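{- Let $F(x,y,q;1)=\sum_{\nu\in\mathcal{CP}}x^{v(\nu)}y^{h(\nu)}q^{int(\nu)}$. Then $$\begin{aligned}\frac{\partial}{\partial q}F(x,y,q;1)\Big|_{q=1}&=\frac{8x^3y^2\bigl(4x(x^2+6x-1)+4x(5x+11)(y-x-1)+(6x^2+29x+17)(y-x-1)^2\bigr)}{((1+x-y)^2-4x)^4}\\&\quad+\frac{x^2y^2(y-x-1)^3\bigl(40x(2x+1)+2(x^2+11x-8)(y-x-1)+(y-x-1)^2(y+x-1)\bigr)}{((1+x-y)^2-4x)^4}\\&\quad+\frac{4x^2y^2(4-3(x+y)-(x-y)^2)}{\sqrt{(1+x-y)^2-4x}^{\,5}}.\end{aligned}$$
   Context: A cell is a unit square in the plane with sides parallel to the axes and center at an integer point. A polyomino is a finite edge-connected set of cells, considered up to translation; it is convex if each of its columns (cells with a common center $x$-coordinate) and each of its rows (cells with a common center $y$-coordinate) is a contiguous block. $\mathcal{CP}$ is the set of nonempty convex polyominoes up to translation; $v(\nu)$ and $h(\nu)$ are the numbers of columns and rows of $\nu$, and $int(\nu)$ is the number of interior vertices of $\nu$, i.e. corner points that are vertices of four distinct cells of $\nu$. -}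

module Defs where

open import Data.Nat as ℕ using (ℕ; zero; suc; _≤_; _<_; _∸_)
open import Data.Integer as ℤ using (ℤ; +_; -_)
open import Data.Bool using (Bool; true; false; _∧_; if_then_else_)
open import Data.Vec using (Vec; []; _∷_)
open import Data.List using (List; map; upTo; foldr)
open import Data.List.Membership.Propositional using (_∈_)
open import Data.List.Relation.Unary.Unique.Propositional using (Unique)
open import Data.Product using (Σ; ∃; ∃-syntax; _×_; _,_)
open import Data.Sum using (_⊎_)
open import Function.Bundles using (_⇔_)
open import Relation.Binary.PropositionalEquality using (_≡_)

-- Bivariate formal power series in x, y with integer coefficients:
-- a series is its coefficient function, (f m n) = [x^m y^n] f.

Series : Set
Series = ℕ → ℕ → ℤ

sumℤ : List ℤ → ℤ
sumℤ = foldr ℤ._+_ (+ 0)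

sumℕ : List ℕ → ℕ
sumℕ = foldr ℕ._+_ 0

infixl 6 _⊕_ _⊖_
infixl 7 _⊛_
infixr 8 _^ₛ_
infix 4 _≈ₛ_

_⊕_ : Series → Series → Series
(f ⊕ g) m n = f m n ℤ.+ g m n

_⊖_ : Series → Series → Series
(f ⊖ g) m n = f m n ℤ.- g m n

_⊛_ : Series → Series → Series
(f ⊛ g) m n =
  sumℤ (map (λ i → sumℤ (map (λ j → f i j ℤ.* g (m ∸ i) (n ∸ j)) (upTo (suc n))))
            (upTo (suc m)))

cst : ℤ → Series
cst c zero zero = c
cst c _ _ = + 0

𝟙 : Series
𝟙 = cst (+ 1)

𝕏 : Series
𝕏 (suc zero) zero = + 1
𝕏 _ _ = + 0

𝕐 : Series
𝕐 zero (suc zero) = + 1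
𝕐 _ _ = + 0

_^ₛ_ : Series → ℕ → Series
f ^ₛ zero = 𝟙
f ^ₛ suc k = f ⊛ (f ^ₛ k)

_≈ₛ_ : Series → Series → Set
f ≈ₛ g = ∀ m n → f m n ≡ g m n

D : Series
D = (𝟙 ⊕ 𝕏 ⊖ 𝕐) ^ₛ 2 ⊖ cst (+ 4) ⊛ 𝕏

w : Series
w = 𝕐 ⊖ 𝕏 ⊖ 𝟙

P₁ : Series
P₁ = cst (+ 8) ⊛ 𝕏 ^ₛ 3 ⊛ 𝕐 ^ₛ 2 ⊛
     ( cst (+ 4) ⊛ 𝕏 ⊛ (𝕏 ^ₛ 2 ⊕ cst (+ 6) ⊛ 𝕏 ⊖ 𝟙)
     ⊕ cst (+ 4) ⊛ 𝕏 ⊛ (cst (+ 5) ⊛ 𝕏 ⊕ cst (+ 11)) ⊛ w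
     ⊕ (cst (+ 6) ⊛ 𝕏 ^ₛ 2 ⊕ cst (+ 29) ⊛ 𝕏 ⊕ cst (+ 17)) ⊛ w ^ₛ 2 )

P₂ : Series
P₂ = 𝕏 ^ₛ 2 ⊛ 𝕐 ^ₛ 2 ⊛ w ^ₛ 3 ⊛
     ( cst (+ 40) ⊛ 𝕏 ⊛ (cst (+ 2) ⊛ 𝕏 ⊕ 𝟙)
     ⊕ cst (+ 2) ⊛ (𝕏 ^ₛ 2 ⊕ cst (+ 11) ⊛ 𝕏 ⊖ cst (+ 8)) ⊛ w
     ⊕ w ^ₛ 2 ⊛ (𝕐 ⊕ 𝕏 ⊖ 𝟙) )

P₃ : Series
P₃ = cst (+ 4) ⊛ 𝕏 ^ₛ 2 ⊛ 𝕐 ^ₛ 2 ⊛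
     (cst (+ 4) ⊖ cst (+ 3) ⊛ (𝕏 ⊕ 𝕐) ⊖ (𝕏 ⊖ 𝕐) ^ₛ 2)

-- Convex polyominoes.
-- A polyomino with exactly m columns and n rows, normalised by translation
-- so that its leftmost column is x = 0 and its lowest row is y = 0, is a
-- set of cells inside the box {0..m-1} × {0..n-1}.  We store it as a grid:
-- g : Grid m n, the i-th entry (column x = i) being a vector over rows y.

Grid : ℕ → ℕ → Set
Grid m n = Vec (Vec Bool n) m

colAt : ∀ {k} → Vec Bool k → ℕ → Bool
colAt [] _ = false
colAt (b ∷ _) zero = b
colAt (_ ∷ bs) (suc j) = colAt bs j

-- at g i j = is the cell centred at (i , j) in g (false outside the box)
at : ∀ {m n} → Grid m n → ℕ → ℕ → Bool
at [] _ _ = false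
at (c ∷ _) zero j = colAt c j
at (_ ∷ cs) (suc i) j = at cs i j

Cell : ∀ {m n} → Grid m n → ℕ → ℕ → Set
Cell g i j = at g i j ≡ true

Adjacent : ℕ × ℕ → ℕ × ℕ → Set
Adjacent (i , j) (i' , j') =
  (i ≡ i' × (j' ≡ suc j ⊎ j ≡ suc j')) ⊎ (j ≡ j' × (i' ≡ suc i ⊎ i ≡ suc i'))

data Path {m n} (g : Grid m n) : ℕ × ℕ → ℕ × ℕ → Set where
  here : ∀ {i j} → Cell g i j → Path g (i , j) (i , j)
  step : ∀ {i j c d} → Cell g i j → Adjacent (i , j) c → Path g c d →
         Path g (i , j) d

EdgeConnected : ∀ {m n} → Grid m n → Set
EdgeConnected g = ∀ i j i' j' → Cell g i j → Cell g i' j' → Path g (i , j) (i' , j')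

Nonempty : ∀ {m n} → Grid m n → Set
Nonempty g = ∃[ i ] ∃[ j ] Cell g i j

ColumnConvex : ∀ {m n} → Grid m n → Set
ColumnConvex g = ∀ i j₁ j₂ j → Cell g i j₁ → Cell g i j₂ → j₁ ≤ j → j ≤ j₂ → Cell g i j

RowConvex : ∀ {m n} → Grid m n → Set
RowConvex g = ∀ j i₁ i₂ i → Cell g i₁ j → Cell g i₂ j → i₁ ≤ i → i ≤ i₂ → Cell g i j

-- the polyomino has exactly m columns and n rows (and is normalised):
-- every x-coordinate 0..m-1 and every y-coordinate 0..n-1 is used
FillsColumns : ∀ {m n} → Grid m n → Set
FillsColumns {m} g = ∀ i → i < m → ∃[ j ] Cell g i j

FillsRows : ∀ {m n} → Grid m n → Set
FillsRows {n = n} g = ∀ j → j < n → ∃[ i ] Cell g i j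

-- g represents (the translation class of) a nonempty convex polyomino ν
-- with v(ν) = m and h(ν) = n
IsCP : ∀ {m n} → Grid m n → Set
IsCP g = Nonempty g × EdgeConnected g × ColumnConvex g × RowConvex g
         × FillsColumns g × FillsRows g

-- number of interior vertices: corner points (i+1/2, j+1/2) shared by the
-- four cells (i,j), (i+1,j), (i,j+1), (i+1,j+1)
int : ∀ {m n} → Grid m n → ℕ
int {m} {n} g =
  sumℕ (map (λ i → sumℕ (map (λ j →
    if at g i j ∧ at g (suc i) j ∧ at g i (suc j) ∧ at g (suc i) (suc j)
    then 1 else 0) (upTo n))) (upTo m))

IntSum : ℕ → ℕ → ℕ → Set
IntSum m n k =
  Σ (List (Grid m n)) λ L →
    Unique L × (∀ g → (g ∈ L) ⇔ IsCP g) × sumℕ (map int L) ≡ k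

{-# OPTIONS --safe #-}
-- A convex polyomino is read column by column. The numbers of empty cells below its columns first weakly decrease to 0 and
-- then weakly increase, and so do the numbers of empty cells above them; hence the ways to continue depend only on the
-- height h of the last column and on which of its two sides have begun to contract: both (C), one (B) or none (A).
-- Counted with weight q ^ int modulo (q − 1)², the continuations satisfy a linear system of recurrences in h, whose
-- solution is unique by induction on the degree in x. Under x = X (1 − Y), y = Y (1 − X) one has D = (1 − X − Y)², and the
-- solution is a combination of the sequences (1 − X)^(-h) and (1 ± √x)^(-h) whose coefficients are quadratic polynomials
-- in h over the rational functions of X and Y with denominator a power of 1 − X − Y. It was found by computer algebra;
-- checking it, and comparing its value with the claimed series, amounts to polynomial identities.
module Submission where

-- Where the sequences in h come from: look for solutions of ratio r without weights. In state C the
-- condition is (1 - 1/r)² = x, so r = 1 / (1 ± √x). In state B it is (r - 1)(1 - y r) = x r, whose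
-- only power series root is r = 1 / (1 - X); the other one is 1 / Y. In state A it is (1 - y r)² =
-- x, and r = (1 ± √x) / y is no power series, so A is driven by B and C alone. The factor h
-- produced by the weights meets the same ratios again, and this resonance raises the degree in h to
-- two. Three devices keep the verification polynomial. √x never occurs, because even and odd parts
-- in √x are carried separately. The index h is only ever lowered, because the values at h are
-- polynomial in those at h + 1, while the converse needs inverses of 1 - x and 1 - X. The common
-- denominator 4 (1 - X - Y)⁸ is multiplied into the counts instead of being divided out of the
-- closed form.

open import Defs
open import Level using (0ℓ)
open import Algebra.Bundles using (CommutativeRing)
import Algebra.Construct.Pointwise as PointwiseAlgebra
open import Data.Bool using (Bool; true; false; _∧_; if_then_else_)
open import Data.Bool.Properties using (∧-comm; T-≡)
open import Data.Fin using (Fin; #_)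
open import Data.Integer as ℤ using (ℤ; +_)
import Data.Integer.Properties as ℤₚ
open import Data.List as List using (List; []; _∷_; _++_; map; filter; upTo; foldr; cartesianProductWith)
open import Data.List.Membership.Propositional using (_∈_)
open import Data.List.Membership.Propositional.Properties
open import Data.List.Properties using (map-applyUpTo)
import Data.List.Relation.Unary.All as ListAll
open import Data.List.Relation.Unary.Any using (here; there)
open import Data.List.Relation.Unary.Unique.Propositional using (Unique; []; _∷_)
import Data.List.Relation.Unary.Unique.Propositional.Properties as Uniqueₚ
open import Data.Nat as ℕ using (ℕ; zero; suc; _∸_; _<_; z≤n; s≤s; z<s; s<s)
import Data.Nat.Properties as ℕₚ
open import Data.Nat.Tactic.RingSolver using (solve-∀)
open import Data.Product using (Σ; ∃-syntax; _×_; _,_; proj₁; proj₂)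
open import Data.Sum using (_⊎_; inj₁; inj₂)
open import Data.Unit using (⊤; tt)
open import Data.Vec as Vec using (Vec; []; _∷_; replicate)
open import Data.Vec.Properties using (∷-injective)
open import Data.Vec.Relation.Binary.Pointwise.Inductive as Pointwise using (Pointwise; []; _∷_)
open import Data.Vec.Relation.Unary.All as All using (All; []; _∷_)
open import Function using (_∘_; id; Equivalence)
open import Function.Bundles using (_⇔_; mk⇔)
open import Relation.Binary.PropositionalEquality as ≡ using (_≡_)
open import Relation.Nullary using (¬_; Dec; yes; no; does; contradiction)

-- Power series

module PowerSeries (R : CommutativeRing 0ℓ 0ℓ) where
  open CommutativeRing R
  open import Relation.Binary.Reasoning.Setoid setoid
  open import Algebra.Properties.CommutativeSemigroup +-commutativeSemigroup using (interchange; x∙yz≈y∙xz)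

  tail : (ℕ → Carrier) → ℕ → Carrier
  tail f = f ∘ suc

  conv : (ℕ → Carrier) → (ℕ → Carrier) → ℕ → Carrier
  conv f g zero    = f 0 * g 0
  conv f g (suc n) = f 0 * g (suc n) + conv (tail f) g n

  const : Carrier → ℕ → Carrier
  const c zero    = c
  const c (suc _) = 0#

  conv-cong : ∀ {f f′ g g′} → (∀ n → f n ≈ f′ n) → (∀ n → g n ≈ g′ n) → ∀ n → conv f g n ≈ conv f′ g′ n
  conv-cong p q zero    = *-cong (p 0) (q 0)
  conv-cong p q (suc n) = +-cong (*-cong (p 0) (q (suc n))) (conv-cong (p ∘ suc) q n)

  conv-scaleˡ : ∀ c f g n → conv (λ k → c * f k) g n ≈ c * conv f g n
  conv-scaleˡ c f g zero    = *-assoc c (f 0) (g 0)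
  conv-scaleˡ c f g (suc n) = begin
    c * f 0 * g (suc n) + conv (λ k → c * f (suc k)) g n ≈⟨ +-cong (*-assoc c _ _) (conv-scaleˡ c (tail f) g n) ⟩
    c * (f 0 * g (suc n)) + c * conv (tail f) g n         ≈⟨ distribˡ c _ _ ⟨
    c * conv f g (suc n)                                   ∎

  conv-distribʳ : ∀ h f g n → conv (λ k → f k + g k) h n ≈ conv f h n + conv g h n
  conv-distribʳ h f g zero    = distribʳ (h 0) (f 0) (g 0)
  conv-distribʳ h f g (suc n) = begin
    (f 0 + g 0) * h (suc n) + conv (λ k → f (suc k) + g (suc k)) h n
      ≈⟨ +-cong (distribʳ _ _ _) (conv-distribʳ h (tail f) (tail g) n) ⟩
    (f 0 * h (suc n) + g 0 * h (suc n)) + (conv (tail f) h n + conv (tail g) h n)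
      ≈⟨ interchange _ _ _ _ ⟩
    conv f h (suc n) + conv g h (suc n) ∎

  conv-sucʳ : ∀ f g n → conv f g (suc n) ≈ f (suc n) * g 0 + conv f (tail g) n
  conv-sucʳ f g zero    = +-comm _ _
  conv-sucʳ f g (suc n) = begin
    f 0 * g (suc (suc n)) + conv (tail f) g (suc n)
      ≈⟨ +-congˡ (conv-sucʳ (tail f) g n) ⟩
    f 0 * g (suc (suc n)) + (f (suc (suc n)) * g 0 + conv (tail f) (tail g) n)
      ≈⟨ x∙yz≈y∙xz _ _ _ ⟩
    f (suc (suc n)) * g 0 + conv f (tail g) (suc n) ∎

  conv-comm : ∀ f g n → conv f g n ≈ conv g f n
  conv-comm f g zero    = *-comm _ _
  conv-comm f g (suc n) = begin
    f 0 * g (suc n) + conv (tail f) g n ≈⟨ +-cong (*-comm _ _) (conv-comm (tail f) g n) ⟩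
    g (suc n) * f 0 + conv g (tail f) n ≈⟨ conv-sucʳ g f n ⟨
    conv g f (suc n) ∎

  conv-assoc : ∀ f g h n → conv (conv f g) h n ≈ conv f (conv g h) n
  conv-assoc f g h zero    = *-assoc _ _ _
  conv-assoc f g h (suc n) = begin
    f 0 * g 0 * h (suc n) + conv (λ k → f 0 * g (suc k) + conv (tail f) g k) h n
      ≈⟨ +-cong (*-assoc _ _ _) (conv-distribʳ h _ _ n) ⟩
    f 0 * (g 0 * h (suc n)) + (conv (λ k → f 0 * g (suc k)) h n + conv (conv (tail f) g) h n)
      ≈⟨ +-congˡ (+-cong (conv-scaleˡ (f 0) (tail g) h n) (conv-assoc (tail f) g h n)) ⟩
    f 0 * (g 0 * h (suc n)) + (f 0 * conv (tail g) h n + conv (tail f) (conv g h) n)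
      ≈⟨ +-assoc _ _ _ ⟨
    (f 0 * (g 0 * h (suc n)) + f 0 * conv (tail g) h n) + conv (tail f) (conv g h) n
      ≈⟨ +-congʳ (distribˡ _ _ _) ⟨
    conv f (conv g h) (suc n) ∎

  conv-zeroˡ : ∀ f g → (∀ k → f k ≈ 0#) → ∀ n → conv f g n ≈ 0#
  conv-zeroˡ f g p zero    = trans (*-congʳ (p 0)) (zeroˡ _)
  conv-zeroˡ f g p (suc n) =
    trans (+-cong (trans (*-congʳ (p 0)) (zeroˡ _)) (conv-zeroˡ (tail f) g (p ∘ suc) n)) (+-identityˡ _)

  conv-const : ∀ c g n → conv (const c) g n ≈ c * g n
  conv-const c g zero    = refl
  conv-const c g (suc n) = trans (+-congˡ (conv-zeroˡ _ g (λ _ → refl) n)) (+-identityʳ _)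

  conv-shift : ∀ f g → f 0 ≈ 0# → ∀ n → conv f g (suc n) ≈ conv (tail f) g n
  conv-shift f g p n = trans (+-congʳ (trans (*-congʳ p) (zeroˡ _))) (+-identityˡ _)

  -- Only the constant term of `g` has to be a non-zero-divisor: once f 0 = 0 is known, the lowest
  -- term drops out and the tail of `f` satisfies the same hypothesis. The coefficient ring is
  -- arbitrary, so the lemma applies first in y and then, with its own conclusion as hypothesis, in
  -- x.
  cancel : ∀ g → (∀ a → a * g 0 ≈ 0# → a ≈ 0#) → ∀ f → (∀ n → conv f g n ≈ 0#) → ∀ n → f n ≈ 0#
  cancel g nzd f p zero    = nzd (f 0) (p 0)
  cancel g nzd f p (suc n) = cancel g nzd (tail f) q n
    where
    q : ∀ n → conv (tail f) g n ≈ 0#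
    q n = trans (sym (conv-shift f g (nzd (f 0) (p 0)) n)) (p (suc n))

  commutativeRing : CommutativeRing 0ℓ 0ℓ
  commutativeRing = record
    { Carrier = ℕ → Carrier ; _≈_ = λ f g → ∀ n → f n ≈ g n
    ; _+_ = λ f g n → f n + g n ; _*_ = conv ; -_ = λ f n → - f n
    ; 0# = λ _ → 0# ; 1# = const 1#
    ; isCommutativeRing = record
      { isRing = record
        { +-isAbelianGroup = PointwiseAlgebra.isAbelianGroup ℕ +-isAbelianGroup
        ; *-cong = conv-cong
        ; *-assoc = conv-assoc
        ; *-identity = identityˡ , λ f n → trans (conv-comm f _ n) (identityˡ f n)
        ; distrib = (λ h f g n → trans (conv-comm h _ n) (trans (conv-distribʳ h f g n)
                       (+-cong (conv-comm f h n) (conv-comm g h n))))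
                  , conv-distribʳ
        }
      ; *-comm = conv-comm
      }
    }
    where
    identityˡ : ∀ f n → conv (const 1#) f n ≈ f n
    identityˡ f n = trans (conv-const 1# f n) (*-identityˡ (f n))

-- Series in x and y as nested power series

module ℤ⟦y⟧   = PowerSeries ℤₚ.+-*-commutativeRing
module ℤ⟦y⟧⟦x⟧ = PowerSeries ℤ⟦y⟧.commutativeRing

private
  module Nested = CommutativeRing ℤ⟦y⟧⟦x⟧.commutativeRing

sumℤ-upTo : ∀ (F : ℕ → ℤ) n → sumℤ (map F (upTo (suc n))) ≡ F 0 ℤ.+ sumℤ (map (F ∘ suc) (upTo n))
sumℤ-upTo F n = ≡.cong (λ l → F 0 ℤ.+ sumℤ l)
  (≡.trans (map-applyUpTo suc F n) (≡.sym (map-applyUpTo id (F ∘ suc) n)))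

sumℤ-cong : ∀ {F G : ℕ → ℤ} n → (∀ i → i ℕ.< n → F i ≡ G i) → sumℤ (map F (upTo n)) ≡ sumℤ (map G (upTo n))
sumℤ-cong         zero    p = ≡.refl
sumℤ-cong {F} {G} (suc n) p = ≡.trans (sumℤ-upTo F n) (≡.trans
  (≡.cong₂ ℤ._+_ (p 0 ℕ.z<s) (sumℤ-cong n (λ i i<n → p (suc i) (ℕ.s<s i<n)))) (≡.sym (sumℤ-upTo G n)))

row-product : ∀ (f g : ℕ → ℤ) n → sumℤ (map (λ j → f j ℤ.* g (n ℕ.∸ j)) (upTo (suc n))) ≡ ℤ⟦y⟧.conv f g n
row-product f g zero    = ℤₚ.+-identityʳ _
row-product f g (suc n) =
  ≡.trans (sumℤ-upTo (λ j → f j ℤ.* g (suc n ℕ.∸ j)) (suc n)) (≡.cong (ℤ._+_ (f 0 ℤ.* g (suc n))) (row-product (f ∘ suc) g n))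

-- The double sum with truncated subtraction is awkward for induction, whereas `conv` recurs on the
-- first factor; all ring laws of `_⊛_` are transported along this equality.
⊛-conv : ∀ f g → f ⊛ g ≈ₛ ℤ⟦y⟧⟦x⟧.conv f g
⊛-conv f g m n = ≡.trans (sumℤ-cong (suc m) (λ i _ → row-product (f i) (g (m ℕ.∸ i)) n)) (column f m)
  where
  column : ∀ f m → sumℤ (map (λ i → ℤ⟦y⟧.conv (f i) (g (m ℕ.∸ i)) n) (upTo (suc m))) ≡ ℤ⟦y⟧⟦x⟧.conv f g m n
  column f zero    = ℤₚ.+-identityʳ _
  column f (suc m) = ≡.trans (sumℤ-upTo (λ i → ℤ⟦y⟧.conv (f i) (g (suc m ℕ.∸ i)) n) (suc m))
    (≡.cong (ℤ._+_ (ℤ⟦y⟧.conv (f 0) (g (suc m)) n)) (column (f ∘ suc) m))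

𝟙-const : 𝟙 ≈ₛ Nested.1#
𝟙-const zero    zero    = ≡.refl
𝟙-const zero    (suc n) = ≡.refl
𝟙-const (suc m) n       = ≡.refl

neg : Series → Series
neg f m n = ℤ.- f m n

seriesRing : CommutativeRing 0ℓ 0ℓ
seriesRing = record
  { Carrier = Series ; _≈_ = _≈ₛ_ ; _+_ = _⊕_ ; _*_ = _⊛_ ; -_ = neg ; 0# = Nested.0# ; 1# = 𝟙
  ; isCommutativeRing = record
    { isRing = record
      { +-isAbelianGroup = Nested.+-isAbelianGroup
      ; *-cong = cong
      ; *-assoc = λ f g h → Nested.trans (⊛-conv (f ⊛ g) h) (Nested.trans (Nested.*-congʳ (⊛-conv f g))
          (Nested.trans (Nested.*-assoc f g h) (Nested.sym (Nested.trans (⊛-conv f (g ⊛ h)) (Nested.*-congˡ {f} (⊛-conv g h))))))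
      ; *-identity = identityˡ , λ f → Nested.trans (comm f 𝟙) (identityˡ f)
      ; distrib = (λ h f g → Nested.trans (⊛-conv h (f ⊕ g)) (Nested.trans (Nested.distribˡ h f g)
                    (Nested.sym (Nested.+-cong (⊛-conv h f) (⊛-conv h g)))))
                , (λ h f g → Nested.trans (⊛-conv (f ⊕ g) h) (Nested.trans (Nested.distribʳ h f g)
                    (Nested.sym (Nested.+-cong (⊛-conv f h) (⊛-conv g h)))))
      }
    ; *-comm = comm
    }
  }
  where
  cong : ∀ {f f′ g g′} → f ≈ₛ f′ → g ≈ₛ g′ → f ⊛ g ≈ₛ f′ ⊛ g′
  cong {f} {f′} {g} {g′} p q = Nested.trans (⊛-conv f g) (Nested.trans (Nested.*-cong p q) (Nested.sym (⊛-conv f′ g′)))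
  comm : ∀ f g → f ⊛ g ≈ₛ g ⊛ f
  comm f g = Nested.trans (⊛-conv f g) (Nested.trans (Nested.*-comm f g) (Nested.sym (⊛-conv g f)))
  identityˡ : ∀ f → 𝟙 ⊛ f ≈ₛ f
  identityˡ f = Nested.trans (⊛-conv 𝟙 f) (Nested.trans (Nested.*-congʳ 𝟙-const) (Nested.*-identityˡ f))

-- Polynomial identities

infixl 6 _:+_ _:-_
infixl 7 _:*_
infixr 8 _:^_

data Expr (k : ℕ) : Set where
  con  : ℤ → Expr k
  var  : Fin k → Expr k
  _:+_ _:-_ _:*_ : Expr k → Expr k → Expr k
  _:^_ : Expr k → ℕ → Expr k

substitute : ∀ {j k} → Vec (Expr k) j → Expr j → Expr k
substitute σ (con c)   = con c
substitute σ (var i)   = Vec.lookup σ i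
substitute σ (e :+ e′) = substitute σ e :+ substitute σ e′
substitute σ (e :- e′) = substitute σ e :- substitute σ e′
substitute σ (e :* e′) = substitute σ e :* substitute σ e′
substitute σ (e :^ j)  = substitute σ e :^ j

-- Dense Horner form: the list of coefficients of the first variable, constant term first.
Poly : ℕ → Set
Poly zero    = ℤ
Poly (suc k) = List (Poly k)

constᵖ : ∀ k → ℤ → Poly k
constᵖ zero    c = c
constᵖ (suc k) c = constᵖ k c ∷ []

varᵖ : ∀ k → Fin k → Poly k
varᵖ (suc k) Fin.zero    = constᵖ k (+ 0) ∷ constᵖ k (+ 1) ∷ []
varᵖ (suc k) (Fin.suc i) = varᵖ k i ∷ []

negᵖ : ∀ k → Poly k → Poly k
negᵖ zero    c = ℤ.- c
negᵖ (suc k) p = List.map (negᵖ k) p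

addᵖ : ∀ k → Poly k → Poly k → Poly k
addᵖ zero    c       d       = c ℤ.+ d
addᵖ (suc k) []      q       = q
addᵖ (suc k) p       []      = p
addᵖ (suc k) (a ∷ p) (b ∷ q) = addᵖ k a b ∷ addᵖ (suc k) p q

mulᵖ : ∀ k → Poly k → Poly k → Poly k
mulᵖ zero    c       d = c ℤ.* d
mulᵖ (suc k) []      q = []
mulᵖ (suc k) (a ∷ p) q = addᵖ (suc k) (List.map (mulᵖ k a) q) (constᵖ k (+ 0) ∷ mulᵖ (suc k) p q)

powᵖ : ∀ k → Poly k → ℕ → Poly k
powᵖ k p zero    = constᵖ k (+ 1)
powᵖ k p (suc j) = mulᵖ k p (powᵖ k p j)

normalise : ∀ {k} → Expr k → Poly k
normalise {k} (con c)   = constᵖ k c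
normalise {k} (var i)   = varᵖ k i
normalise {k} (e :+ e′) = addᵖ k (normalise e) (normalise e′)
normalise {k} (e :- e′) = addᵖ k (normalise e) (negᵖ k (normalise e′))
normalise {k} (e :* e′) = mulᵖ k (normalise e) (normalise e′)
normalise {k} (e :^ j)  = powᵖ k (normalise e) j

isZero : ∀ k → Poly k → Bool
isZero zero    c       = does (c ℤ.≟ + 0)
isZero (suc k) []      = true
isZero (suc k) (a ∷ p) = isZero k a ∧ isZero (suc k) p

-- Constants, subtraction and powers are fields rather than derived operations. The series instance
-- can then use `cst`, `_⊖_` and `_^ₛ_` themselves, so that an evaluated expression is
-- definitionally a series of the statement.
record ℤ-Algebra : Set₁ where
  infixl 6 _-_
  infixr 8 _^_
  field
    commutativeRing : CommutativeRing 0ℓ 0ℓ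
  open CommutativeRing commutativeRing public hiding (_-_)
  field
    ι     : ℤ → Carrier
    ι-0   : ι (+ 0) ≈ 0#
    ι-1   : ι (+ 1) ≈ 1#
    ι-+   : ∀ a b → ι (a ℤ.+ b) ≈ ι a + ι b
    ι-*   : ∀ a b → ι (a ℤ.* b) ≈ ι a * ι b
    ι-neg : ∀ a → ι (ℤ.- a) ≈ - ι a
    _-_   : Carrier → Carrier → Carrier
    -‿def : ∀ a b → a - b ≈ a + - b
    _^_   : Carrier → ℕ → Carrier
    ^-0   : ∀ a → a ^ 0 ≈ 1#
    ^-suc : ∀ a k → a ^ suc k ≈ a * a ^ k

module Identities (𝔸 : ℤ-Algebra) where
  open ℤ-Algebra 𝔸

  ⟦_⟧ : ∀ {k} → Expr k → Vec Carrier k → Carrier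
  ⟦ con c ⟧    ρ = ι c
  ⟦ var i ⟧    ρ = Vec.lookup ρ i
  ⟦ e :+ e′ ⟧  ρ = ⟦ e ⟧ ρ + ⟦ e′ ⟧ ρ
  ⟦ e :- e′ ⟧  ρ = ⟦ e ⟧ ρ - ⟦ e′ ⟧ ρ
  ⟦ e :* e′ ⟧  ρ = ⟦ e ⟧ ρ * ⟦ e′ ⟧ ρ
  ⟦ e :^ j ⟧   ρ = ⟦ e ⟧ ρ ^ j

  eval : ∀ k → Poly k → Vec Carrier k → Carrier
  eval zero    c       []      = ι c
  eval (suc k) []      ρ       = 0#
  eval (suc k) (a ∷ p) (v ∷ ρ) = eval k a ρ + v * eval (suc k) p (v ∷ ρ)

  private
    open import Relation.Binary.Reasoning.Setoid setoid
    open import Algebra.Properties.Ring (CommutativeRing.ring commutativeRing) using (-‿distribʳ-*; -‿+-comm; -0#≈0#)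
    open import Algebra.Properties.Group +-group using () renaming (x∙y⁻¹≈ε⇒x≈y to x-y≈0⇒x≈y)
    open import Algebra.Properties.CommutativeSemigroup +-commutativeSemigroup using (interchange)
    open import Algebra.Properties.CommutativeSemigroup *-commutativeSemigroup using (x∙yz≈y∙xz)

    +0* : ∀ a v → a + v * 0# ≈ a
    +0* a v = trans (+-congˡ (zeroʳ v)) (+-identityʳ a)

    eval-const : ∀ k c ρ → eval k (constᵖ k c) ρ ≈ ι c
    eval-const zero    c []      = refl
    eval-const (suc k) c (v ∷ ρ) = trans (+0* (eval k (constᵖ k c) ρ) v) (eval-const k c ρ)

    eval-var : ∀ k i ρ → eval k (varᵖ k i) ρ ≈ Vec.lookup ρ i
    eval-var (suc k) Fin.zero (v ∷ ρ) = begin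
      eval k (constᵖ k (+ 0)) ρ + v * (eval k (constᵖ k (+ 1)) ρ + v * 0#)
        ≈⟨ +-cong (trans (eval-const k (+ 0) ρ) ι-0) (*-congˡ (trans (+0* (eval k (constᵖ k (+ 1)) ρ) v) (trans (eval-const k (+ 1) ρ) ι-1))) ⟩
      0# + v * 1# ≈⟨ +-identityˡ (v * 1#) ⟩
      v * 1#        ≈⟨ *-identityʳ v ⟩
      v             ∎
    eval-var (suc k) (Fin.suc i) (v ∷ ρ) = trans (+0* (eval k (varᵖ k i) ρ) v) (eval-var k i ρ)

    eval-neg : ∀ k p ρ → eval k (negᵖ k p) ρ ≈ - (eval k p ρ)
    eval-neg zero    c       []      = ι-neg c
    eval-neg (suc k) []      ρ       = sym -0#≈0#
    eval-neg (suc k) (a ∷ p) (v ∷ ρ) = begin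
      eval k (negᵖ k a) ρ + v * eval (suc k) (negᵖ (suc k) p) (v ∷ ρ)
        ≈⟨ +-cong (eval-neg k a ρ) (*-congˡ (eval-neg (suc k) p (v ∷ ρ))) ⟩
      (- A) + v * (- B)   ≈⟨ +-congˡ (-‿distribʳ-* v B) ⟨
      (- A) + (- (v * B)) ≈⟨ -‿+-comm A (v * B) ⟩
      - (A + v * B)     ∎
      where A = eval k a ρ ; B = eval (suc k) p (v ∷ ρ)

    eval-add : ∀ k p q ρ → eval k (addᵖ k p q) ρ ≈ eval k p ρ + eval k q ρ
    eval-add zero    c       d       []      = ι-+ c d
    eval-add (suc k) []      q       ρ       = sym (+-identityˡ (eval (suc k) q ρ))
    eval-add (suc k) (a ∷ p) []      ρ       = sym (+-identityʳ (eval (suc k) (a ∷ p) ρ))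
    eval-add (suc k) (a ∷ p) (b ∷ q) (v ∷ ρ) = begin
      eval k (addᵖ k a b) ρ + v * eval (suc k) (addᵖ (suc k) p q) (v ∷ ρ)
        ≈⟨ +-cong (eval-add k a b ρ) (*-congˡ (eval-add (suc k) p q (v ∷ ρ))) ⟩
      (A + B) + v * (P + Q)       ≈⟨ +-congˡ (distribˡ v P Q) ⟩
      (A + B) + (v * P + v * Q)   ≈⟨ interchange A B (v * P) (v * Q) ⟩
      (A + v * P) + (B + v * Q)   ∎
      where A = eval k a ρ ; B = eval k b ρ ; P = eval (suc k) p (v ∷ ρ) ; Q = eval (suc k) q (v ∷ ρ)

    eval-mul : ∀ k p q ρ → eval k (mulᵖ k p q) ρ ≈ eval k p ρ * eval k q ρ
    eval-map : ∀ k a q v ρ → eval (suc k) (List.map (mulᵖ k a) q) (v ∷ ρ) ≈ eval k a ρ * eval (suc k) q (v ∷ ρ)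

    eval-mul zero    c       d []      = ι-* c d
    eval-mul (suc k) []      q ρ       = sym (zeroˡ (eval (suc k) q ρ))
    eval-mul (suc k) (a ∷ p) q (v ∷ ρ) = begin
      eval (suc k) (addᵖ (suc k) (List.map (mulᵖ k a) q) (constᵖ k (+ 0) ∷ mulᵖ (suc k) p q)) (v ∷ ρ)
        ≈⟨ eval-add (suc k) (List.map (mulᵖ k a) q) _ (v ∷ ρ) ⟩
      eval (suc k) (List.map (mulᵖ k a) q) (v ∷ ρ) + (eval k (constᵖ k (+ 0)) ρ + v * eval (suc k) (mulᵖ (suc k) p q) (v ∷ ρ))
        ≈⟨ +-cong (eval-map k a q v ρ) (+-cong (trans (eval-const k (+ 0) ρ) ι-0) (*-congˡ (eval-mul (suc k) p q (v ∷ ρ)))) ⟩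
      A * Q + (0# + v * (P * Q)) ≈⟨ +-congˡ (+-identityˡ (v * (P * Q))) ⟩
      A * Q + v * (P * Q)           ≈⟨ +-congˡ (*-assoc v P Q) ⟨
      A * Q + v * P * Q             ≈⟨ distribʳ Q A (v * P) ⟨
      (A + v * P) * Q               ∎
      where A = eval k a ρ ; P = eval (suc k) p (v ∷ ρ) ; Q = eval (suc k) q (v ∷ ρ)

    eval-map k a []      v ρ = sym (zeroʳ (eval k a ρ))
    eval-map k a (b ∷ q) v ρ = begin
      eval k (mulᵖ k a b) ρ + v * eval (suc k) (List.map (mulᵖ k a) q) (v ∷ ρ)
        ≈⟨ +-cong (eval-mul k a b ρ) (*-congˡ (eval-map k a q v ρ)) ⟩
      A * B + v * (A * Q) ≈⟨ +-congˡ (x∙yz≈y∙xz v A Q) ⟩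
      A * B + A * (v * Q) ≈⟨ distribˡ A B (v * Q) ⟨
      A * (B + v * Q)     ∎
      where A = eval k a ρ ; B = eval k b ρ ; Q = eval (suc k) q (v ∷ ρ)

    eval-normalise : ∀ {k} (e : Expr k) ρ → eval k (normalise e) ρ ≈ ⟦ e ⟧ ρ
    eval-normalise {k} (con c) ρ = eval-const k c ρ
    eval-normalise {k} (var i) ρ = eval-var k i ρ
    eval-normalise {k} (e :+ e′) ρ =
      trans (eval-add k (normalise e) (normalise e′) ρ) (+-cong (eval-normalise e ρ) (eval-normalise e′ ρ))
    eval-normalise {k} (e :- e′) ρ =
      trans (eval-add k (normalise e) (negᵖ k (normalise e′)) ρ)
        (trans (+-cong (eval-normalise e ρ) (trans (eval-neg k (normalise e′) ρ) (-‿cong (eval-normalise e′ ρ)))) (sym (-‿def _ _)))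
    eval-normalise {k} (e :* e′) ρ =
      trans (eval-mul k (normalise e) (normalise e′) ρ) (*-cong (eval-normalise e ρ) (eval-normalise e′ ρ))
    eval-normalise {k} (e :^ j) ρ = power j
      where
      power : ∀ j → eval k (powᵖ k (normalise e) j) ρ ≈ ⟦ e ⟧ ρ ^ j
      power zero    = trans (eval-const k (+ 1) ρ) (trans ι-1 (sym (^-0 (⟦ e ⟧ ρ))))
      power (suc j) = trans (eval-mul k (normalise e) (powᵖ k (normalise e) j) ρ) (trans (*-cong (eval-normalise e ρ) (power j)) (sym (^-suc (⟦ e ⟧ ρ) j)))

    eval-zero : ∀ k p ρ → isZero k p ≡ true → eval k p ρ ≈ 0#
    eval-zero zero c [] eq with c ℤ.≟ + 0
    eval-zero zero .(+ 0) [] eq | yes ≡.refl = ι-0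
    eval-zero zero c [] () | no _
    eval-zero (suc k) []      ρ       eq = refl
    eval-zero (suc k) (a ∷ p) (v ∷ ρ) eq with isZero k a in eqa
    ... | true = trans (+-cong (eval-zero k a ρ eqa) (*-congˡ (eval-zero (suc k) p (v ∷ ρ) eq))) (+0* 0# v)

  -- The hypothesis is a closed computation over ℤ, so concrete polynomial identities are proved by
  -- `≡.refl`, whatever the elements in `ρ`. The difference is tested for zero because the dense
  -- form is not canonical: it may carry trailing zeros.
  solve : ∀ {k} (e e′ : Expr k) ρ → isZero k (normalise (e :- e′)) ≡ true → ⟦ e ⟧ ρ ≈ ⟦ e′ ⟧ ρ
  solve {k} e e′ ρ eq = x-y≈0⇒x≈y (⟦ e ⟧ ρ) (⟦ e′ ⟧ ρ) (trans (sym (-‿def (⟦ e ⟧ ρ) (⟦ e′ ⟧ ρ)))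
    (trans (sym (eval-normalise (e :- e′) ρ)) (eval-zero k (normalise (e :- e′)) ρ eq)))

  -‿congᵇ : ∀ {a a′ b b′} → a ≈ a′ → b ≈ b′ → a - b ≈ a′ - b′
  -‿congᵇ p q = trans (-‿def _ _) (trans (+-cong p (-‿cong q)) (sym (-‿def _ _)))

  ^-cong : ∀ {a b} k → a ≈ b → a ^ k ≈ b ^ k
  ^-cong zero    p = trans (^-0 _) (sym (^-0 _))
  ^-cong (suc k) p = trans (^-suc _ k) (trans (*-cong p (^-cong k p)) (sym (^-suc _ k)))

  -- Lets a change of index in the closed form, or the passage from x and y to X and Y, be done on
  -- syntax, where identities can be computed.
  ⟦⟧-subst : ∀ {j k} {σ : Vec (Expr k) j} {ρ ρ′} → Pointwise (λ v e → v ≈ ⟦ e ⟧ ρ) ρ′ σ →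
             ∀ e → ⟦ e ⟧ ρ′ ≈ ⟦ substitute σ e ⟧ ρ
  ⟦⟧-subst p (con c)   = refl
  ⟦⟧-subst p (var i)   = Pointwise.lookup p i
  ⟦⟧-subst p (e :+ e′) = +-cong (⟦⟧-subst p e) (⟦⟧-subst p e′)
  ⟦⟧-subst p (e :- e′) = -‿congᵇ (⟦⟧-subst p e) (⟦⟧-subst p e′)
  ⟦⟧-subst p (e :* e′) = *-cong (⟦⟧-subst p e) (⟦⟧-subst p e′)
  ⟦⟧-subst p (e :^ j)  = ^-cong j (⟦⟧-subst p e)

module 𝕊 = CommutativeRing seriesRing

cst-⊛ : ∀ c f m n → (cst c ⊛ f) m n ≡ c ℤ.* f m n
cst-⊛ c f m n = ≡.trans (⊛-conv (cst c) f m n) (≡.trans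
  (ℤ⟦y⟧⟦x⟧.conv-cong cst-const (λ _ _ → ≡.refl) m n) (≡.trans
  (ℤ⟦y⟧⟦x⟧.conv-const (ℤ⟦y⟧.const c) f m n) (ℤ⟦y⟧.conv-const c (f m) n)))
  where
  cst-const : ∀ m n → cst c m n ≡ ℤ⟦y⟧⟦x⟧.const (ℤ⟦y⟧.const c) m n
  cst-const zero    zero    = ≡.refl
  cst-const zero    (suc n) = ≡.refl
  cst-const (suc m) n       = ≡.refl

cst-+ : ∀ a b → cst (a ℤ.+ b) ≈ₛ cst a ⊕ cst b
cst-+ a b zero    zero    = ≡.refl
cst-+ a b zero    (suc n) = ≡.refl
cst-+ a b (suc m) n       = ≡.refl

cst-* : ∀ a b → cst (a ℤ.* b) ≈ₛ cst a ⊛ cst b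
cst-* a b m n = ≡.trans (scale m n) (≡.sym (cst-⊛ a (cst b) m n))
  where
  scale : ∀ m n → cst (a ℤ.* b) m n ≡ a ℤ.* cst b m n
  scale zero    zero    = ≡.refl
  scale zero    (suc n) = ≡.sym (ℤₚ.*-zeroʳ a)
  scale (suc m) n       = ≡.sym (ℤₚ.*-zeroʳ a)

cst-neg : ∀ a → cst (ℤ.- a) ≈ₛ neg (cst a)
cst-neg a zero    zero    = ≡.refl
cst-neg a zero    (suc n) = ≡.refl
cst-neg a (suc m) n       = ≡.refl

cst-0 : cst (+ 0) ≈ₛ 𝕊.0#
cst-0 zero    zero    = ≡.refl
cst-0 zero    (suc n) = ≡.refl
cst-0 (suc m) n       = ≡.refl

seriesAlgebra : ℤ-Algebra
seriesAlgebra = record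
  { commutativeRing = seriesRing
  ; ι = cst ; ι-0 = cst-0 ; ι-1 = λ _ _ → ≡.refl ; ι-+ = cst-+ ; ι-* = cst-* ; ι-neg = cst-neg
  ; _-_ = _⊖_ ; -‿def = λ _ _ _ _ → ≡.refl
  ; _^_ = _^ₛ_ ; ^-0 = λ _ _ _ → ≡.refl ; ^-suc = λ _ _ _ _ → ≡.refl
  }

-- The parametrisation x = X (1 − Y), y = Y (1 − X)

𝕏-⊛-zero : ∀ f n → (𝕏 ⊛ f) 0 n ≡ + 0
𝕏-⊛-zero f n = ≡.trans (⊛-conv 𝕏 f 0 n) (ℤ⟦y⟧.conv-zeroˡ (𝕏 0) (f 0) (λ _ → ≡.refl) n)

𝕏-⊛-suc : ∀ f m n → (𝕏 ⊛ f) (suc m) n ≡ f m n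
𝕏-⊛-suc f m n = ≡.trans (⊛-conv 𝕏 f (suc m) n) (≡.trans
  (ℤ⟦y⟧⟦x⟧.conv-shift 𝕏 f (λ _ → ≡.refl) m n) (≡.trans
  (≡.sym (⊛-conv (λ i → 𝕏 (suc i)) f m n)) (≡.trans
  (𝕊.*-congʳ {f} tail≈𝟙 m n) (𝕊.*-identityˡ f m n))))
  where
  tail≈𝟙 : (λ i → 𝕏 (suc i)) ≈ₛ 𝟙
  tail≈𝟙 zero    zero    = ≡.refl
  tail≈𝟙 zero    (suc n) = ≡.refl
  tail≈𝟙 (suc m) n       = ≡.refl

𝕐-⊛ : ∀ f m n → (𝕐 ⊛ f) m n ≡ ℤ⟦y⟧.conv (𝕐 0) (f m) n
𝕐-⊛ f m n = ≡.trans (⊛-conv 𝕐 f m n) (≡.trans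
  (ℤ⟦y⟧⟦x⟧.conv-cong {g = f} 𝕐-const (λ _ _ → ≡.refl) m n) (ℤ⟦y⟧⟦x⟧.conv-const (𝕐 0) f m n))
  where
  𝕐-const : ∀ m n → 𝕐 m n ≡ ℤ⟦y⟧⟦x⟧.const (𝕐 0) m n
  𝕐-const zero    n = ≡.refl
  𝕐-const (suc m) n = ≡.refl

𝕐-⊛-zero : ∀ f m → (𝕐 ⊛ f) m 0 ≡ + 0
𝕐-⊛-zero f m = ≡.trans (𝕐-⊛ f m 0) ≡.refl

𝕐-⊛-suc : ∀ f m n → (𝕐 ⊛ f) m (suc n) ≡ f m n
𝕐-⊛-suc f m n = ≡.trans (𝕐-⊛ f m (suc n)) (≡.trans
  (ℤ⟦y⟧.conv-shift (𝕐 0) (f m) ≡.refl n) (≡.trans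
  (ℤ⟦y⟧.conv-cong {g = f m} tail-const (λ _ → ≡.refl) n) (≡.trans
  (ℤ⟦y⟧.conv-const (+ 1) (f m) n) (ℤₚ.*-identityˡ (f m n)))))
  where
  tail-const : ∀ n → 𝕐 0 (suc n) ≡ ℤ⟦y⟧.const (+ 1) n
  tail-const zero    = ≡.refl
  tail-const (suc n) = ≡.refl

Agree : ℕ → Series → Series → Set
Agree d f g = ∀ m n → m ℕ.+ n ℕ.< d → f m n ≡ g m n

⊛-agree : ∀ {d f f′ g g′} → Agree d f f′ → Agree d g g′ → Agree d (f ⊛ g) (f′ ⊛ g′)
⊛-agree p q m n m+n<d = sumℤ-cong (suc m) λ i i<sm → sumℤ-cong (suc n) λ j j<sn → ≡.cong₂ ℤ._*_
  (p i j (ℕₚ.≤-<-trans (ℕₚ.+-mono-≤ (ℕₚ.≤-pred i<sm) (ℕₚ.≤-pred j<sn)) m+n<d))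
  (q (m ℕ.∸ i) (n ℕ.∸ j) (ℕₚ.≤-<-trans (ℕₚ.+-mono-≤ (ℕₚ.m∸n≤m m i) (ℕₚ.m∸n≤m n j)) m+n<d))

𝟙⊕𝕏-agree : ∀ {d f g} → Agree d f g → Agree (suc d) (𝟙 ⊕ 𝕏 ⊛ f) (𝟙 ⊕ 𝕏 ⊛ g)
𝟙⊕𝕏-agree {f = f} {g} p zero    n _ = ≡.cong (ℤ._+_ (𝟙 0 n)) (≡.trans (𝕏-⊛-zero f n) (≡.sym (𝕏-⊛-zero g n)))
𝟙⊕𝕏-agree {f = f} {g} p (suc m) n (ℕ.s≤s l) =
  ≡.cong (ℤ._+_ (𝟙 (suc m) n)) (≡.trans (𝕏-⊛-suc f m n) (≡.trans (p m n l) (≡.sym (𝕏-⊛-suc g m n))))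

𝟙⊕𝕐-agree : ∀ {d f g} → Agree d f g → Agree (suc d) (𝟙 ⊕ 𝕐 ⊛ f) (𝟙 ⊕ 𝕐 ⊛ g)
𝟙⊕𝕐-agree {f = f} {g} p m zero    _ = ≡.cong (ℤ._+_ (𝟙 m 0)) (≡.trans (𝕐-⊛-zero f m) (≡.sym (𝕐-⊛-zero g m)))
𝟙⊕𝕐-agree {d} {f} {g} p m (suc n) l =
  ≡.cong (ℤ._+_ (𝟙 m (suc n))) (≡.trans (𝕐-⊛-suc f m n) (≡.trans
    (p m n (ℕₚ.≤-pred (≡.subst (ℕ._< suc d) (ℕₚ.+-suc m n) l))) (≡.sym (𝕐-⊛-suc g m n))))

-- Banach iteration: a map that gains one degree of agreement has a fixed point.
module FixedPoint (Φ : Series → Series) (contractive : ∀ {d f g} → Agree d f g → Agree (suc d) (Φ f) (Φ g)) where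

  iterate : ℕ → Series
  iterate zero    = 𝕊.0#
  iterate (suc k) = Φ (iterate k)

  stable : ∀ k → Agree k (iterate k) (iterate (suc k))
  stable zero    m n ()
  stable (suc k) = contractive (stable k)

  stable-≤ : ∀ k j → Agree k (iterate k) (iterate (j ℕ.+ k))
  stable-≤ k zero    m n l = ≡.refl
  stable-≤ k (suc j) m n l = ≡.trans (stable-≤ k j m n l) (stable (j ℕ.+ k) m n (ℕₚ.≤-trans l (ℕₚ.m≤n+m k j)))

  fix : Series
  fix m n = iterate (suc (m ℕ.+ n)) m n

  fix-agree : ∀ k → Agree k fix (iterate k)
  fix-agree k m n l = ≡.trans (stable-≤ (suc (m ℕ.+ n)) (k ℕ.∸ suc (m ℕ.+ n)) m n ℕₚ.≤-refl)
    (≡.cong (λ j → iterate j m n) (ℕₚ.m∸n+n≡m l))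

  fixed : fix ≈ₛ Φ fix
  fixed m n = ≡.sym (contractive (fix-agree (m ℕ.+ n)) m n ℕₚ.≤-refl)

-- The fixed point is the generating function of the Narayana numbers. Every occurrence of t on the
-- right comes with a factor x or y, which is what gains a degree.
module Narayana = FixedPoint (λ t → (𝟙 ⊕ 𝕏 ⊛ t) ⊛ (𝟙 ⊕ 𝕐 ⊛ t))
  (λ p → ⊛-agree (𝟙⊕𝕏-agree p) (𝟙⊕𝕐-agree p))
module Geometric = FixedPoint (λ v → 𝟙 ⊕ 𝕏 ⊛ v) 𝟙⊕𝕏-agree

module _ (𝔸 : ℤ-Algebra) where

  open ℤ-Algebra 𝔸

  module NarayanaParametrisation (x y t : Carrier)
    (fixed : t ≈ (ι (+ 1) + x * t) * (ι (+ 1) + y * t)) where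

    open Identities 𝔸
    open import Relation.Binary.Reasoning.Setoid setoid

    X Y Z root : Carrier
    X = x * (ι (+ 1) + y * t)
    Y = y * (ι (+ 1) + x * t)
    Z = ι (+ 1) + x * t
    root = ι (+ 1) - X - Y

    private
      x′ y′ t′ X′ Y′ 𝟙′ Φ′ : Expr 3
      x′ = var (# 0)
      y′ = var (# 1)
      t′ = var (# 2)
      𝟙′ = con (+ 1)
      X′ = x′ :* (𝟙′ :+ y′ :* t′)
      Y′ = y′ :* (𝟙′ :+ x′ :* t′)
      Φ′ = (𝟙′ :+ x′ :* t′) :* (𝟙′ :+ y′ :* t′)
      Γ : Vec Carrier 3
      Γ = x ∷ y ∷ t ∷ []

    -- By the equation of t, X Y = x y (1 + x t)(1 + y t) = x y t, hence X - X Y = X - x y t = x.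
    x-parametrised : x ≈ X * (ι (+ 1) - Y)
    x-parametrised = begin
      x                                  ≈⟨ solve x′ (X′ :- x′ :* y′ :* t′) Γ ≡.refl ⟩
      X - x * y * t                      ≈⟨ -‿congᵇ refl (*-congˡ fixed) ⟩
      ⟦ X′ :- x′ :* y′ :* Φ′ ⟧ Γ         ≈⟨ solve (X′ :- x′ :* y′ :* Φ′) (X′ :* (𝟙′ :- Y′)) Γ ≡.refl ⟩
      X * (ι (+ 1) - Y)                  ∎

    y-parametrised : y ≈ Y * (ι (+ 1) - X)
    y-parametrised = begin
      y                                  ≈⟨ solve y′ (Y′ :- x′ :* y′ :* t′) Γ ≡.refl ⟩
      Y - x * y * t                      ≈⟨ -‿congᵇ refl (*-congˡ fixed) ⟩
      ⟦ Y′ :- x′ :* y′ :* Φ′ ⟧ Γ         ≈⟨ solve (Y′ :- x′ :* y′ :* Φ′) (Y′ :* (𝟙′ :- X′)) Γ ≡.refl ⟩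
      Y * (ι (+ 1) - X)                  ∎

    -- The product is 1 + x t - x (1 + x t)(1 + y t), and the last term is x t. Thus `Z` is the
    -- ratio of the sequence ζ.
    Z-inverse : (ι (+ 1) - X) * Z ≈ ι (+ 1)
    Z-inverse = begin
      (ι (+ 1) - X) * Z                  ≈⟨ solve ((𝟙′ :- X′) :* (𝟙′ :+ x′ :* t′)) (𝟙′ :+ x′ :* t′ :- x′ :* Φ′) Γ ≡.refl ⟩
      ⟦ 𝟙′ :+ x′ :* t′ :- x′ :* Φ′ ⟧ Γ   ≈⟨ -‿congᵇ refl (*-congˡ fixed) ⟨
      Z - x * t                          ≈⟨ solve (𝟙′ :+ x′ :* t′ :- x′ :* t′) 𝟙′ Γ ≡.refl ⟩
      ι (+ 1)                            ∎

    -- Since x - y = X - Y, the right side is ((1 - Y) + X)² - 4 X (1 - Y), which is the square of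
    -- (1 - Y) - X.
    root-square : root * root ≈ (ι (+ 1) + x - y) ^ 2 - ι (+ 4) * x
    root-square = begin
      root * root
        ≈⟨ solve (r :* r) ((𝟙″ :+ x″ :- y″) :^ 2 :- con (+ 4) :* x″) (X ∷ Y ∷ []) ≡.refl ⟩
      ⟦ (𝟙″ :+ x″ :- y″) :^ 2 :- con (+ 4) :* x″ ⟧ (X ∷ Y ∷ [])
        ≈⟨ -‿congᵇ (^-cong 2 (-‿congᵇ (+-congˡ x-parametrised) y-parametrised)) (*-congˡ x-parametrised) ⟨
      (ι (+ 1) + x - y) ^ 2 - ι (+ 4) * x ∎
      where
      𝟙″ x″ y″ r : Expr 2
      𝟙″ = con (+ 1)
      x″ = var (# 0) :* (𝟙″ :- var (# 1))
      y″ = var (# 1) :* (𝟙″ :- var (# 0))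
      r = 𝟙″ :- var (# 0) :- var (# 1)

-- Elimination of the square root and its inverse powers

module Elimination (𝔸 : ℤ-Algebra) where

  open ℤ-Algebra 𝔸
  open Identities 𝔸
  open import Relation.Binary.Reasoning.Setoid setoid

  geometric-inverse : ∀ {x v} → v ≈ ι (+ 1) + x * v → (ι (+ 1) - x) * v ≈ ι (+ 1)
  geometric-inverse {x} {v} fixed = begin
    (ι (+ 1) - x) * v       ≈⟨ solve ((con (+ 1) :- x′) :* v′) (v′ :- x′ :* v′) (x ∷ v ∷ []) ≡.refl ⟩
    v - x * v               ≈⟨ -‿congᵇ fixed refl ⟩
    ι (+ 1) + x * v - x * v ≈⟨ solve (con (+ 1) :+ x′ :* v′ :- x′ :* v′) (con (+ 1)) (x ∷ v ∷ []) ≡.refl ⟩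
    ι (+ 1)                 ∎
    where x′ = var (# 0) ; v′ = var (# 1)

  difference-of-squares : ∀ {a b d} → a * a ≈ d → b * b ≈ d → (a - b) * (a + b) ≈ 0#
  difference-of-squares {a} {b} {d} p q = begin
    (a - b) * (a + b) ≈⟨ solve ((a′ :- b′) :* (a′ :+ b′)) (a′ :* a′ :- b′ :* b′) (a ∷ b ∷ []) ≡.refl ⟩
    a * a - b * b     ≈⟨ -‿congᵇ p q ⟩
    d - d             ≈⟨ solve (a′ :- a′) (con (+ 0)) (d ∷ b ∷ []) ≡.refl ⟩
    ι (+ 0)           ≈⟨ ι-0 ⟩
    0#                ∎
    where a′ = var (# 0) ; b′ = var (# 1)

  -- Here U is S⁻⁸ and T is S⁻⁵, so U S³ = T. Multiplying the polynomial relation by U therefore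
  -- produces the two kinds of denominators of the claimed formula.
  eliminate : ∀ {S T U d} → S * S ≈ d → T * S ^ 5 ≈ 1# → U * d ^ 4 ≈ 1# → ∀ G P₁ P₂ P₃ →
              ι (+ 4) * S ^ 8 * G ≈ ι (+ 4) * (P₁ + P₂ + P₃ * S ^ 3) → ι (+ 4) * G ≈ ι (+ 4) * ((P₁ + P₂) * U + P₃ * T)
  eliminate {S} {T} {U} {d} S² TS⁵ Ud⁴ G P₁ P₂ P₃ eq = begin
    ι (+ 4) * G                                       ≈⟨ *-identityˡ _ ⟨
    1# * (ι (+ 4) * G)                                ≈⟨ *-congʳ US⁸ ⟨
    U * S ^ 8 * (ι (+ 4) * G)
      ≈⟨ solve (u :* s :^ 8 :* (con (+ 4) :* g)) (u :* (con (+ 4) :* s :^ 8 :* g)) Γ ≡.refl ⟩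
    U * (ι (+ 4) * S ^ 8 * G)                         ≈⟨ *-congˡ eq ⟩
    U * (ι (+ 4) * (P₁ + P₂ + P₃ * S ^ 3))
      ≈⟨ solve (u :* (con (+ 4) :* (a :+ b :+ c :* s :^ 3))) (con (+ 4) :* ((a :+ b) :* u :+ c :* (u :* s :^ 3))) Γ ≡.refl ⟩
    ι (+ 4) * ((P₁ + P₂) * U + P₃ * (U * S ^ 3))      ≈⟨ *-congˡ (+-congˡ (*-congˡ US³)) ⟩
    ι (+ 4) * ((P₁ + P₂) * U + P₃ * T)                ∎
    where
    Γ : Vec Carrier 7
    Γ = S ∷ T ∷ U ∷ G ∷ P₁ ∷ P₂ ∷ P₃ ∷ []
    s t u g a b c : Expr 7
    s = var (# 0)
    t = var (# 1)
    u = var (# 2)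
    g = var (# 3)
    a = var (# 4)
    b = var (# 5)
    c = var (# 6)
    US⁸ : U * S ^ 8 ≈ 1#
    US⁸ = begin
      U * S ^ 8       ≈⟨ solve (u :* s :^ 8) (u :* (s :* s) :^ 4) Γ ≡.refl ⟩
      U * (S * S) ^ 4 ≈⟨ *-congˡ (^-cong 4 S²) ⟩
      U * d ^ 4       ≈⟨ Ud⁴ ⟩
      1#              ∎
    US³ : U * S ^ 3 ≈ T
    US³ = begin
      U * S ^ 3               ≈⟨ *-identityʳ _ ⟨
      U * S ^ 3 * 1#          ≈⟨ *-congˡ TS⁵ ⟨
      U * S ^ 3 * (T * S ^ 5) ≈⟨ solve (u :* s :^ 3 :* (t :* s :^ 5)) (t :* (u :* s :^ 8)) Γ ≡.refl ⟩
      T * (U * S ^ 8)         ≈⟨ *-congˡ US⁸ ⟩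
      T * 1#                  ≈⟨ *-identityʳ T ⟩
      T                       ∎

  rescale : ∀ {S root y y′ F A R R′} → root ≈ S → y ≈ y′ → ι (+ 4) * root ^ 8 * F ≈ A → y′ * A ≈ ι (+ 4) * R → R ≈ R′ →
            ι (+ 4) * S ^ 8 * (y * F) ≈ ι (+ 4) * R′
  rescale {S} {root} {y} {y′} {F} {A} {R} {R′} root≈ y≈ F≈ total R≈ = begin
    ι (+ 4) * S ^ 8 * (y * F)     ≈⟨ *-congʳ (*-congˡ (^-cong 8 root≈)) ⟨
    ι (+ 4) * root ^ 8 * (y * F)  ≈⟨ solve (var (# 0) :* (var (# 1) :* var (# 2))) (var (# 1) :* (var (# 0) :* var (# 2)))
                                       (ι (+ 4) * root ^ 8 ∷ y ∷ F ∷ []) ≡.refl ⟩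
    y * (ι (+ 4) * root ^ 8 * F)  ≈⟨ *-cong y≈ F≈ ⟩
    y′ * A                        ≈⟨ total ⟩
    ι (+ 4) * R                   ≈⟨ *-congˡ R≈ ⟩
    ι (+ 4) * R′                  ∎

τ V : Series
τ = Narayana.fix
V = Geometric.fix

module 𝔑 = NarayanaParametrisation seriesAlgebra 𝕏 𝕐 τ Narayana.fixed
open Elimination seriesAlgebra using (difference-of-squares)

⊛-cancelʳ : ∀ {f g} → g 0 0 ≡ + 2 → f ⊛ g ≈ₛ 𝕊.0# → f ≈ₛ 𝕊.0#
⊛-cancelʳ {f} {g} g₀₀ p = ℤ⟦y⟧⟦x⟧.cancel g nzd f (λ m n → ≡.trans (≡.sym (⊛-conv f g m n)) (p m n))
  where
  nzd₀ : ∀ a → a ℤ.* g 0 0 ≡ + 0 → a ≡ + 0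
  nzd₀ a eq with ℤₚ.i*j≡0⇒i≡0∨j≡0 a (≡.trans (≡.cong (a ℤ.*_) (≡.sym g₀₀)) eq)
  ... | inj₁ a≡0 = a≡0
  nzd : ∀ a → (∀ n → ℤ⟦y⟧.conv a (g 0) n ≡ + 0) → ∀ n → a n ≡ + 0
  nzd = ℤ⟦y⟧.cancel (g 0) nzd₀

-- In (S - root)(S + root) = 0 the second factor has constant term 2 and can be cancelled. The
-- condition on S 0 0 is what excludes -root.
sqrt-unique : ∀ S → S 0 0 ≡ + 1 → S ⊛ S ≈ₛ D → 𝔑.root ≈ₛ S
sqrt-unique S S₀₀ S² m n = ≡.sym (ℤₚ.i-j≡0⇒i≡j (S m n) (𝔑.root m n)
  (⊛-cancelʳ {S ⊖ 𝔑.root} {S ⊕ 𝔑.root} (≡.cong (ℤ._+ + 1) S₀₀)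
    (difference-of-squares {S} {𝔑.root} {D} S² 𝔑.root-square) m n))

-- The closed form

-- wa1-i2 is the coefficient of h² i (h + 1) in the ε-part of WA, up to the power of 1 − X − Y given in the definition of
-- waₑ. It is a polynomial in x and y, for ζ in X and Y, listed by increasing powers of the first variable.
private module Coefficients where
  open import Agda.Builtin.FromNat using (Number; fromNat)
  open import Agda.Builtin.FromNeg using (Negative; fromNeg)
  open import Data.Unit using (tt)
  import Data.Integer.Literals as ℤ-literals
  instance
    _ = ℤ-literals.number
    _ = ℤ-literals.negative
    _ = tt

  rb0-i0 : List (List ℤ)
  rb0-i0 =
    [] ∷ (-4 ∷ 12 ∷ -8 ∷ []) ∷ (8 ∷ 4 ∷ []) ∷ (-4 ∷ []) ∷ []

  rb0-p0 : List (List ℤ)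
  rb0-p0 =
    (4 ∷ -8 ∷ 4 ∷ []) ∷ (-8 ∷ -4 ∷ 4 ∷ []) ∷ (4 ∷ -4 ∷ []) ∷ []

  rb0-ζ0 : List (List ℤ)
  rb0-ζ0 =
    [] ∷ (0 ∷ -8 ∷ 8 ∷ []) ∷ (0 ∷ 8 ∷ -8 ∷ []) ∷ []

  rb1-i0 : List (List ℤ)
  rb1-i0 =
    (1 ∷ -4 ∷ 6 ∷ -4 ∷ 1 ∷ []) ∷ (-4 ∷ -3 ∷ 19 ∷ -13 ∷ 1 ∷ []) ∷ (6 ∷ 13 ∷ -20 ∷ -7 ∷ []) ∷
    (-4 ∷ -1 ∷ 11 ∷ []) ∷ (1 ∷ -5 ∷ []) ∷ []

  rb1-p0 : List (List ℤ)
  rb1-p0 =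
    (-1 ∷ 4 ∷ -6 ∷ 4 ∷ -1 ∷ []) ∷ (4 ∷ -17 ∷ -3 ∷ 17 ∷ -1 ∷ []) ∷ (-6 ∷ 23 ∷ -4 ∷ 3 ∷ []) ∷
    (4 ∷ -11 ∷ -3 ∷ []) ∷ (-1 ∷ 1 ∷ []) ∷ []

  rb1-ζ0 : List (List ℤ)
  rb1-ζ0 =
    [] ∷ (0 ∷ 20 ∷ -36 ∷ 12 ∷ 4 ∷ []) ∷ (0 ∷ -36 ∷ 92 ∷ -52 ∷ -4 ∷ []) ∷ (0 ∷ 12 ∷ -52 ∷ 40 ∷ []) ∷
    (0 ∷ 4 ∷ -4 ∷ []) ∷ []

  rb1-i1 : List (List ℤ)
  rb1-i1 =
    [] ∷ (0 ∷ 1 ∷ -3 ∷ 3 ∷ -1 ∷ []) ∷ (0 ∷ 3 ∷ 6 ∷ -9 ∷ []) ∷ (0 ∷ -9 ∷ 5 ∷ []) ∷ (0 ∷ 5 ∷ []) ∷ []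

  rb1-p1 : List (List ℤ)
  rb1-p1 =
    (-1 ∷ 4 ∷ -6 ∷ 4 ∷ -1 ∷ []) ∷ (4 ∷ 0 ∷ -10 ∷ 4 ∷ 2 ∷ []) ∷ (-6 ∷ -10 ∷ 10 ∷ -2 ∷ []) ∷
    (4 ∷ 4 ∷ -2 ∷ []) ∷ (-1 ∷ 2 ∷ []) ∷ []

  rb1-ζ1 : List (List ℤ)
  rb1-ζ1 =
    [] ∷ [] ∷ (0 ∷ 4 ∷ -12 ∷ 12 ∷ -4 ∷ []) ∷ (0 ∷ -8 ∷ 12 ∷ -8 ∷ 4 ∷ []) ∷ (0 ∷ 4 ∷ 0 ∷ -4 ∷ []) ∷ []

  rb1-i2 : List (List ℤ)
  rb1-i2 =
    [] ∷ (1 ∷ -2 ∷ 1 ∷ []) ∷ (-2 ∷ []) ∷ (1 ∷ []) ∷ []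

  rb1-p2 : List (List ℤ)
  rb1-p2 =
    [] ∷ (0 ∷ 1 ∷ -1 ∷ []) ∷ (0 ∷ 1 ∷ []) ∷ []

  rb1-ζ2 : List (List ℤ)
  rb1-ζ2 =
    [] ∷ [] ∷ (0 ∷ -4 ∷ 8 ∷ -4 ∷ []) ∷ (0 ∷ 4 ∷ -8 ∷ 4 ∷ []) ∷ []

  wa0-i0 : List (List ℤ)
  wa0-i0 =
    [] ∷ [] ∷ (-4 ∷ 24 ∷ -20 ∷ []) ∷ (16 ∷ -40 ∷ -40 ∷ []) ∷ (-24 ∷ 8 ∷ -4 ∷ []) ∷ (16 ∷ 8 ∷ []) ∷
    (-4 ∷ []) ∷ []

  wa0-p0 : List (List ℤ)
  wa0-p0 =
    [] ∷ (4 ∷ -8 ∷ 4 ∷ []) ∷ (-16 ∷ -8 ∷ 40 ∷ []) ∷ (24 ∷ 40 ∷ 20 ∷ []) ∷ (-16 ∷ -24 ∷ []) ∷ (4 ∷ []) ∷ []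

  wa0-ζ0 : List (List ℤ)
  wa0-ζ0 =
    [] ∷ [] ∷ (0 ∷ -16 ∷ 16 ∷ []) ∷ (0 ∷ 32 ∷ -32 ∷ []) ∷ (0 ∷ -16 ∷ 16 ∷ []) ∷ []

  wa1-i0 : List (List ℤ)
  wa1-i0 =
    [] ∷ (1 ∷ -6 ∷ 15 ∷ -20 ∷ 15 ∷ -6 ∷ 1 ∷ []) ∷ (-8 ∷ 10 ∷ 50 ∷ -140 ∷ 140 ∷ -62 ∷ 10 ∷ []) ∷
    (28 ∷ 58 ∷ -267 ∷ 328 ∷ -142 ∷ -90 ∷ 85 ∷ []) ∷ (-56 ∷ -222 ∷ 316 ∷ -88 ∷ 380 ∷ -26 ∷ 16 ∷ []) ∷
    (70 ∷ 310 ∷ -119 ∷ -260 ∷ -265 ∷ -72 ∷ []) ∷ (-56 ∷ -194 ∷ 66 ∷ 292 ∷ 128 ∷ []) ∷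
    (28 ∷ 30 ∷ -109 ∷ -112 ∷ []) ∷ (-8 ∷ 22 ∷ 48 ∷ []) ∷ (1 ∷ -8 ∷ []) ∷ []

  wa1-p0 : List (List ℤ)
  wa1-p0 =
    [] ∷ (-1 ∷ 6 ∷ -15 ∷ 20 ∷ -15 ∷ 6 ∷ -1 ∷ []) ∷ (8 ∷ -50 ∷ 70 ∷ 60 ∷ -220 ∷ 182 ∷ -50 ∷ []) ∷
    (-28 ∷ 174 ∷ -61 ∷ 8 ∷ 62 ∷ -94 ∷ -61 ∷ []) ∷ (56 ∷ -330 ∷ -156 ∷ -328 ∷ 20 ∷ 162 ∷ []) ∷
    (-70 ∷ 370 ∷ 359 ∷ 292 ∷ -103 ∷ []) ∷ (56 ∷ -246 ∷ -266 ∷ -52 ∷ []) ∷ (-28 ∷ 90 ∷ 69 ∷ []) ∷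
    (8 ∷ -14 ∷ []) ∷ (-1 ∷ []) ∷ []

  wa1-ζ0 : List (List ℤ)
  wa1-ζ0 =
    [] ∷ [] ∷ (0 ∷ 40 ∷ -112 ∷ 96 ∷ -16 ∷ -8 ∷ []) ∷ (0 ∷ -152 ∷ 456 ∷ -536 ∷ 312 ∷ -80 ∷ []) ∷
    (0 ∷ 208 ∷ -688 ∷ 872 ∷ -576 ∷ 184 ∷ []) ∷ (0 ∷ -112 ∷ 448 ∷ -520 ∷ 280 ∷ -96 ∷ []) ∷
    (0 ∷ 8 ∷ -96 ∷ 88 ∷ []) ∷ (0 ∷ 8 ∷ -8 ∷ []) ∷ []

  wa1-i1 : List (List ℤ)
  wa1-i1 =
    [] ∷ [] ∷ (0 ∷ 4 ∷ -12 ∷ 12 ∷ -4 ∷ []) ∷ (0 ∷ -8 ∷ 84 ∷ -32 ∷ -44 ∷ []) ∷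
    (0 ∷ -8 ∷ -156 ∷ -36 ∷ -8 ∷ []) ∷ (0 ∷ 32 ∷ 108 ∷ 24 ∷ []) ∷ (0 ∷ -28 ∷ -24 ∷ []) ∷ (0 ∷ 8 ∷ []) ∷ []

  wa1-p1 : List (List ℤ)
  wa1-p1 =
    [] ∷ (-1 ∷ 4 ∷ -6 ∷ 4 ∷ -1 ∷ []) ∷ (6 ∷ 4 ∷ 0 ∷ -36 ∷ 26 ∷ []) ∷ (-15 ∷ -56 ∷ 12 ∷ 108 ∷ 31 ∷ []) ∷
    (20 ∷ 104 ∷ 0 ∷ -44 ∷ []) ∷ (-15 ∷ -76 ∷ -6 ∷ []) ∷ (6 ∷ 20 ∷ []) ∷ (-1 ∷ []) ∷ []

  wa1-ζ1 : List (List ℤ)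
  wa1-ζ1 =
    [] ∷ [] ∷ [] ∷ (0 ∷ 8 ∷ -72 ∷ 120 ∷ -56 ∷ []) ∷ (0 ∷ -24 ∷ 160 ∷ -248 ∷ 112 ∷ []) ∷
    (0 ∷ 24 ∷ -104 ∷ 136 ∷ -56 ∷ []) ∷ (0 ∷ -8 ∷ 16 ∷ -8 ∷ []) ∷ []

  wa1-i2 : List (List ℤ)
  wa1-i2 =
    [] ∷ [] ∷ (1 ∷ -2 ∷ 1 ∷ []) ∷ (-4 ∷ 2 ∷ 6 ∷ []) ∷ (6 ∷ 2 ∷ 1 ∷ []) ∷ (-4 ∷ -2 ∷ []) ∷ (1 ∷ []) ∷ []

  wa1-p2 : List (List ℤ)
  wa1-p2 =
    [] ∷ [] ∷ (0 ∷ 4 ∷ -4 ∷ []) ∷ (0 ∷ -8 ∷ -4 ∷ []) ∷ (0 ∷ 4 ∷ []) ∷ []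

  wa1-ζ2 : List (List ℤ)
  wa1-ζ2 =
    [] ∷ [] ∷ [] ∷ (0 ∷ -8 ∷ 16 ∷ -8 ∷ []) ∷ (0 ∷ 16 ∷ -32 ∷ 16 ∷ []) ∷ (0 ∷ -8 ∷ 16 ∷ -8 ∷ []) ∷ []

  total-p : List (List ℤ)
  total-p =
    [] ∷ [] ∷ (0 ∷ 0 ∷ -36 ∷ 144 ∷ -212 ∷ 128 ∷ -12 ∷ -16 ∷ 4 ∷ []) ∷
    (0 ∷ 0 ∷ 144 ∷ -144 ∷ -32 ∷ -96 ∷ 144 ∷ -16 ∷ []) ∷ (0 ∷ 0 ∷ -212 ∷ -32 ∷ 344 ∷ -128 ∷ 28 ∷ []) ∷
    (0 ∷ 0 ∷ 128 ∷ -96 ∷ -128 ∷ -32 ∷ []) ∷ (0 ∷ 0 ∷ -12 ∷ 144 ∷ 28 ∷ []) ∷ (0 ∷ 0 ∷ -16 ∷ -16 ∷ []) ∷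
    (0 ∷ 0 ∷ 4 ∷ []) ∷ []

  total-i : List (List ℤ)
  total-i =
    [] ∷ (0 ∷ 1 ∷ -7 ∷ 21 ∷ -35 ∷ 35 ∷ -21 ∷ 7 ∷ -1 ∷ []) ∷
    (0 ∷ -8 ∷ 21 ∷ 18 ∷ -125 ∷ 180 ∷ -117 ∷ 34 ∷ -3 ∷ []) ∷ (0 ∷ 28 ∷ -35 ∷ -5 ∷ -46 ∷ 98 ∷ -31 ∷ -9 ∷ []) ∷
    (0 ∷ -56 ∷ 73 ∷ 60 ∷ 150 ∷ -236 ∷ 9 ∷ []) ∷ (0 ∷ 70 ∷ -117 ∷ -261 ∷ 129 ∷ 51 ∷ []) ∷
    (0 ∷ -56 ∷ 95 ∷ 146 ∷ -73 ∷ []) ∷ (0 ∷ 28 ∷ -33 ∷ 21 ∷ []) ∷ (0 ∷ -8 ∷ 3 ∷ []) ∷ (0 ∷ 1 ∷ []) ∷ []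

  total-ζ : List (List ℤ)
  total-ζ =
    [] ∷ [] ∷ (0 ∷ 0 ∷ 40 ∷ -152 ∷ 208 ∷ -112 ∷ 8 ∷ 8 ∷ []) ∷ (0 ∷ 0 ∷ -152 ∷ 576 ∷ -816 ∷ 512 ∷ -120 ∷ []) ∷
    (0 ∷ 0 ∷ 208 ∷ -816 ∷ 1112 ∷ -632 ∷ 152 ∷ -24 ∷ []) ∷ (0 ∷ 0 ∷ -112 ∷ 512 ∷ -632 ∷ 192 ∷ 24 ∷ 16 ∷ []) ∷
    (0 ∷ 0 ∷ 8 ∷ -120 ∷ 152 ∷ 24 ∷ -64 ∷ []) ∷ (0 ∷ 0 ∷ 8 ∷ 0 ∷ -24 ∷ 16 ∷ []) ∷ []

open Coefficients

-- Write (1 − √x)^(-h) = p h + √x i h and ζ h = (1 − X)^(-h). The variables stand for h, p (h + 1), i (h + 1), ζ h, X, Y.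
𝕙 ℙ 𝕀 𝕫 Xₑ Yₑ xₑ yₑ Sₑ : Expr 6
𝕙  = var (# 0)
ℙ  = var (# 1)
𝕀  = var (# 2)
𝕫  = var (# 3)
Xₑ = var (# 4)
Yₑ = var (# 5)
xₑ = Xₑ :* (con (+ 1) :- Yₑ)
yₑ = Yₑ :* (con (+ 1) :- Xₑ)
Sₑ = con (+ 1) :- Xₑ :- Yₑ

polynomial : List (List ℤ) → Expr 6 → Expr 6 → Expr 6
polynomial rows u v = foldr (λ row e → foldr (λ c e′ → con c :+ v :* e′) (con (+ 0)) row :+ u :* e) (con (+ 0)) rows

-- The power `k` is what is left of the common factor (1 - X - Y)⁸: it stands for a denominator (1 -
-- X - Y)^(8 - k). The coefficients of p and i are written in x and y, whereas those of ζ in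
-- `algebraic` need X and Y.
rational : ℕ → List (List ℤ) → List (List ℤ) → Expr 6
rational k p i = Sₑ :^ k :* (polynomial p xₑ yₑ :* ℙ :+ polynomial i xₑ yₑ :* 𝕀)

algebraic : ℕ → List (List ℤ) → Expr 6
algebraic k z = Sₑ :^ k :* polynomial z Xₑ Yₑ :* 𝕫

-- Expresses the value at h in terms of the variables at h + 1.
back : Expr 6 → Expr 6
back = substitute (𝕙 :- con (+ 1) ∷ ℙ :- xₑ :* 𝕀 ∷ 𝕀 :- ℙ ∷ (con (+ 1) :- Xₑ) :* 𝕫 ∷ Xₑ ∷ Yₑ ∷ [])

-- For expressions written in p h and i h themselves, as `total` is; h and ζ h stay as they are.
unshift : Expr 6 → Expr 6
unshift = substitute (𝕙 ∷ ℙ :- xₑ :* 𝕀 ∷ 𝕀 :- ℙ ∷ 𝕫 ∷ Xₑ ∷ Yₑ ∷ [])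

-- The value y · VA 0 lies at index 2. Only there is it compared with `total`, so h may be replaced
-- by its value.
at2 : Expr 6 → Expr 6
at2 = substitute (con (+ 2) ∷ ℙ ∷ 𝕀 ∷ 𝕫 ∷ Xₑ ∷ Yₑ ∷ [])

-- At h = 0, where p 1 = i 1 = 1 / (1 − x).
origin : Expr 6 → Expr 6
origin = substitute (con (+ 0) ∷ ℙ ∷ ℙ ∷ (con (+ 1) :- xₑ) :* ℙ ∷ Xₑ ∷ Yₑ ∷ [])

-- Transcriptions of `w`, `P₁`, `P₂` and `P₃`. The third variable stands for √D, and `resultₑ` is
-- the claimed series multiplied by √D to the power 8.
x₀ y₀ w₀ p₁ₑ p₂ₑ p₃ₑ resultₑ : Expr 3
x₀ = var (# 0)
y₀ = var (# 1)
w₀ = y₀ :- x₀ :- con (+ 1)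
p₁ₑ = con (+ 8) :* x₀ :^ 3 :* y₀ :^ 2 :*
   ( con (+ 4) :* x₀ :* (x₀ :^ 2 :+ con (+ 6) :* x₀ :- con (+ 1))
   :+ con (+ 4) :* x₀ :* (con (+ 5) :* x₀ :+ con (+ 11)) :* w₀
   :+ (con (+ 6) :* x₀ :^ 2 :+ con (+ 29) :* x₀ :+ con (+ 17)) :* w₀ :^ 2 )
p₂ₑ = x₀ :^ 2 :* y₀ :^ 2 :* w₀ :^ 3 :*
   ( con (+ 40) :* x₀ :* (con (+ 2) :* x₀ :+ con (+ 1))
   :+ con (+ 2) :* (x₀ :^ 2 :+ con (+ 11) :* x₀ :- con (+ 8)) :* w₀
   :+ w₀ :^ 2 :* (y₀ :+ x₀ :- con (+ 1)) )
p₃ₑ = con (+ 4) :* x₀ :^ 2 :* y₀ :^ 2 :*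
   (con (+ 4) :- con (+ 3) :* (x₀ :+ y₀) :- (x₀ :- y₀) :^ 2)
resultₑ = p₁ₑ :+ p₂ₑ :+ p₃ₑ :* var (# 2) :^ 3

-- The values of h, p h, i h and ζ h at h = 0.
startₑ : Expr 6 → Expr 6
startₑ = substitute (con (+ 0) ∷ con (+ 1) ∷ con (+ 0) ∷ con (+ 1) ∷ Xₑ ∷ Yₑ ∷ [])

infix 4 _≋_

_≋_ : ∀ {k} → Expr k → Expr k → Set
_≋_ {k} e e′ = isZero k (normalise (e :- e′)) ≡ true

-- All sequences are multiplied by 4 (1 − X − Y)⁸; unprimed letters are the counts, primed ones their ε-parts.
record Solution : Set where
  field
    rc rc′ tc tc′ sb sb′ rb rb′ vb vb′ ra ra′ va va′ wa wa′ total : Expr 6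
    -- As ζ 0 = 1, the right side is the constant 4 (1 - X - Y)⁸, written so that both sides are
    -- multiples of `ℙ`.
    rc-0    : origin rc ≋ origin (con (+ 4) :* Sₑ :^ 8 :* 𝕫)
    rc′-0   : origin rc′ ≋ con (+ 0)
    tc-0    : origin tc ≋ con (+ 0)
    tc′-0   : origin tc′ ≋ con (+ 0)
    sb-0    : origin sb ≋ con (+ 0)
    sb′-0   : origin sb′ ≋ con (+ 0)
    rc-suc  : rc ≋ back rc :+ tc
    rc′-suc : rc′ ≋ back rc′ :+ tc′
    tc-suc  : tc ≋ back tc :+ xₑ :* rc
    tc′-suc : tc′ ≋ back tc′ :+ xₑ :* (rc′ :+ back 𝕙 :* rc)
    sb-suc  : sb ≋ back sb :+ vb
    sb′-suc : sb′ ≋ back sb′ :+ (vb′ :+ back 𝕙 :* vb)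
    rb-eq   : rb ≋ back rc :+ sb
    rb′-eq  : rb′ ≋ back rc′ :+ sb′
    vb-eq   : back vb ≋ xₑ :* back rb :+ yₑ :* vb
    vb′-eq  : back vb′ ≋ xₑ :* back rb′ :+ yₑ :* vb′
    -- `rc :- tc` is RC (h - 1) for positive h, and RC 0 for h = 0 because TC 0 vanishes. One
    -- expression thus covers both clauses of `previous`.
    ra-eq   : ra ≋ wa :+ (back sb :+ back sb) :+ back (rc :- tc)
    ra′-eq  : ra′ ≋ wa′ :+ back 𝕙 :* wa :+ (back sb′ :+ back sb′) :+ back (rc′ :- tc′)
    va-eq   : back va ≋ xₑ :* back (back ra) :+ yₑ :* va
    va′-eq  : back va′ ≋ xₑ :* back (back ra′) :+ yₑ :* va′
    wa-eq   : back wa ≋ va :+ yₑ :* wa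
    wa′-eq  : back wa′ ≋ va′ :+ yₑ :* wa′
    total-eq   : at2 (yₑ :* va′) ≋ at2 (back (back (unshift total)))
    total-eval : startₑ total ≋ con (+ 4) :* substitute (xₑ ∷ yₑ ∷ Sₑ ∷ []) resultₑ

-- Only `rcₑ`, `rbₑ` and `waₑ` carry data. The other sequences are read off the equations that
-- define them, which then hold by construction; the content lies in the initial values, in the
-- equations for TC, VB and VA, and in the two claims about `total`.
solution : Solution
solution = record
  { rc = rcₑ .proj₁ ; rc′ = rcₑ .proj₂ ; tc = tcₑ .proj₁ ; tc′ = tcₑ .proj₂
  ; sb = sbₑ .proj₁ ; sb′ = sbₑ .proj₂ ; rb = rbₑ .proj₁ ; rb′ = rbₑ .proj₂
  ; vb = vbₑ .proj₁ ; vb′ = vbₑ .proj₂ ; ra = raₑ .proj₁ ; ra′ = raₑ .proj₂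
  ; va = vaₑ .proj₁ ; va′ = vaₑ .proj₂ ; wa = waₑ .proj₁ ; wa′ = waₑ .proj₂
  ; total = rational 0 total-p total-i :+ algebraic 2 total-ζ
  ; rc-0 = ≡.refl ; rc′-0 = ≡.refl ; tc-0 = ≡.refl ; tc′-0 = ≡.refl
  ; sb-0 = ≡.refl ; sb′-0 = ≡.refl ; rc-suc = ≡.refl ; rc′-suc = ≡.refl
  ; tc-suc = ≡.refl ; tc′-suc = ≡.refl ; sb-suc = ≡.refl ; sb′-suc = ≡.refl
  ; rb-eq = ≡.refl ; rb′-eq = ≡.refl ; vb-eq = ≡.refl ; vb′-eq = ≡.refl
  ; ra-eq = ≡.refl ; ra′-eq = ≡.refl ; va-eq = ≡.refl ; va′-eq = ≡.refl
  ; wa-eq = ≡.refl ; wa′-eq = ≡.refl ; total-eq = ≡.refl ; total-eval = ≡.refl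
  }
  where
  rcₑ tcₑ rbₑ sbₑ vbₑ waₑ vaₑ raₑ : Expr 6 × Expr 6
  rcₑ = con (+ 4) :* Sₑ :^ 8 :* (ℙ :- xₑ :* 𝕀)
      , Sₑ :^ 8 :* (𝕀 :- ℙ :- 𝕙 :* ℙ :+ 𝕙 :* 𝕙 :* xₑ :* 𝕀)
  rbₑ = rational 6 rb0-p0 rb0-i0 :+ algebraic 6 rb0-ζ0
      , rational 4 rb1-p0 rb1-i0 :+ algebraic 4 rb1-ζ0
        :+ 𝕙 :* (rational 4 rb1-p1 rb1-i1 :+ algebraic 4 rb1-ζ1
        :+ 𝕙 :* (rational 6 rb1-p2 rb1-i2 :+ algebraic 5 rb1-ζ2))
  waₑ = rational 4 wa0-p0 wa0-i0 :+ algebraic 5 wa0-ζ0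
      , rational 0 wa1-p0 wa1-i0 :+ algebraic 2 wa1-ζ0
        :+ 𝕙 :* (rational 2 wa1-p1 wa1-i1 :+ algebraic 3 wa1-ζ1
        :+ 𝕙 :* (rational 4 wa1-p2 wa1-i2 :+ algebraic 4 wa1-ζ2))
  tcₑ = let (a , b) = rcₑ in a :- back a , b :- back b
  sbₑ = let (a , b) = rbₑ ; (c , d) = rcₑ in a :- back c , b :- back d
  -- Solves SB (h + 1) = SB h + q ^ h VB h for VB h at the index h + 1, where the exponent reads
  -- `𝕙 :- con (+ 1)`.
  vbₑ = let (a , b) = sbₑ in a :- back a , b :- back b :- (𝕙 :- con (+ 1)) :* (a :- back a)
  raₑ = let (w , w′) = waₑ ; (s , s′) = sbₑ ; (r , r′) = rcₑ ; (t , t′) = tcₑ in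
        w :+ con (+ 2) :* back s :+ back r :- back t
      , w′ :+ (𝕙 :- con (+ 1)) :* w :+ con (+ 2) :* back s′ :+ back r′ :- back t′
  -- The value at h of the sequence VA = WA h − y WA (h + 1), written at h + 1.
  vaₑ = let (w , w′) = waₑ in back w :- yₑ :* w , back w′ :- yₑ :* w′

-- The transfer equations and their solution in closed form

module Transfer (𝔸 : ℤ-Algebra) (x y : ℤ-Algebra.Carrier 𝔸) where

  open ℤ-Algebra 𝔸

  infix  4 _≈₂_
  infixl 6 _+₂_
  infixr 7 _·_

  _≈₂_ : Carrier × Carrier → Carrier × Carrier → Set
  (a , b) ≈₂ (c , d) = a ≈ c × b ≈ d

  _+₂_ : Carrier × Carrier → Carrier × Carrier → Carrier × Carrier
  (a , b) +₂ (c , d) = a + c , b + d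

  _·_ : Carrier → Carrier × Carrier → Carrier × Carrier
  c · (a , b) = c * a , c * b

  twist : ℕ → Carrier × Carrier → Carrier × Carrier
  twist d (a , b) = a , b + ι (+ d) * a

  -- If both sides start to contract at once, two rows are lost. A column of height one cannot do
  -- this, and only the empty completion, of value δ, remains.
  previous : Carrier → (ℕ → Carrier × Carrier) → ℕ → Carrier × Carrier
  previous δ RC zero    = δ , 0#
  previous δ RC (suc h) = RC h

  -- Powers of x count the further columns, powers of y the rows still missing. The last column has
  -- height h in `RC` and h + 1 in `RB` and `RA`. The equations for `VB`, `VA` and `WA` add missing
  -- rows one at a time, and the differences in `TC`, `RC` and `SB` undo summations over the rows
  -- that are kept. The value δ of the empty completion is left free so that solutions can be
  -- rescaled.
  record System (δ : Carrier) : Set where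
    field
      RC TC SB RB VB RA VA WA : ℕ → Carrier × Carrier
      RC-0   : RC 0 ≈₂ (δ , 0#)
      RC-suc : ∀ h → RC (suc h) ≈₂ RC h +₂ TC (suc h)
      TC-0   : TC 0 ≈₂ (0# , 0#)
      TC-suc : ∀ h → TC (suc h) ≈₂ TC h +₂ x · twist h (RC (suc h))
      SB-0   : SB 0 ≈₂ (0# , 0#)
      SB-suc : ∀ h → SB (suc h) ≈₂ SB h +₂ twist h (VB h)
      RB-eq  : ∀ h → RB h ≈₂ RC h +₂ SB (suc h)
      VB-eq  : ∀ h → VB h ≈₂ x · RB h +₂ y · VB (suc h)
      RA-eq  : ∀ h → RA h ≈₂ twist h (WA h) +₂ (SB h +₂ SB h) +₂ previous δ RC h
      VA-eq  : ∀ h → VA h ≈₂ x · RA h +₂ y · VA (suc h)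
      WA-eq  : ∀ h → WA h ≈₂ VA h +₂ y · WA (suc h)

  private
    open Identities 𝔸

    infixr 2 _⨾_
    _⨾_ : ∀ {u v w} → u ≈₂ v → v ≈₂ w → u ≈₂ w
    (p , p′) ⨾ (q , q′) = trans p q , trans p′ q′

    +₂-cong : ∀ {u u′ v v′} → u ≈₂ u′ → v ≈₂ v′ → u +₂ v ≈₂ u′ +₂ v′
    +₂-cong (p , p′) (q , q′) = +-cong p q , +-cong p′ q′

    ·-cong : ∀ {c d u v} → c ≈ d → u ≈₂ v → c · u ≈₂ d · v
    ·-cong p (q , q′) = *-cong p q , *-cong p q′

    ≈₂-refl : ∀ {u} → u ≈₂ u
    ≈₂-refl = refl , refl

    ·-distrib : ∀ c {u v} → c · (u +₂ v) ≈₂ c · u +₂ c · v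
    ·-distrib c = distribˡ c _ _ , distribˡ c _ _

    ·-swap : ∀ c d {u} → c · (d · u) ≈₂ d · (c · u)
    ·-swap c d = swap _ , swap _
      where
      swap : ∀ a → c * (d * a) ≈ d * (c * a)
      swap a = trans (sym (*-assoc c d a)) (trans (*-congʳ (*-comm c d)) (*-assoc d c a))

    ·-twist : ∀ c d {u} → c · twist d u ≈₂ twist d (c · u)
    ·-twist c d {a , b} = refl , trans (distribˡ c b _) (+-congˡ (·-swap c (ι (+ d)) {a , b} .proj₁))

    ·-previous : ∀ c {δ} RC h → c · previous δ RC h ≈₂ previous (c * δ) (λ h → c · RC h) h
    ·-previous c RC zero    = refl , zeroʳ c
    ·-previous c RC (suc h) = ≈₂-refl

  -- The counts solve the system with δ = 1, the closed form with δ = 4 (1 - X - Y)⁸. Rescaling the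
  -- counts makes them comparable without any division.
  scale : ∀ c {δ} → System δ → System (c * δ)
  scale c {δ} 𝓢 = record
    { RC = λ h → c · RC h ; TC = λ h → c · TC h ; SB = λ h → c · SB h ; RB = λ h → c · RB h
    ; VB = λ h → c · VB h ; RA = λ h → c · RA h ; VA = λ h → c · VA h ; WA = λ h → c · WA h
    ; RC-0   = ·-cong refl RC-0 ⨾ (refl , zeroʳ c)
    ; RC-suc = λ h → ·-cong refl (RC-suc h) ⨾ ·-distrib c
    ; TC-0   = ·-cong refl TC-0 ⨾ (zeroʳ c , zeroʳ c)
    ; TC-suc = λ h → ·-cong refl (TC-suc h) ⨾ ·-distrib c ⨾
        +₂-cong ≈₂-refl (·-swap c x ⨾ ·-cong refl (·-twist c h))
    ; SB-0   = ·-cong refl SB-0 ⨾ (zeroʳ c , zeroʳ c)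
    ; SB-suc = λ h → ·-cong refl (SB-suc h) ⨾ ·-distrib c ⨾ +₂-cong ≈₂-refl (·-twist c h)
    ; RB-eq  = λ h → ·-cong refl (RB-eq h) ⨾ ·-distrib c
    ; VB-eq  = λ h → ·-cong refl (VB-eq h) ⨾ ·-distrib c ⨾ +₂-cong (·-swap c x) (·-swap c y)
    ; RA-eq  = λ h → ·-cong refl (RA-eq h) ⨾ ·-distrib c ⨾ +₂-cong
        (·-distrib c ⨾ +₂-cong (·-twist c h) (·-distrib c)) (·-previous c RC h)
    ; VA-eq  = λ h → ·-cong refl (VA-eq h) ⨾ ·-distrib c ⨾ +₂-cong (·-swap c x) (·-swap c y)
    ; WA-eq  = λ h → ·-cong refl (WA-eq h) ⨾ ·-distrib c ⨾ +₂-cong ≈₂-refl (·-swap c y)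
    }
    where open System 𝓢

module _ (𝔸 : ℤ-Algebra) {x x′ y y′ δ δ′ : ℤ-Algebra.Carrier 𝔸} where

  open ℤ-Algebra 𝔸

  private
    module T  = Transfer 𝔸 x y
    module T′ = Transfer 𝔸 x′ y′

  -- The closed form is built over X (1 - Y) and Y (1 - X), which agree with the given x and y only
  -- up to `_≈_`.
  System-resp-≈ : x ≈ x′ → y ≈ y′ → δ ≈ δ′ → T.System δ → T′.System δ′
  System-resp-≈ x≈ y≈ δ≈ 𝓢 = record
    { RC = RC ; TC = TC ; SB = SB ; RB = RB ; VB = VB ; RA = RA ; VA = VA ; WA = WA
    ; RC-0   = trans (RC-0 .proj₁) δ≈ , RC-0 .proj₂
    ; RC-suc = RC-suc
    ; TC-0   = TC-0
    ; TC-suc = λ h → trans (TC-suc h .proj₁) (+-congˡ (*-congʳ x≈)) , trans (TC-suc h .proj₂) (+-congˡ (*-congʳ x≈))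
    ; SB-0   = SB-0
    ; SB-suc = SB-suc
    ; RB-eq  = RB-eq
    ; VB-eq  = λ h → replace (VB-eq h .proj₁) , replace (VB-eq h .proj₂)
    ; RA-eq  = λ h → trans (RA-eq h .proj₁) (+-congˡ (previous≈ h .proj₁))
                   , trans (RA-eq h .proj₂) (+-congˡ (previous≈ h .proj₂))
    ; VA-eq  = λ h → replace (VA-eq h .proj₁) , replace (VA-eq h .proj₂)
    ; WA-eq  = λ h → trans (WA-eq h .proj₁) (+-congˡ (*-congʳ y≈)) , trans (WA-eq h .proj₂) (+-congˡ (*-congʳ y≈))
    }
    where
    open T.System 𝓢
    replace : ∀ {a b c} → a ≈ x * b + y * c → a ≈ x′ * b + y′ * c
    replace p = trans p (+-cong (*-congʳ x≈) (*-congʳ y≈))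
    previous≈ : ∀ h → T.previous δ RC h T.≈₂ T′.previous δ′ RC h
    previous≈ zero    = δ≈ , refl
    previous≈ (suc h) = refl , refl

module _ (𝔸 : ℤ-Algebra) where

  open ℤ-Algebra 𝔸

  module ClosedForm (solution : Solution) (X Y V Z : Carrier)
    (V-inverse : (ι (+ 1) - X * (ι (+ 1) - Y)) * V ≈ ι (+ 1)) (Z-inverse : (ι (+ 1) - X) * Z ≈ ι (+ 1)) where

    open Identities 𝔸
    open Solution solution
    open import Relation.Binary.Reasoning.Setoid setoid

    x y δ : Carrier
    x = X * (ι (+ 1) - Y)
    y = Y * (ι (+ 1) - X)
    δ = ι (+ 4) * (ι (+ 1) - X - Y) ^ 8

    open Transfer 𝔸 x y

    -- Multiplication by 1 / (1 - √x) = V (1 + √x), separated into even and odd part in √x; no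
    -- square root of x has to exist in the algebra.
    p i ζ : ℕ → Carrier
    p zero    = ι (+ 1)
    p (suc h) = V * (p h + x * i h)
    i zero    = ι (+ 0)
    i (suc h) = V * (p h + i h)
    ζ zero    = ι (+ 1)
    ζ (suc h) = Z * ζ h

    unit : ∀ {a b} → a ≈ ι (+ 1) → a * b ≈ b
    unit {b = b} a≈1 = trans (*-congʳ (trans a≈1 ι-1)) (*-identityˡ b)

    -- The even part of multiplication by 1 - √x, which undoes a step without using V; `i-back` is
    -- the odd part.
    p-back : ∀ h → p h ≈ p (suc h) - x * i (suc h)
    p-back h = trans (sym (unit V-inverse)) (solve
      ((con (+ 1) :- x′) :* v :* p′) (v :* (p′ :+ x′ :* i′) :- x′ :* (v :* (p′ :+ i′))) (x ∷ V ∷ p h ∷ i h ∷ []) ≡.refl)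
      where x′ = var (# 0) ; v = var (# 1) ; p′ = var (# 2) ; i′ = var (# 3)

    i-back : ∀ h → i h ≈ i (suc h) - p (suc h)
    i-back h = trans (sym (unit V-inverse)) (solve
      ((con (+ 1) :- x′) :* v :* i′) (v :* (p′ :+ i′) :- v :* (p′ :+ x′ :* i′)) (x ∷ V ∷ p h ∷ i h ∷ []) ≡.refl)
      where x′ = var (# 0) ; v = var (# 1) ; p′ = var (# 2) ; i′ = var (# 3)

    ζ-back : ∀ h → ζ h ≈ (ι (+ 1) - X) * ζ (suc h)
    ζ-back h = trans (sym (unit Z-inverse)) (*-assoc _ Z (ζ h))

    ι-back : ∀ h → ι (+ h) ≈ ι (+ suc h) - ι (+ 1)
    ι-back h = sym (trans (-‿congᵇ (ι-+ (+ 1) (+ h)) refl)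
      (solve (con (+ 1) :+ var (# 0) :- con (+ 1)) (var (# 0)) (ι (+ h) ∷ []) ≡.refl))

    env : ℕ → Vec Carrier 6
    env h = ι (+ h) ∷ p (suc h) ∷ i (suc h) ∷ ζ h ∷ X ∷ Y ∷ []

    seq : Expr 6 → ℕ → Carrier
    seq e h = ⟦ e ⟧ (env h)

    seq-back : ∀ e h → seq e h ≈ seq (back e) (suc h)
    seq-back e h = ⟦⟧-subst {ρ = env (suc h)} (ι-back h ∷ p-back (suc h) ∷ i-back (suc h) ∷ ζ-back h ∷ refl ∷ refl ∷ []) e

    seq-origin : ∀ e → seq e 0 ≈ seq (origin e) 0
    seq-origin = ⟦⟧-subst {ρ = env 0} (refl ∷ refl
      ∷ solve (v :* (con (+ 1) :+ con (+ 0))) (v :* (con (+ 1) :+ x′ :* con (+ 0))) (V ∷ x ∷ []) ≡.refl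
      ∷ trans (sym V-inverse) (solve ((con (+ 1) :- x′) :* v) ((con (+ 1) :- x′) :* (v :* (con (+ 1) :+ x′ :* con (+ 0)))) (V ∷ x ∷ []) ≡.refl)
      ∷ refl ∷ refl ∷ [])
      where v = var (# 0) ; x′ = var (# 1)

    seq-at2 : ∀ e → seq e 2 ≈ seq (at2 e) 2
    seq-at2 = ⟦⟧-subst {ρ = env 2} (refl ∷ refl ∷ refl ∷ refl ∷ refl ∷ refl ∷ [])

    -- `total` is meant at index 0 and y · VA 0 is found at index 2. They are compared in the
    -- variables of index 2, because only lowering the index is polynomial.
    seq-start : ∀ e → seq (startₑ e) 2 ≈ seq (at2 (back (back (unshift e)))) 2
    seq-start e = begin
      seq (startₑ e) 2                  ≈⟨ ⟦⟧-subst {ρ = env 2} (refl ∷ refl ∷ refl ∷ refl ∷ refl ∷ refl ∷ []) e ⟨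
      ⟦ e ⟧ (ι (+ 0) ∷ p 0 ∷ i 0 ∷ ζ 0 ∷ X ∷ Y ∷ [])
                                       ≈⟨ ⟦⟧-subst {ρ = env 0} (refl ∷ p-back 0 ∷ i-back 0 ∷ refl ∷ refl ∷ refl ∷ []) e ⟩
      seq (unshift e) 0                ≈⟨ seq-back (unshift e) 0 ⟩
      seq (back (unshift e)) 1         ≈⟨ seq-back (back (unshift e)) 1 ⟩
      seq (back (back (unshift e))) 2  ≈⟨ seq-at2 (back (back (unshift e))) ⟩
      seq (at2 (back (back (unshift e)))) 2 ∎

    pair : Expr 6 × Expr 6 → ℕ → Carrier × Carrier
    pair (e , e′) h = seq e h , seq e′ h

    vanish : ∀ e → origin e ≋ con (+ 0) → seq e 0 ≈ 0#
    vanish e eq = trans (seq-origin e) (trans (solve (origin e) (con (+ 0)) (env 0) eq) ι-0)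

    system : System δ
    system = record
      { RC = pair (rc , rc′) ; TC = pair (tc , tc′) ; SB = pair (sb , sb′)
      -- The sequences RB, RA and WA belong to columns of height h + 1 and are written at index h +
      -- 1. VB h involves SB (h + 1), and VA h involves WA (h + 1), which lies at index h + 2.
      ; RB = λ h → pair (rb , rb′) (suc h) ; VB = λ h → pair (vb , vb′) (suc h)
      ; RA = λ h → pair (ra , ra′) (suc h) ; VA = λ h → pair (va , va′) (suc (suc h)) ; WA = λ h → pair (wa , wa′) (suc h)
      ; RC-0 = seq-rc-0 , vanish rc′ rc′-0
      ; RC-suc = λ h → advance rc tc h rc-suc , advance rc′ tc′ h rc′-suc
      ; TC-0 = vanish tc tc-0 , vanish tc′ tc′-0
      ; TC-suc = λ h → advance tc (xₑ :* rc) h tc-suc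
          , trans (advance tc′ (xₑ :* (rc′ :+ back 𝕙 :* rc)) h tc′-suc) (+-congˡ (*-congˡ (untwist rc′ rc h)))
      ; SB-0 = vanish sb sb-0 , vanish sb′ sb′-0
      ; SB-suc = λ h → advance sb vb h sb-suc
          , trans (advance sb′ (vb′ :+ back 𝕙 :* vb) h sb′-suc) (+-congˡ (untwist vb′ vb h))
      ; RB-eq = λ h → split rb rc sb h rb-eq , split rb′ rc′ sb′ h rb′-eq
      ; VB-eq = λ h → recur vb rb h vb-eq , recur vb′ rb′ h vb′-eq
      ; RA-eq = λ h →
          trans (solve ra (wa :+ (back sb :+ back sb) :+ back (rc :- tc)) (env (suc h)) ra-eq)
            (+-cong (+-congˡ (+-cong (sym (seq-back sb h)) (sym (seq-back sb h))))
              (trans (sym (seq-back (rc :- tc) h)) (prev h .proj₁)))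
        , trans (solve ra′ (wa′ :+ back 𝕙 :* wa :+ (back sb′ :+ back sb′) :+ back (rc′ :- tc′)) (env (suc h)) ra′-eq)
            (+-cong (+-cong (untwist wa′ wa h) (+-cong (sym (seq-back sb′ h)) (sym (seq-back sb′ h))))
              (trans (sym (seq-back (rc′ :- tc′) h)) (prev h .proj₂)))
      ; VA-eq = λ h → recur₂ va ra h va-eq , recur₂ va′ ra′ h va′-eq
      ; WA-eq = λ h → final va wa h wa-eq , final va′ wa′ h wa′-eq
      }
      where
      advance : ∀ e d h → e ≋ back e :+ d → seq e (suc h) ≈ seq e h + seq d (suc h)
      advance e d h eq = trans (solve e (back e :+ d) (env (suc h)) eq) (+-congʳ (sym (seq-back e h)))

      untwist : ∀ e d h → seq (e :+ back 𝕙 :* d) (suc h) ≈ seq e (suc h) + ι (+ h) * seq d (suc h)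
      untwist e d h = +-congˡ (*-congʳ (sym (seq-back 𝕙 h)))

      split : ∀ e f g h → e ≋ back f :+ g → seq e (suc h) ≈ seq f h + seq g (suc h)
      split e f g h eq = trans (solve e (back f :+ g) (env (suc h)) eq) (+-congʳ (sym (seq-back f h)))

      recur : ∀ e f h → back e ≋ xₑ :* back f :+ yₑ :* e →
              seq e (suc h) ≈ x * seq f (suc h) + y * seq e (suc (suc h))
      recur e f h eq = trans (seq-back e (suc h)) (trans (solve (back e) (xₑ :* back f :+ yₑ :* e) (env (suc (suc h))) eq)
        (+-congʳ (*-congˡ (sym (seq-back f (suc h))))))

      recur₂ : ∀ e f h → back e ≋ xₑ :* back (back f) :+ yₑ :* e →
               seq e (suc (suc h)) ≈ x * seq f (suc h) + y * seq e (suc (suc (suc h)))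
      recur₂ e f h eq = trans (seq-back e (suc (suc h)))
        (trans (solve (back e) (xₑ :* back (back f) :+ yₑ :* e) (env (suc (suc (suc h)))) eq)
        (+-congʳ (*-congˡ (sym (trans (seq-back f (suc h)) (seq-back (back f) (suc (suc h))))))))

      final : ∀ e f h → back f ≋ e :+ yₑ :* f →
              seq f (suc h) ≈ seq e (suc (suc h)) + y * seq f (suc (suc h))
      final e f h eq = trans (seq-back f (suc h)) (solve (back f) (e :+ yₑ :* f) (env (suc (suc h))) eq)

      seq-rc-0 : seq rc 0 ≈ δ
      seq-rc-0 = trans (seq-origin rc) (trans (solve (origin rc) (origin (con (+ 4) :* Sₑ :^ 8 :* 𝕫)) (env 0) rc-0)
        (trans (sym (seq-origin (con (+ 4) :* Sₑ :^ 8 :* 𝕫))) (trans (*-congˡ ι-1) (*-identityʳ _))))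

      prev : ∀ h → pair (rc :- tc , rc′ :- tc′) h ≈₂ previous δ (pair (rc , rc′)) h
      prev zero    = trans (minus-zero rc tc tc-0) seq-rc-0
                   , trans (minus-zero rc′ tc′ tc′-0) (vanish rc′ rc′-0)
        where
        minus-zero : ∀ e d → origin d ≋ con (+ 0) → seq (e :- d) 0 ≈ seq e 0
        minus-zero e d eq = trans (-‿congᵇ refl (trans (vanish d eq) (sym ι-0)))
          (solve (var (# 0) :- con (+ 0)) (var (# 0)) (seq e 0 ∷ []) ≡.refl)
      prev (suc h) = undo rc tc rc-suc , undo rc′ tc′ rc′-suc
        where
        undo : ∀ e d → e ≋ back e :+ d → seq (e :- d) (suc h) ≈ seq e h
        undo e d eq = trans (-‿congᵇ (solve e (back e :+ d) (env (suc h)) eq) refl) (trans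
          (solve (var (# 0) :+ var (# 1) :- var (# 1)) (var (# 0)) (seq (back e) (suc h) ∷ seq d (suc h) ∷ []) ≡.refl)
          (sym (seq-back e h)))

    series-total : y * System.VA system 0 .proj₂ ≈ ι (+ 4) * ⟦ resultₑ ⟧ (x ∷ y ∷ ι (+ 1) - X - Y ∷ [])
    series-total = begin
      y * seq va′ 2                               ≈⟨ seq-at2 (yₑ :* va′) ⟩
      seq (at2 (yₑ :* va′)) 2                     ≈⟨ solve (at2 (yₑ :* va′)) (at2 (back (back (unshift total)))) (env 2) total-eq ⟩
      seq (at2 (back (back (unshift total)))) 2   ≈⟨ seq-start total ⟨
      seq (startₑ total) 2                        ≈⟨ solve (startₑ total) (con (+ 4) :* result′) (env 2) total-eval ⟩
      ι (+ 4) * ⟦ result′ ⟧ (env 2)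
      ≈⟨ *-congˡ (⟦⟧-subst {σ = xₑ ∷ yₑ ∷ Sₑ ∷ []} {ρ = env 2} (refl ∷ refl ∷ refl ∷ []) resultₑ) ⟨
      ι (+ 4) * ⟦ resultₑ ⟧ (x ∷ y ∷ ι (+ 1) - X - Y ∷ []) ∎
      where
      result′ : Expr 6
      result′ = substitute (xₑ ∷ yₑ ∷ Sₑ ∷ []) resultₑ

-- Uniqueness of the solution and the generating function

open Transfer seriesAlgebra 𝕏 𝕐 using (System; twist; previous; _+₂_; _·_; _≈₂_; scale)

CloseTo : ℕ → Series × Series → Series × Series → Set
CloseTo m (a , b) (c , d) = ∀ i → i ℕ.< m → ∀ n → a i n ≡ c i n × b i n ≡ d i n

close-≈ : ∀ {m u u′ v v′} → u ≈₂ u′ → v ≈₂ v′ → CloseTo m u′ v′ → CloseTo m u v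
close-≈ (p , p′) (q , q′) r i l n =
    ≡.trans (p i n) (≡.trans (r i l n .proj₁) (≡.sym (q i n)))
  , ≡.trans (p′ i n) (≡.trans (r i l n .proj₂) (≡.sym (q′ i n)))

close-+ : ∀ {m u u′ v v′} → CloseTo m u u′ → CloseTo m v v′ → CloseTo m (u +₂ v) (u′ +₂ v′)
close-+ p q i l n = ≡.cong₂ ℤ._+_ (p i l n .proj₁) (q i l n .proj₁)
                  , ≡.cong₂ ℤ._+_ (p i l n .proj₂) (q i l n .proj₂)

close-twist : ∀ {m u v} d → CloseTo m u v → CloseTo m (twist d u) (twist d v)
close-twist {u = a , b} {a′ , b′} d p i l n =
    p i l n .proj₁
  , ≡.cong₂ ℤ._+_ (p i l n .proj₂) (≡.trans (cst-⊛ (+ d) a i n)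
      (≡.trans (≡.cong (+ d ℤ.*_) (p i l n .proj₁)) (≡.sym (cst-⊛ (+ d) a′ i n))))

close-𝕏 : ∀ {m u v} → CloseTo m u v → CloseTo (suc m) (𝕏 · u) (𝕏 · v)
close-𝕏 {u = a , b} {a′ , b′} p zero l n =
    ≡.trans (𝕏-⊛-zero a n) (≡.sym (𝕏-⊛-zero a′ n)) , ≡.trans (𝕏-⊛-zero b n) (≡.sym (𝕏-⊛-zero b′ n))
close-𝕏 {u = a , b} {a′ , b′} p (suc i) (ℕ.s≤s l) n =
    ≡.trans (𝕏-⊛-suc a i n) (≡.trans (p i l n .proj₁) (≡.sym (𝕏-⊛-suc a′ i n)))
  , ≡.trans (𝕏-⊛-suc b i n) (≡.trans (p i l n .proj₂) (≡.sym (𝕏-⊛-suc b′ i n)))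

-- The recursion runs upwards in h and has no initial value, but each step costs a power of y: the
-- coefficient of yⁿ at h needs only that of yⁿ⁻¹ at h + 1. This is where solutions of ratio (1 ±
-- √x) / y are ruled out.
close-𝕐-recursion : ∀ {m} (f g f′ g′ : ℕ → Series × Series) →
  (∀ h → g h ≈₂ f h +₂ 𝕐 · g (suc h)) → (∀ h → g′ h ≈₂ f′ h +₂ 𝕐 · g′ (suc h)) →
  (∀ h → CloseTo m (f h) (f′ h)) → ∀ h → CloseTo m (g h) (g′ h)
close-𝕐-recursion f g f′ g′ p p′ q h i l zero =
    coefficient (g h .proj₁) (f h .proj₁) (g (suc h) .proj₁) (g′ h .proj₁) (f′ h .proj₁) (g′ (suc h) .proj₁)
      (p h .proj₁) (p′ h .proj₁) (q h i l 0 .proj₁)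
  , coefficient (g h .proj₂) (f h .proj₂) (g (suc h) .proj₂) (g′ h .proj₂) (f′ h .proj₂) (g′ (suc h) .proj₂)
      (p h .proj₂) (p′ h .proj₂) (q h i l 0 .proj₂)
  where
  coefficient : ∀ a b c a′ b′ c′ → a ≈ₛ b ⊕ 𝕐 ⊛ c → a′ ≈ₛ b′ ⊕ 𝕐 ⊛ c′ → b i 0 ≡ b′ i 0 → a i 0 ≡ a′ i 0
  coefficient a b c a′ b′ c′ r r′ s = ≡.trans (r i 0) (≡.trans
    (≡.cong₂ ℤ._+_ s (≡.trans (𝕐-⊛-zero c i) (≡.sym (𝕐-⊛-zero c′ i)))) (≡.sym (r′ i 0)))
close-𝕐-recursion f g f′ g′ p p′ q h i l (suc n) =
    coefficient (g h .proj₁) (f h .proj₁) (g (suc h) .proj₁) (g′ h .proj₁) (f′ h .proj₁) (g′ (suc h) .proj₁)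
      (p h .proj₁) (p′ h .proj₁) (q h i l (suc n) .proj₁) (rest .proj₁)
  , coefficient (g h .proj₂) (f h .proj₂) (g (suc h) .proj₂) (g′ h .proj₂) (f′ h .proj₂) (g′ (suc h) .proj₂)
      (p h .proj₂) (p′ h .proj₂) (q h i l (suc n) .proj₂) (rest .proj₂)
  where
  rest = close-𝕐-recursion f g f′ g′ p p′ q (suc h) i l n
  coefficient : ∀ a b c a′ b′ c′ → a ≈ₛ b ⊕ 𝕐 ⊛ c → a′ ≈ₛ b′ ⊕ 𝕐 ⊛ c′ →
                b i (suc n) ≡ b′ i (suc n) → c i n ≡ c′ i n → a i (suc n) ≡ a′ i (suc n)
  coefficient a b c a′ b′ c′ r r′ s t = ≡.trans (r i (suc n)) (≡.trans
    (≡.cong₂ ℤ._+_ s (≡.trans (𝕐-⊛-suc c i n) (≡.trans t (≡.sym (𝕐-⊛-suc c′ i n))))) (≡.sym (r′ i (suc n))))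

-- In every equation of the system the terms of the same x-degree are already determined.
module Uniqueness {δ : Series} (𝓢 𝓣 : System δ) where
  module S = System 𝓢
  module T = System 𝓣

  record Stage (m : ℕ) : Set where
    field
      rc : ∀ h → CloseTo m (S.RC h) (T.RC h)
      rb : ∀ h → CloseTo m (S.RB h) (T.RB h)
      ra : ∀ h → CloseTo m (S.RA h) (T.RA h)
      va : ∀ h → CloseTo m (S.VA h) (T.VA h)

  same : ∀ {m} u → CloseTo m u u
  same u i l n = ≡.refl , ≡.refl

  ascend : ∀ {m} → Stage m → Stage (suc m)
  ascend {m} L = record { rc = rc ; rb = rb ; ra = ra ; va = va }
    where
    module L = Stage L
    tc : ∀ h → CloseTo (suc m) (S.TC h) (T.TC h)
    tc zero    = close-≈ S.TC-0 T.TC-0 (same (𝕊.0# , 𝕊.0#))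
    tc (suc h) = close-≈ (S.TC-suc h) (T.TC-suc h) (close-+ (tc h) (close-𝕏 (close-twist h (L.rc (suc h)))))
    rc : ∀ h → CloseTo (suc m) (S.RC h) (T.RC h)
    rc zero    = close-≈ S.RC-0 T.RC-0 (same (δ , 𝕊.0#))
    rc (suc h) = close-≈ (S.RC-suc h) (T.RC-suc h) (close-+ (rc h) (tc (suc h)))
    vb : ∀ h → CloseTo (suc m) (S.VB h) (T.VB h)
    vb = close-𝕐-recursion (λ h → 𝕏 · S.RB h) S.VB (λ h → 𝕏 · T.RB h) T.VB S.VB-eq T.VB-eq (λ h → close-𝕏 (L.rb h))
    sb : ∀ h → CloseTo (suc m) (S.SB h) (T.SB h)
    sb zero    = close-≈ S.SB-0 T.SB-0 (same (𝕊.0# , 𝕊.0#))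
    sb (suc h) = close-≈ (S.SB-suc h) (T.SB-suc h) (close-+ (sb h) (close-twist h (vb h)))
    rb : ∀ h → CloseTo (suc m) (S.RB h) (T.RB h)
    rb h = close-≈ (S.RB-eq h) (T.RB-eq h) (close-+ (rc h) (sb (suc h)))
    va : ∀ h → CloseTo (suc m) (S.VA h) (T.VA h)
    va = close-𝕐-recursion (λ h → 𝕏 · S.RA h) S.VA (λ h → 𝕏 · T.RA h) T.VA S.VA-eq T.VA-eq (λ h → close-𝕏 (L.ra h))
    wa : ∀ h → CloseTo (suc m) (S.WA h) (T.WA h)
    wa = close-𝕐-recursion S.VA S.WA T.VA T.WA S.WA-eq T.WA-eq va
    prev : ∀ h → CloseTo (suc m) (previous δ S.RC h) (previous δ T.RC h)
    prev zero    = same (δ , 𝕊.0#)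
    prev (suc h) = rc h
    ra : ∀ h → CloseTo (suc m) (S.RA h) (T.RA h)
    ra h = close-≈ (S.RA-eq h) (T.RA-eq h)
      (close-+ (close-+ (close-twist h (wa h)) (close-+ (sb h) (sb h))) (prev h))

  stage : ∀ m → Stage m
  stage zero    = record { rc = λ _ _ () ; rb = λ _ _ () ; ra = λ _ _ () ; va = λ _ _ () }
  stage (suc m) = ascend (stage m)

  VA-unique : ∀ h → S.VA h .proj₂ ≈ₛ T.VA h .proj₂
  VA-unique h m n = Stage.va (stage (suc m)) h m ℕₚ.≤-refl n .proj₂

module _ (𝔸 : ℤ-Algebra) where

  open ℤ-Algebra 𝔸

  module Assembly (x y t v : Carrier)
    (t-fixed : t ≈ (ι (+ 1) + x * t) * (ι (+ 1) + y * t)) (v-fixed : v ≈ ι (+ 1) + x * v) where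

    private module Tr = Transfer 𝔸 x y
    open Identities 𝔸
    open Elimination 𝔸
    open NarayanaParametrisation 𝔸 x y t t-fixed

    -- Over an arbitrary algebra the operations stay opaque and no coefficient is ever unfolded.
    -- Uniqueness and `root ≈ S` enter as hypotheses because they depend on coefficients of series.
    assembly : (∀ {δ} (𝓢 𝓣 : Tr.System δ) → Tr.System.VA 𝓢 0 .proj₂ ≈ Tr.System.VA 𝓣 0 .proj₂) →
      ∀ (𝓢 : Tr.System 1#) {S T U d P₁ P₂ P₃} → root ≈ S → S * S ≈ d → T * S ^ 5 ≈ 1# → U * d ^ 4 ≈ 1# →
      ⟦ p₁ₑ ⟧ (x ∷ y ∷ S ∷ []) ≡ P₁ → ⟦ p₂ₑ ⟧ (x ∷ y ∷ S ∷ []) ≡ P₂ → ⟦ p₃ₑ ⟧ (x ∷ y ∷ S ∷ []) ≡ P₃ →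
      ι (+ 4) * (y * Tr.System.VA 𝓢 0 .proj₂) ≈ ι (+ 4) * ((P₁ + P₂) * U + P₃ * T)
    assembly unique 𝓢 {S} root≈ S² TS⁵ Ud⁴ ≡.refl ≡.refl ≡.refl =
      eliminate S² TS⁵ Ud⁴ _ _ _ _ (rescale root≈ y-parametrised (unique counted closed) 𝔽.series-total result)
      where
      v-inverse : (ι (+ 1) - X * (ι (+ 1) - Y)) * v ≈ ι (+ 1)
      v-inverse = trans (*-congʳ (-‿congᵇ refl (sym x-parametrised))) (geometric-inverse v-fixed)
      module 𝔽 = ClosedForm 𝔸 solution X Y v Z v-inverse Z-inverse
      closed : Tr.System 𝔽.δ
      closed = System-resp-≈ 𝔸 (sym x-parametrised) (sym y-parametrised) refl 𝔽.system
      counted : Tr.System 𝔽.δ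
      counted = System-resp-≈ 𝔸 refl refl (*-identityʳ 𝔽.δ) (Tr.scale 𝔽.δ 𝓢)
      result : ⟦ resultₑ ⟧ (𝔽.x ∷ 𝔽.y ∷ root ∷ []) ≈ ⟦ resultₑ ⟧ (x ∷ y ∷ S ∷ [])
      result = ⟦⟧-subst {σ = var (# 0) ∷ var (# 1) ∷ var (# 2) ∷ []} {ρ = x ∷ y ∷ S ∷ []}
        (sym x-parametrised ∷ sym y-parametrised ∷ root≈ ∷ []) resultₑ

generating-function : ∀ (𝓢 : System 𝟙) (S T U : Series) →
  S 0 0 ≡ + 1 → S ⊛ S ≈ₛ D → T ⊛ S ^ₛ 5 ≈ₛ 𝟙 → U ⊛ D ^ₛ 4 ≈ₛ 𝟙 →
  𝕐 ⊛ System.VA 𝓢 0 .proj₂ ≈ₛ (P₁ ⊕ P₂) ⊛ U ⊕ P₃ ⊛ T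
-- The factor 4 survives the algebra and is cancelled here in ℤ, coefficient by coefficient.
generating-function 𝓢 S T U S₀₀ S² TS⁵ UD⁴ m n = ℤₚ.*-cancelˡ-≡ (+ 4) (G m n) (R m n)
  (≡.trans (≡.sym (cst-⊛ (+ 4) G m n)) (≡.trans (equation m n) (cst-⊛ (+ 4) R m n)))
  where
  G R : Series
  G = 𝕐 ⊛ System.VA 𝓢 0 .proj₂
  R = (P₁ ⊕ P₂) ⊛ U ⊕ P₃ ⊛ T
  equation : cst (+ 4) ⊛ G ≈ₛ cst (+ 4) ⊛ R
  equation = Assembly.assembly seriesAlgebra 𝕏 𝕐 τ V Narayana.fixed Geometric.fixed
    (λ 𝓢 𝓣 → Uniqueness.VA-unique 𝓢 𝓣 0) 𝓢 {S} {T} {U} {D} {P₁} {P₂} {P₃}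
    (sqrt-unique S S₀₀ S²) S² TS⁵ UD⁴ ≡.refl ≡.refl ≡.refl

-- Completions of a convex polyomino

-- a +ε b is the value of a q-count at q = 1 + ε modulo ε²; weight w is multiplication by q ^ w.
data Count : Set where
  _+ε_ : ℤ → ℤ → Count

infixl 6 _⊞_
infix  5 _+ε_

number total : Count → ℤ
number (a +ε b) = a
total  (a +ε b) = b

_⊞_ : Count → Count → Count
(a +ε b) ⊞ (c +ε d) = a ℤ.+ c +ε b ℤ.+ d

∅ one : Count
∅   = + 0 +ε + 0
one = + 1 +ε + 0

weight : ℕ → Count → Count
weight w (a +ε b) = a +ε b ℤ.+ + w ℤ.* a

⊞-assoc : ∀ u v w → (u ⊞ v) ⊞ w ≡ u ⊞ (v ⊞ w)
⊞-assoc (a +ε b) (c +ε d) (e +ε f) = ≡.cong₂ _+ε_ (ℤₚ.+-assoc a c e) (ℤₚ.+-assoc b d f)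

⊞-comm : ∀ u v → u ⊞ v ≡ v ⊞ u
⊞-comm (a +ε b) (c +ε d) = ≡.cong₂ _+ε_ (ℤₚ.+-comm a c) (ℤₚ.+-comm b d)

⊞-identityˡ : ∀ u → ∅ ⊞ u ≡ u
⊞-identityˡ (a +ε b) = ≡.cong₂ _+ε_ (ℤₚ.+-identityˡ a) (ℤₚ.+-identityˡ b)

⊞-identityʳ : ∀ u → u ⊞ ∅ ≡ u
⊞-identityʳ u = ≡.trans (⊞-comm u ∅) (⊞-identityˡ u)

⊞-interchange : ∀ a b c d → (a ⊞ b) ⊞ (c ⊞ d) ≡ (a ⊞ c) ⊞ (b ⊞ d)
⊞-interchange a b c d = begin
  (a ⊞ b) ⊞ (c ⊞ d) ≡⟨ ⊞-assoc a b (c ⊞ d) ⟩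
  a ⊞ (b ⊞ (c ⊞ d)) ≡⟨ ≡.cong (a ⊞_) (⊞-assoc b c d) ⟨
  a ⊞ ((b ⊞ c) ⊞ d) ≡⟨ ≡.cong (λ z → a ⊞ (z ⊞ d)) (⊞-comm b c) ⟩
  a ⊞ ((c ⊞ b) ⊞ d) ≡⟨ ≡.cong (a ⊞_) (⊞-assoc c b d) ⟩
  a ⊞ (c ⊞ (b ⊞ d)) ≡⟨ ⊞-assoc a c (b ⊞ d) ⟨
  (a ⊞ c) ⊞ (b ⊞ d) ∎
  where open ≡.≡-Reasoning

weight-∅ : ∀ w → weight w ∅ ≡ ∅
weight-∅ w = ≡.cong (+ 0 +ε_) (≡.trans (ℤₚ.+-identityˡ _) (ℤₚ.*-zeroʳ (+ w)))

weight-⊞ : ∀ w u v → weight w (u ⊞ v) ≡ weight w u ⊞ weight w v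
weight-⊞ w (a +ε b) (c +ε d) = ≡.cong (a ℤ.+ c +ε_) (≡.trans
  (≡.cong (ℤ._+_ (b ℤ.+ d)) (ℤₚ.*-distribˡ-+ (+ w) a c)) (interchange b d (+ w ℤ.* a) (+ w ℤ.* c)))
  where open import Algebra.Properties.CommutativeSemigroup ℤₚ.+-commutativeSemigroup using (interchange)

Sum : ℕ → (ℕ → Count) → Count
Sum zero    f = ∅
Sum (suc n) f = f 0 ⊞ Sum n (f ∘ suc)

Sum-cong : ∀ n {f g} → (∀ i → i < n → f i ≡ g i) → Sum n f ≡ Sum n g
Sum-cong zero    p = ≡.refl
Sum-cong (suc n) p = ≡.cong₂ _⊞_ (p 0 z<s) (Sum-cong n (λ i i<n → p (suc i) (s<s i<n)))

Sum-∅ : ∀ n {f} → (∀ i → i < n → f i ≡ ∅) → Sum n f ≡ ∅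
Sum-∅ zero    p = ≡.refl
Sum-∅ (suc n) p = ≡.trans (≡.cong₂ _⊞_ (p 0 z<s) (Sum-∅ n (λ i i<n → p (suc i) (s<s i<n)))) (⊞-identityˡ ∅)

Sum-last : ∀ n f → Sum (suc n) f ≡ Sum n f ⊞ f n
Sum-last zero    f = ⊞-comm (f 0) ∅
Sum-last (suc n) f = ≡.trans (≡.cong (f 0 ⊞_) (Sum-last n (f ∘ suc))) (≡.sym (⊞-assoc (f 0) _ _))

Sum-⊞ : ∀ n f g → Sum n (λ i → f i ⊞ g i) ≡ Sum n f ⊞ Sum n g
Sum-⊞ zero    f g = ≡.refl
Sum-⊞ (suc n) f g = ≡.trans (≡.cong ((f 0 ⊞ g 0) ⊞_) (Sum-⊞ n (f ∘ suc) (g ∘ suc))) (⊞-interchange (f 0) (g 0) _ _)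

Sum-weight : ∀ n w f → Sum n (λ i → weight w (f i)) ≡ weight w (Sum n f)
Sum-weight zero    w f = ≡.sym (weight-∅ w)
Sum-weight (suc n) w f = ≡.trans (≡.cong (weight w (f 0) ⊞_) (Sum-weight n w (f ∘ suc))) (≡.sym (weight-⊞ w (f 0) _))

Sum-swap : ∀ m n (f : ℕ → ℕ → Count) → Sum m (λ i → Sum n (f i)) ≡ Sum n (λ j → Sum m (λ i → f i j))
Sum-swap zero    n f = ≡.sym (Sum-∅ n (λ _ _ → ≡.refl))
Sum-swap (suc m) n f = ≡.trans (≡.cong (Sum n (f 0) ⊞_) (Sum-swap m n (f ∘ suc))) (≡.sym (Sum-⊞ n (f 0) (λ j → Sum m (λ i → f (suc i) j))))

Sum-split : ∀ m n f → Sum (m ℕ.+ n) f ≡ Sum m f ⊞ Sum n (λ i → f (m ℕ.+ i))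
Sum-split zero    n f = ≡.sym (⊞-identityˡ _)
Sum-split (suc m) n f = ≡.trans (≡.cong (f 0 ⊞_) (Sum-split m n (f ∘ suc))) (≡.sym (⊞-assoc (f 0) _ _))

Sum-reverse : ∀ n f → Sum n (λ i → f (n ∸ suc i)) ≡ Sum n f
Sum-reverse zero    f = ≡.refl
Sum-reverse (suc n) f = begin
  f n ⊞ Sum n (λ i → f (n ∸ suc i)) ≡⟨ ≡.cong (f n ⊞_) (Sum-reverse n f) ⟩
  f n ⊞ Sum n f                     ≡⟨ ⊞-comm (f n) _ ⟩
  Sum n f ⊞ f n                     ≡⟨ Sum-last n f ⟨
  Sum (suc n) f                     ∎
  where open ≡.≡-Reasoning

-- The sum over all ways to add some of c rows to a column of height h, by V h = R h + y V (h + 1).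
extend : (ℕ → ℕ → Count) → ℕ → ℕ → Count
extend F zero    h = F 0 h
extend F (suc c) h = F (suc c) h ⊞ extend F c (suc h)

extend-Sum : ∀ F c h → extend F c h ≡ Sum (suc c) (λ j → F j (h ℕ.+ (c ∸ j)))
extend-Sum F zero    h = ≡.trans (≡.cong (F 0) (≡.sym (ℕₚ.+-identityʳ h))) (≡.sym (⊞-identityʳ _))
extend-Sum F (suc c) h = begin
  F (suc c) h ⊞ extend F c (suc h)
    ≡⟨ ⊞-comm (F (suc c) h) _ ⟩
  extend F c (suc h) ⊞ F (suc c) h
    ≡⟨ ≡.cong₂ _⊞_ (≡.trans (extend-Sum F c (suc h)) (Sum-cong (suc c) shift)) last ⟩
  Sum (suc c) G ⊞ G (suc c)
    ≡⟨ Sum-last (suc c) G ⟨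
  Sum (suc (suc c)) G ∎
  where
  open ≡.≡-Reasoning
  G : ℕ → Count
  G j = F j (h ℕ.+ (suc c ∸ j))
  shift : ∀ j → j < suc c → F j (suc h ℕ.+ (c ∸ j)) ≡ G j
  shift j (ℕ.s≤s j≤c) = ≡.cong (F j) (≡.trans (≡.sym (ℕₚ.+-suc h (c ∸ j))) (≡.cong (h ℕ.+_) (≡.sym (ℕₚ.+-∸-assoc 1 j≤c))))
  last : F (suc c) h ≡ G (suc c)
  last = ≡.cong (F (suc c)) (≡.trans (≡.sym (ℕₚ.+-identityʳ h)) (≡.cong (h ℕ.+_) (≡.sym (ℕₚ.n∸n≡0 c))))

at-zero : ℕ → Count → Count
at-zero zero    u = u
at-zero (suc _) u = ∅

-- The q-counts of the completions by k further columns. In rc both sides of the last column contract and h is its height;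
-- in rb one side still has to expand by c rows, in na both sides do, by a and c, and the height is suc h. In na a and c are
-- kept apart, so that its diagonal sums are the coefficients of RA.
rc tc : ℕ → ℕ → Count
rc zero    h = one
-- A column of height d + 1 has h - d positions beside one of height h, one for each e with d ≤ e <
-- h. The d + 1 shared rows create d interior vertices.
rc (suc k) h = Sum h (λ e → tc k (suc e))
tc k h = Sum h (λ d → weight d (rc k (suc d)))

rc-before : ℕ → ℕ → Count
rc-before k zero    = ∅
rc-before k (suc h) = rc (suc k) h

rb sb vb : ℕ → ℕ → ℕ → Count
rb zero    h c = at-zero c one
-- Either the expanding side has arrived (c = 0) and turns, giving up a row, so that both sides
-- contract within h rows; or it goes on, while the other side keeps d + 1 of the h + 1 rows.
rb (suc k) h c = at-zero c (rc (suc k) h) ⊞ sb k (suc h) c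
sb k h c = Sum h (λ d → weight d (vb k d c))
vb k h c = extend (λ j h′ → rb k h′ j) c h

na va wa : ℕ → ℕ → ℕ → ℕ → Count
na zero    a h c = at-zero a (at-zero c one)
-- Both sides go on, and then all h + 1 rows are shared; or the lower side turns, or the upper one,
-- or both. A side that turns gives up at least one row, which leaves h rows in the middle cases and
-- h - 1 in the last.
na (suc k) a h c = weight h (wa k a h c) ⊞ (at-zero a (sb k h c) ⊞ at-zero c (sb k h a)) ⊞ at-zero a (at-zero c (rc-before k h))
va k a h c = extend (λ j h′ → na k a h′ j) c h
wa k a h c = extend (λ i h′ → va k i h′ c) a h

diagonal : (ℕ → ℕ → Count) → ℕ → Count
diagonal f t = Sum (suc t) (λ a → f a (t ∸ a))

diagonal-⊞ : ∀ (f g : ℕ → ℕ → Count) t → diagonal (λ a c → f a c ⊞ g a c) t ≡ diagonal f t ⊞ diagonal g t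
diagonal-⊞ f g t = Sum-⊞ (suc t) (λ a → f a (t ∸ a)) (λ a → g a (t ∸ a))

diagonal-left : ∀ (f : ℕ → Count) t → diagonal (λ a c → at-zero a (f c)) t ≡ f t
diagonal-left f t = ≡.trans (≡.cong (f t ⊞_) (Sum-∅ t (λ _ _ → ≡.refl))) (⊞-identityʳ (f t))

diagonal-right : ∀ (f : ℕ → Count) t → diagonal (λ a c → at-zero c (f a)) t ≡ f t
diagonal-right f t = begin
  Sum (suc t) (λ a → at-zero (t ∸ a) (f a))                         ≡⟨ Sum-last t _ ⟩
  Sum t (λ a → at-zero (t ∸ a) (f a)) ⊞ at-zero (t ∸ t) (f t)
    ≡⟨ ≡.cong₂ _⊞_ (Sum-∅ t vanish) (≡.cong (λ d → at-zero d (f t)) (ℕₚ.n∸n≡0 t)) ⟩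
  ∅ ⊞ f t                                                           ≡⟨ ⊞-identityˡ (f t) ⟩
  f t                                                               ∎
  where
  open ≡.≡-Reasoning
  vanish : ∀ a → a < t → at-zero (t ∸ a) (f a) ≡ ∅
  vanish a a<t with t ∸ a | ℕₚ.m<n⇒0<n∸m a<t
  ... | suc _ | _ = ≡.refl

-- Adding a row raises h and lowers the total gap by one, so on antidiagonals it is a shift in y.
-- The pair with a = t + 1 has no room above and contributes only to the first summand; it is split
-- off before unfolding.
diagonal-extendʳ : ∀ (F : ℕ → ℕ → ℕ → Count) t h → diagonal (λ a c → extend (λ j h′ → F a h′ j) c h) (suc t)
  ≡ diagonal (λ a c → F a h c) (suc t) ⊞ diagonal (λ a c → extend (λ j h′ → F a h′ j) c (suc h)) t
diagonal-extendʳ F t h = begin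
  Sum (suc (suc t)) (λ a → E a (suc t ∸ a) h)
    ≡⟨ Sum-last (suc t) (λ a → E a (suc t ∸ a) h) ⟩
  Sum (suc t) (λ a → E a (suc t ∸ a) h) ⊞ E (suc t) (t ∸ t) h
    ≡⟨ ≡.cong₂ _⊞_ (Sum-cong (suc t) unfold) (last (t ∸ t) (ℕₚ.n∸n≡0 t)) ⟩
  Sum (suc t) (λ a → F a h (suc t ∸ a) ⊞ E a (t ∸ a) (suc h)) ⊞ F (suc t) h (t ∸ t)
    ≡⟨ ≡.cong (_⊞ F (suc t) h (t ∸ t)) (Sum-⊞ (suc t) (λ a → F a h (suc t ∸ a)) (λ a → E a (t ∸ a) (suc h))) ⟩
  (Sum (suc t) (λ a → F a h (suc t ∸ a)) ⊞ Sum (suc t) (λ a → E a (t ∸ a) (suc h))) ⊞ F (suc t) h (t ∸ t)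
    ≡⟨ ⊞-assoc _ _ _ ⟩
  Sum (suc t) (λ a → F a h (suc t ∸ a)) ⊞ (Sum (suc t) (λ a → E a (t ∸ a) (suc h)) ⊞ F (suc t) h (t ∸ t))
    ≡⟨ ≡.cong (Sum (suc t) (λ a → F a h (suc t ∸ a)) ⊞_) (⊞-comm (Sum (suc t) (λ a → E a (t ∸ a) (suc h))) _) ⟩
  Sum (suc t) (λ a → F a h (suc t ∸ a)) ⊞ (F (suc t) h (t ∸ t) ⊞ Sum (suc t) (λ a → E a (t ∸ a) (suc h)))
    ≡⟨ ⊞-assoc _ _ _ ⟨
  (Sum (suc t) (λ a → F a h (suc t ∸ a)) ⊞ F (suc t) h (t ∸ t)) ⊞ Sum (suc t) (λ a → E a (t ∸ a) (suc h))
    ≡⟨ ≡.cong (_⊞ Sum (suc t) (λ a → E a (t ∸ a) (suc h))) (Sum-last (suc t) (λ a → F a h (suc t ∸ a))) ⟨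
  diagonal (λ a c → F a h c) (suc t) ⊞ diagonal (λ a c → E a c (suc h)) t ∎
  where
  open ≡.≡-Reasoning
  E : ℕ → ℕ → ℕ → Count
  E a c h = extend (λ j h′ → F a h′ j) c h
  unfold : ∀ a → a < suc t → E a (suc t ∸ a) h ≡ F a h (suc t ∸ a) ⊞ E a (t ∸ a) (suc h)
  unfold a (ℕ.s≤s a≤t) rewrite ℕₚ.+-∸-assoc 1 a≤t = ≡.refl
  last : ∀ d → d ≡ 0 → E (suc t) d h ≡ F (suc t) h d
  last zero _ = ≡.refl

diagonal-extendˡ : ∀ (F : ℕ → ℕ → ℕ → Count) t h → diagonal (λ a c → extend (λ i h′ → F i h′ c) a h) (suc t)
  ≡ diagonal (λ a c → F a h c) (suc t) ⊞ diagonal (λ a c → extend (λ i h′ → F i h′ c) a (suc h)) t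
diagonal-extendˡ F t h = ≡.trans
  (≡.cong (F 0 h (suc t) ⊞_) (Sum-⊞ (suc t) (λ a → F (suc a) h (t ∸ a))
    (λ a → extend (λ i h′ → F i h′ (t ∸ a)) a (suc h))))
  (≡.sym (⊞-assoc (F 0 h (suc t)) _ _))

-- From counts to generating series

series : (ℕ → ℕ → Count) → Series × Series
series f = (λ m n → number (f m n)) , (λ m n → total (f m n))

infix 4 _≗₂_
_≗₂_ : (ℕ → ℕ → Count) → (ℕ → ℕ → Count) → Set
f ≗₂ g = ∀ m n → f m n ≡ g m n

x-shift y-shift : (ℕ → ℕ → Count) → ℕ → ℕ → Count
x-shift f zero    n       = ∅
x-shift f (suc m) n       = f m n
y-shift f m       zero    = ∅
y-shift f m       (suc n) = f m n

series-+₂ : ∀ f g → series (λ m n → f m n ⊞ g m n) ≈₂ series f +₂ series g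
series-+₂ f g = (λ m n → number-⊞ (f m n) (g m n)) , (λ m n → total-⊞ (f m n) (g m n))
  where
  number-⊞ : ∀ u v → number (u ⊞ v) ≡ number u ℤ.+ number v
  number-⊞ (a +ε b) (c +ε d) = ≡.refl
  total-⊞ : ∀ u v → total (u ⊞ v) ≡ total u ℤ.+ total v
  total-⊞ (a +ε b) (c +ε d) = ≡.refl

series-𝕏 : ∀ f → series (x-shift f) ≈₂ 𝕏 · series f
series-𝕏 f = shift number ≡.refl , shift total ≡.refl
  where
  shift : ∀ (π : Count → ℤ) → π ∅ ≡ + 0 → (λ m n → π (x-shift f m n)) ≈ₛ 𝕏 ⊛ (λ m n → π (f m n))
  shift π p zero    n = ≡.trans p (≡.sym (𝕏-⊛-zero (λ m n → π (f m n)) n))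
  shift π p (suc m) n = ≡.sym (𝕏-⊛-suc (λ m n → π (f m n)) m n)

series-𝕐 : ∀ f → series (y-shift f) ≈₂ 𝕐 · series f
series-𝕐 f = shift number ≡.refl , shift total ≡.refl
  where
  shift : ∀ (π : Count → ℤ) → π ∅ ≡ + 0 → (λ m n → π (y-shift f m n)) ≈ₛ 𝕐 ⊛ (λ m n → π (f m n))
  shift π p m zero    = ≡.trans p (≡.sym (𝕐-⊛-zero (λ m n → π (f m n)) m))
  shift π p m (suc n) = ≡.sym (𝕐-⊛-suc (λ m n → π (f m n)) m n)

series-weight : ∀ d f → series (λ m n → weight d (f m n)) ≈₂ twist d (series f)
series-weight d f = (λ m n → number-weight (f m n)) , λ m n → ≡.trans (total-weight (f m n))
  (≡.cong (ℤ._+_ (total (f m n))) (≡.sym (cst-⊛ (+ d) (λ m n → number (f m n)) m n)))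
  where
  number-weight : ∀ u → number (weight d u) ≡ number u
  number-weight (a +ε b) = ≡.refl
  total-weight : ∀ u → total (weight d u) ≡ total u ℤ.+ + d ℤ.* number u
  total-weight (a +ε b) = ≡.refl

private
  ≈₂-refl : ∀ u → u ≈₂ u
  ≈₂-refl u = (λ _ _ → ≡.refl) , (λ _ _ → ≡.refl)

  series-sum : ∀ f g h u v → f ≗₂ (λ m n → g m n ⊞ h m n) → series g ≈₂ u → series h ≈₂ v → series f ≈₂ u +₂ v
  series-sum f g h u v p (q , q′) (r , r′) =
      (λ m n → ≡.trans (≡.cong number (p m n)) (≡.trans (series-+₂ g h .proj₁ m n) (≡.cong₂ ℤ._+_ (q m n) (r m n))))
    , (λ m n → ≡.trans (≡.cong total (p m n)) (≡.trans (series-+₂ g h .proj₂ m n) (≡.cong₂ ℤ._+_ (q′ m n) (r′ m n))))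

private
  -- Coefficients of x ^ m y ^ n. The sequences T, S, V and W already include the column being
  -- added, hence `x-shift`. With both sides contracting no rows may be missing, hence `at-zero`.
  RCᶜ TCᶜ SBᶜ RBᶜ VBᶜ RAᶜ VAᶜ WAᶜ : ℕ → ℕ → ℕ → Count
  RCᶜ h m n = at-zero n (rc m h)
  TCᶜ h = x-shift (λ m n → at-zero n (tc m h))
  SBᶜ h = x-shift (λ m n → sb m h n)
  RBᶜ h m n = rb m h n
  VBᶜ h = x-shift (λ m n → vb m h n)
  RAᶜ h m = diagonal (λ a c → na m a h c)
  VAᶜ h = x-shift (λ m → diagonal (λ a c → va m a h c))
  WAᶜ h = x-shift (λ m → diagonal (λ a c → wa m a h c))
  previousᶜ : ℕ → ℕ → ℕ → Count
  previousᶜ zero    zero    n = at-zero n one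
  previousᶜ zero    (suc m) n = ∅
  previousᶜ (suc h) m       n = RCᶜ h m n

  at-zero-∅ : ∀ n → at-zero n ∅ ≡ ∅
  at-zero-∅ zero    = ≡.refl
  at-zero-∅ (suc n) = ≡.refl

  at-zero-⊞ : ∀ n u v → at-zero n (u ⊞ v) ≡ at-zero n u ⊞ at-zero n v
  at-zero-⊞ zero    u v = ≡.refl
  at-zero-⊞ (suc n) u v = ≡.refl

  at-zero-weight : ∀ n w u → at-zero n (weight w u) ≡ weight w (at-zero n u)
  at-zero-weight zero    w u = ≡.refl
  at-zero-weight (suc n) w u = ≡.sym (weight-∅ w)

  RC-sucᶜ : ∀ h m n → RCᶜ (suc h) m n ≡ RCᶜ h m n ⊞ TCᶜ (suc h) m n
  RC-sucᶜ h zero    n = ≡.sym (⊞-identityʳ _)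
  RC-sucᶜ h (suc m) n = ≡.trans (≡.cong (at-zero n) (Sum-last h _)) (at-zero-⊞ n (rc (suc m) h) (tc m (suc h)))

  TC-sucᶜ : ∀ h m n → TCᶜ (suc h) m n ≡ TCᶜ h m n ⊞ x-shift (λ m n → weight h (RCᶜ (suc h) m n)) m n
  TC-sucᶜ h zero    n = ≡.refl
  TC-sucᶜ h (suc m) n = ≡.trans (≡.cong (at-zero n) (Sum-last h _))
    (≡.trans (at-zero-⊞ n (tc m h) _) (≡.cong (at-zero n (tc m h) ⊞_) (at-zero-weight n h (rc m (suc h)))))

  SB-sucᶜ : ∀ h m n → SBᶜ (suc h) m n ≡ SBᶜ h m n ⊞ weight h (VBᶜ h m n)
  SB-sucᶜ h zero    n = ≡.trans (≡.sym (weight-∅ h)) (≡.sym (⊞-identityˡ _))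
  SB-sucᶜ h (suc m) n = Sum-last h _

  RB-eqᶜ : ∀ h m n → RBᶜ h m n ≡ RCᶜ h m n ⊞ SBᶜ (suc h) m n
  RB-eqᶜ h zero    n = ≡.sym (⊞-identityʳ _)
  RB-eqᶜ h (suc m) n = ≡.refl

  VB-eqᶜ : ∀ h m n → VBᶜ h m n ≡ x-shift (RBᶜ h) m n ⊞ y-shift (VBᶜ (suc h)) m n
  VB-eqᶜ h zero    zero    = ≡.refl
  VB-eqᶜ h zero    (suc n) = ≡.refl
  VB-eqᶜ h (suc m) zero    = ≡.sym (⊞-identityʳ _)
  VB-eqᶜ h (suc m) (suc n) = ≡.refl

  VA-eqᶜ : ∀ h m n → VAᶜ h m n ≡ x-shift (RAᶜ h) m n ⊞ y-shift (VAᶜ (suc h)) m n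
  VA-eqᶜ h zero    zero    = ≡.refl
  VA-eqᶜ h zero    (suc n) = ≡.refl
  VA-eqᶜ h (suc m) zero    = ≡.sym (⊞-identityʳ _)
  VA-eqᶜ h (suc m) (suc n) = diagonal-extendʳ (λ a h c → na m a h c) n h

  WA-eqᶜ : ∀ h m n → WAᶜ h m n ≡ VAᶜ h m n ⊞ y-shift (WAᶜ (suc h)) m n
  WA-eqᶜ h zero    zero    = ≡.refl
  WA-eqᶜ h zero    (suc n) = ≡.refl
  WA-eqᶜ h (suc m) zero    = ≡.sym (⊞-identityʳ _)
  WA-eqᶜ h (suc m) (suc n) = diagonal-extendˡ (λ a h c → va m a h c) n h

  RA-eqᶜ : ∀ h m n → RAᶜ h m n ≡ weight h (WAᶜ h m n) ⊞ (SBᶜ h m n ⊞ SBᶜ h m n) ⊞ previousᶜ h m n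
  RA-eqᶜ h zero n = ≡.trans (diagonal-left (λ c → at-zero c one) n) (≡.sym (≡.trans
    (≡.cong (λ z → z ⊞ (∅ ⊞ ∅) ⊞ previousᶜ h 0 n) (weight-∅ h)) (≡.trans (⊞-identityˡ _) (previous-0 h))))
    where
    previous-0 : ∀ h → previousᶜ h 0 n ≡ at-zero n one
    previous-0 zero    = ≡.refl
    previous-0 (suc h) = ≡.refl
  RA-eqᶜ h (suc m) n = begin
    diagonal (λ a c → weight h (wa m a h c) ⊞ (at-zero a (sb m h c) ⊞ at-zero c (sb m h a)) ⊞ at-zero a (at-zero c (rc-before m h))) n
      ≡⟨ diagonal-⊞ (λ a c → weight h (wa m a h c) ⊞ (at-zero a (sb m h c) ⊞ at-zero c (sb m h a)))
           (λ a c → at-zero a (at-zero c (rc-before m h))) n ⟩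
    diagonal (λ a c → weight h (wa m a h c) ⊞ (at-zero a (sb m h c) ⊞ at-zero c (sb m h a))) n
      ⊞ diagonal (λ a c → at-zero a (at-zero c (rc-before m h))) n
      ≡⟨ ≡.cong₂ _⊞_ (diagonal-⊞ (λ a c → weight h (wa m a h c)) (λ a c → at-zero a (sb m h c) ⊞ at-zero c (sb m h a)) n)
           (≡.trans (diagonal-left (λ c → at-zero c (rc-before m h)) n) (before h)) ⟩
    diagonal (λ a c → weight h (wa m a h c)) n ⊞ diagonal (λ a c → at-zero a (sb m h c) ⊞ at-zero c (sb m h a)) n ⊞ previousᶜ h (suc m) n
      ≡⟨ ≡.cong (_⊞ previousᶜ h (suc m) n) (≡.cong₂ _⊞_ (Sum-weight (suc n) h (λ a → wa m a h (n ∸ a)))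
           (≡.trans (diagonal-⊞ (λ a c → at-zero a (sb m h c)) (λ a c → at-zero c (sb m h a)) n)
             (≡.cong₂ _⊞_ (diagonal-left (λ c → sb m h c) n) (diagonal-right (λ a → sb m h a) n)))) ⟩
    weight h (WAᶜ h (suc m) n) ⊞ (sb m h n ⊞ sb m h n) ⊞ previousᶜ h (suc m) n ∎
    where
    open ≡.≡-Reasoning
    before : ∀ h → at-zero n (rc-before m h) ≡ previousᶜ h (suc m) n
    before zero    = at-zero-∅ n
    before (suc h) = ≡.refl

counting-system : System 𝟙
counting-system = record
  { RC = λ h → series (RCᶜ h) ; TC = λ h → series (TCᶜ h) ; SB = λ h → series (SBᶜ h) ; RB = λ h → series (RBᶜ h)
  ; VB = λ h → series (VBᶜ h) ; RA = λ h → series (RAᶜ h) ; VA = λ h → series (VAᶜ h) ; WA = λ h → series (WAᶜ h)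
  ; RC-0   = unit {RCᶜ 0} (λ { zero n → ≡.refl ; (suc m) n → at-zero-∅ n })
  ; RC-suc = λ h → plain (RCᶜ h) (TCᶜ (suc h)) (RC-sucᶜ h)
  ; TC-0   = empty {TCᶜ 0} (λ { zero n → ≡.refl ; (suc m) n → at-zero-∅ n })
  ; TC-suc = λ h → series-sum (TCᶜ (suc h)) (TCᶜ h) (x-shift (λ m n → weight h (RCᶜ (suc h) m n)))
      (series (TCᶜ h)) (𝕏 · twist h (series (RCᶜ (suc h)))) (TC-sucᶜ h) (≈₂-refl (series (TCᶜ h))) (x-weight h (RCᶜ (suc h)))
  ; SB-0   = empty {SBᶜ 0} (λ { zero n → ≡.refl ; (suc m) n → ≡.refl })
  ; SB-suc = λ h → series-sum (SBᶜ (suc h)) (SBᶜ h) (λ m n → weight h (VBᶜ h m n)) (series (SBᶜ h)) (twist h (series (VBᶜ h)))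
      (SB-sucᶜ h) (≈₂-refl (series (SBᶜ h))) (series-weight h (VBᶜ h))
  ; RB-eq  = λ h → plain (RCᶜ h) (SBᶜ (suc h)) (RB-eqᶜ h)
  ; VB-eq  = λ h → shifted (RBᶜ h) (VBᶜ (suc h)) (VB-eqᶜ h)
  ; RA-eq  = λ h → series-sum (RAᶜ h) (λ m n → weight h (WAᶜ h m n) ⊞ (SBᶜ h m n ⊞ SBᶜ h m n)) (previousᶜ h)
      (twist h (series (WAᶜ h)) +₂ (series (SBᶜ h) +₂ series (SBᶜ h))) (previous 𝟙 (λ h → series (RCᶜ h)) h) (RA-eqᶜ h)
      (series-sum (λ m n → weight h (WAᶜ h m n) ⊞ (SBᶜ h m n ⊞ SBᶜ h m n)) (λ m n → weight h (WAᶜ h m n)) (λ m n → SBᶜ h m n ⊞ SBᶜ h m n)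
        (twist h (series (WAᶜ h))) (series (SBᶜ h) +₂ series (SBᶜ h)) (λ _ _ → ≡.refl)
        (series-weight h (WAᶜ h)) (series-+₂ (SBᶜ h) (SBᶜ h)))
      (previous-series h)
  ; VA-eq  = λ h → shifted (RAᶜ h) (VAᶜ (suc h)) (VA-eqᶜ h)
  ; WA-eq  = λ h → series-sum (WAᶜ h) (VAᶜ h) (y-shift (WAᶜ (suc h))) (series (VAᶜ h)) (𝕐 · series (WAᶜ (suc h)))
      (WA-eqᶜ h) (≈₂-refl (series (VAᶜ h))) (series-𝕐 (WAᶜ (suc h)))
  }
  where
  plain : ∀ {f} g h → f ≗₂ (λ m n → g m n ⊞ h m n) → series f ≈₂ series g +₂ series h
  plain {f} g h p = series-sum f g h (series g) (series h) p (≈₂-refl (series g)) (≈₂-refl (series h))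
  shifted : ∀ {f} g h → f ≗₂ (λ m n → x-shift g m n ⊞ y-shift h m n) → series f ≈₂ 𝕏 · series g +₂ 𝕐 · series h
  shifted {f} g h p = series-sum f (x-shift g) (y-shift h) (𝕏 · series g) (𝕐 · series h) p (series-𝕏 g) (series-𝕐 h)
  x-weight : ∀ d f → series (x-shift (λ m n → weight d (f m n))) ≈₂ 𝕏 · twist d (series f)
  x-weight d f =
      𝕊.trans {series (x-shift g) .proj₁} {𝕏 ⊛ series g .proj₁} (series-𝕏 g .proj₁)
        (𝕊.*-congˡ {𝕏} {series g .proj₁} {twist d (series f) .proj₁} (series-weight d f .proj₁))
    , 𝕊.trans {series (x-shift g) .proj₂} {𝕏 ⊛ series g .proj₂} (series-𝕏 g .proj₂)
        (𝕊.*-congˡ {𝕏} {series g .proj₂} {twist d (series f) .proj₂} (series-weight d f .proj₂))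
    where
    g : ℕ → ℕ → Count
    g m n = weight d (f m n)
  empty : ∀ {f} → f ≗₂ (λ _ _ → ∅) → series f ≈₂ (𝕊.0# , 𝕊.0#)
  empty p = (λ m n → ≡.cong number (p m n)) , (λ m n → ≡.cong total (p m n))
  unit : ∀ {f} → f ≗₂ (λ { zero n → at-zero n one ; (suc m) n → ∅ }) → series f ≈₂ (𝟙 , 𝕊.0#)
  unit p = (λ { zero zero → ≡.cong number (p 0 0) ; zero (suc n) → ≡.cong number (p 0 (suc n)) ; (suc m) n → ≡.cong number (p (suc m) n) })
         , (λ { zero zero → ≡.cong total (p 0 0) ; zero (suc n) → ≡.cong total (p 0 (suc n)) ; (suc m) n → ≡.cong total (p (suc m) n) })
  previous-series : ∀ h → series (previousᶜ h) ≈₂ previous 𝟙 (λ h → series (RCᶜ h)) h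
  previous-series zero    = unit {previousᶜ 0} (λ { zero n → ≡.refl ; (suc m) n → ≡.refl })
  previous-series (suc h) = ≈₂-refl (series (RCᶜ h))

-- The first column is regarded as the upward extension of its bottom cell, with gap a below: this
-- is VA at h = 0, summed over a. That cell accounts for the extra power of y and the first column
-- for the extra power of x.
counting-formula : (S T U : Series) → S 0 0 ≡ + 1 → S ⊛ S ≈ₛ D → T ⊛ S ^ₛ 5 ≈ₛ 𝟙 → U ⊛ D ^ₛ 4 ≈ₛ 𝟙 →
  ∀ k t → total (diagonal (λ a c → va k a 0 c) t) ≡ ((P₁ ⊕ P₂) ⊛ U ⊕ P₃ ⊛ T) (suc k) (suc t)
counting-formula S T U S₀₀ S² TS⁵ UD⁴ k t = ≡.trans
  (≡.sym (𝕐-⊛-suc (λ m n → total (VAᶜ 0 m n)) (suc k) t))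
  (generating-function counting-system S T U S₀₀ S² TS⁵ UD⁴ (suc k) (suc t))

no-columns : (S T U : Series) → S 0 0 ≡ + 1 → S ⊛ S ≈ₛ D → T ⊛ S ^ₛ 5 ≈ₛ 𝟙 → U ⊛ D ^ₛ 4 ≈ₛ 𝟙 →
  ∀ n → + 0 ≡ ((P₁ ⊕ P₂) ⊛ U ⊕ P₃ ⊛ T) 0 n
no-columns S T U S₀₀ S² TS⁵ UD⁴ n = ≡.trans (coefficient n) (generating-function counting-system S T U S₀₀ S² TS⁵ UD⁴ 0 n)
  where
  coefficient : ∀ n → + 0 ≡ (𝕐 ⊛ (λ m n → total (VAᶜ 0 m n))) 0 n
  coefficient zero    = ≡.sym (𝕐-⊛-zero (λ m n → total (VAᶜ 0 m n)) 0)
  coefficient (suc n) = ≡.sym (𝕐-⊛-suc (λ m n → total (VAᶜ 0 m n)) 0 n)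

no-rows : (S T U : Series) → S 0 0 ≡ + 1 → S ⊛ S ≈ₛ D → T ⊛ S ^ₛ 5 ≈ₛ 𝟙 → U ⊛ D ^ₛ 4 ≈ₛ 𝟙 →
  ∀ m → + 0 ≡ ((P₁ ⊕ P₂) ⊛ U ⊕ P₃ ⊛ T) m 0
no-rows S T U S₀₀ S² TS⁵ UD⁴ m = ≡.trans (≡.sym (𝕐-⊛-zero (λ m n → total (VAᶜ 0 m n)) m))
  (generating-function counting-system S T U S₀₀ S² TS⁵ UD⁴ m 0)

-- Counting sequences of columns

open ≡ using (refl; sym; trans; cong; cong₂; subst)
open import Data.Nat using (_+_; _⊔_; _≤_; _≤ᵇ_)
open ℕₚ hiding (_≟_)

≤ᵇ-true : ∀ {m n} → m ≤ n → (m ≤ᵇ n) ≡ true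
≤ᵇ-true m≤n = Equivalence.to T-≡ (≤⇒≤ᵇ m≤n)

≤ᵇ-false : ∀ {m n} → n < m → (m ≤ᵇ n) ≡ false
≤ᵇ-false {m} {n} n<m with m ≤ᵇ n in eq
... | false = refl
... | true  = contradiction (≤ᵇ⇒≤ m n (Equivalence.from T-≡ eq)) (<⇒≱ n<m)

data Side : Set where
  expanding contracting : Side

when : Bool → Count → Count
when b u = if b then u else ∅

-- The new state of a side whose distance to the bounding box was a and becomes a′. A side may start to contract only
-- after it has reached the bounding box.
move : Side → ℕ → ℕ → (Side → Count) → Count
move expanding   a a′ G = if a′ ≤ᵇ a then G expanding else at-zero a (G contracting)
move contracting a a′ G = when (a ≤ᵇ a′) (G contracting)

done : Side → ℕ → Count → Count
done expanding   a u = at-zero a u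
done contracting a u = u

-- Two columns share a row when the larger lower gap plus the larger upper gap is below n, which
-- means four inequalities. The fourth, a + c < n, already holds for the old column.
meets : ℕ → ℕ → ℕ → ℕ → ℕ → Bool
meets n a c a′ c′ = (suc (a′ + c′) ≤ᵇ n) ∧ (suc (a′ + c) ≤ᵇ n) ∧ (suc (a + c′) ≤ᵇ n)

-- The number of shared rows minus one, which is the number of interior vertices between two
-- neighbouring columns that meet.
contact : ℕ → ℕ → ℕ → ℕ → ℕ → ℕ
contact n a c a′ c′ = n ∸ (a ⊔ a′) ∸ (c ⊔ c′) ∸ 1

-- A column of a box with n rows is described by the numbers a and c of empty cells below and above it.
completions : ℕ → ℕ → Side → ℕ → Side → ℕ → Count
completions n zero    p a r c = done p a (done r c one)
completions n (suc k) p a r c = Sum n λ a′ → move p a a′ λ p′ → Sum n λ c′ → move r c c′ λ r′ →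
  when (meets n a c a′ c′) (weight (contact n a c a′ c′) (completions n k p′ a′ r′ c′))

cell : ℕ → ℕ → ℕ → ℕ → Side → ℕ → Side → ℕ → Count
cell n k a c p′ a′ r′ c′ = when (meets n a c a′ c′) (weight (contact n a c a′ c′) (completions n k p′ a′ r′ c′))

at-zero-Sum : ∀ a n (f : ℕ → Count) → at-zero a (Sum n f) ≡ Sum n (λ i → at-zero a (f i))
at-zero-Sum zero    n f = refl
at-zero-Sum (suc a) n f = sym (Sum-∅ n (λ _ _ → refl))

Sum-reversed : ∀ n {f g : ℕ → Count} → (∀ i d → i + suc d ≡ n → f i ≡ g d) → Sum n f ≡ Sum n g
Sum-reversed n {f} {g} p = trans (Sum-cong n (λ i i<n → p i (n ∸ suc i)
  (trans (+-suc i _) (m+[n∸m]≡n i<n)))) (Sum-reverse n g)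

Sum-prefix : ∀ m l n {f : ℕ → Count} → m + l ≡ n → (∀ i → f (m + i) ≡ ∅) → Sum n f ≡ Sum m f
Sum-prefix m l n {f} refl p = trans (Sum-split m l f) (trans (cong (Sum m f ⊞_) (Sum-∅ l (λ i _ → p i))) (⊞-identityʳ _))

Sum-contracting : ∀ a l {n} (G : ℕ → Side → Count) → a + l ≡ n →
  Sum n (λ a′ → move contracting a a′ (G a′)) ≡ Sum l (λ i → G (a + i) contracting)
Sum-contracting a l G refl = trans (Sum-split a l (λ a′ → move contracting a a′ (G a′))) (trans
  (cong₂ _⊞_ (Sum-∅ a (λ i i<a → cong (λ b → when b (G i contracting)) (≤ᵇ-false i<a)))
    (Sum-cong l (λ i _ → cong (λ b → when b (G (a + i) contracting)) (≤ᵇ-true (m≤m+n a i)))))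
  (⊞-identityˡ _))

Sum-expanding : ∀ a l {n} (G : ℕ → Side → Count) → suc a + l ≡ n → Sum n (λ a′ → move expanding a a′ (G a′))
  ≡ Sum (suc a) (λ i → G i expanding) ⊞ at-zero a (Sum l (λ i → G (suc a + i) contracting))
Sum-expanding a l G refl = trans (Sum-split (suc a) l (λ a′ → move expanding a a′ (G a′))) (cong₂ _⊞_
  (Sum-cong (suc a) (λ { i (s≤s i≤a) → cong (λ b → if b then G i expanding else at-zero a (G i contracting)) (≤ᵇ-true i≤a) }))
  (trans (Sum-cong l (λ i _ → cong (λ b → if b then G (suc a + i) expanding else at-zero a (G (suc a + i) contracting))
    (≤ᵇ-false (s≤s (m≤m+n a i))))) (sym (at-zero-Sum a l (λ i → G (suc a + i) contracting)))))

meets-true : ∀ {n a c a′ c′} → a′ + c′ < n → a′ + c < n → a + c′ < n → meets n a c a′ c′ ≡ true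
meets-true p q r rewrite ≤ᵇ-true p | ≤ᵇ-true q | ≤ᵇ-true r = refl

meets-false : ∀ {n a c a′ c′} → n ≤ a′ + c′ → meets n a c a′ c′ ≡ false
meets-false p rewrite ≤ᵇ-false (s≤s p) = refl

meets-false₂ : ∀ {n a c a′ c′} → n ≤ a′ + c → meets n a c a′ c′ ≡ false
meets-false₂ {n} {a} {c} {a′} {c′} p rewrite ≤ᵇ-false (s≤s p) with suc (a′ + c′) ≤ᵇ n
... | true  = refl
... | false = refl

contact-value : ∀ {n a c a′ c′} A C w → a ⊔ a′ ≡ A → c ⊔ c′ ≡ C → A + suc w + C ≡ n → contact n a c a′ c′ ≡ w
contact-value A C w refl refl refl = begin
  A + suc w + C ∸ A ∸ C ∸ 1   ≡⟨ cong (λ z → z ∸ A ∸ C ∸ 1) (+-assoc A (suc w) C) ⟩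
  A + (suc w + C) ∸ A ∸ C ∸ 1 ≡⟨ cong (λ z → z ∸ C ∸ 1) (m+n∸m≡n A (suc w + C)) ⟩
  suc w + C ∸ C ∸ 1           ≡⟨ cong (_∸ 1) (m+n∸n≡m (suc w) C) ⟩
  w                           ∎
  where open ≡.≡-Reasoning

cell-value : ∀ {n k a c p′ a′ r′ c′} w u → meets n a c a′ c′ ≡ true → contact n a c a′ c′ ≡ w →
  completions n k p′ a′ r′ c′ ≡ u → cell n k a c p′ a′ r′ c′ ≡ weight w u
cell-value w u p refl refl rewrite p = refl

cell-∅ : ∀ {n k a c p′ a′ r′ c′} → meets n a c a′ c′ ≡ false → cell n k a c p′ a′ r′ c′ ≡ ∅
cell-∅ p rewrite p = refl

move-cong : ∀ p a a′ {F G} → (∀ p′ → F p′ ≡ G p′) → move p a a′ F ≡ move p a a′ G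
move-cong expanding   a a′ eq rewrite eq expanding | eq contracting = refl
move-cong contracting a a′ eq rewrite eq contracting = refl

move-Sum : ∀ p a a′ n (F : Side → ℕ → Count) → move p a a′ (λ p′ → Sum n (F p′)) ≡ Sum n (λ i → move p a a′ (λ p′ → F p′ i))
move-Sum expanding a a′ n F with a′ ≤ᵇ a
... | true  = refl
... | false = at-zero-Sum a n (F contracting)
move-Sum contracting a a′ n F with a ≤ᵇ a′
... | true  = refl
... | false = sym (Sum-∅ n (λ _ _ → refl))

at-zero-comm : ∀ a c u → at-zero a (at-zero c u) ≡ at-zero c (at-zero a u)
at-zero-comm zero    c       u = refl
at-zero-comm (suc a) zero    u = refl
at-zero-comm (suc a) (suc c) u = refl

at-zero-empty : ∀ a → at-zero a ∅ ≡ ∅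
at-zero-empty zero    = refl
at-zero-empty (suc a) = refl

move-comm : ∀ p a a′ r c c′ (F : Side → Side → Count) →
  move p a a′ (λ p′ → move r c c′ (F p′)) ≡ move r c c′ (λ r′ → move p a a′ (λ p′ → F p′ r′))
move-comm expanding a a′ expanding c c′ F with a′ ≤ᵇ a | c′ ≤ᵇ c
... | true  | true  = refl
... | true  | false = refl
... | false | true  = refl
... | false | false = at-zero-comm a c _
move-comm expanding a a′ contracting c c′ F with a′ ≤ᵇ a | c ≤ᵇ c′
... | true  | true  = refl
... | true  | false = refl
... | false | true  = refl
... | false | false = at-zero-empty a
move-comm contracting a a′ expanding c c′ F with a ≤ᵇ a′ | c′ ≤ᵇ c
... | true  | true  = refl
... | true  | false = refl
... | false | true  = refl
... | false | false = sym (at-zero-empty c)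
move-comm contracting a a′ contracting c c′ F with a ≤ᵇ a′ | c ≤ᵇ c′
... | true  | true  = refl
... | true  | false = refl
... | false | true  = refl
... | false | false = refl

meets-mirror : ∀ n a c a′ c′ → meets n a c a′ c′ ≡ meets n c a c′ a′
meets-mirror n a c a′ c′ rewrite +-comm a′ c′ | +-comm a′ c | +-comm a c′ =
  cong ((suc (c′ + a′) ≤ᵇ n) ∧_) (∧-comm (suc (c + a′) ≤ᵇ n) (suc (c′ + a) ≤ᵇ n))

contact-mirror : ∀ n a c a′ c′ → contact n a c a′ c′ ≡ contact n c a c′ a′
contact-mirror n a c a′ c′ = cong (_∸ 1) (trans (∸-+-assoc n (a ⊔ a′) (c ⊔ c′))
  (trans (cong (n ∸_) (+-comm (a ⊔ a′) (c ⊔ c′))) (sym (∸-+-assoc n (c ⊔ c′) (a ⊔ a′)))))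

-- Reflection in a horizontal line. It provides the case in which the upper side turns from the case
-- in which the lower side does.
mirror : ∀ n k p a r c → completions n k p a r c ≡ completions n k r c p a
cell-mirror : ∀ n k a c p′ a′ r′ c′ → cell n k a c p′ a′ r′ c′ ≡ cell n k c a r′ c′ p′ a′
cell-mirror n k a c p′ a′ r′ c′ = trans (cong₂ (λ b w → when b (weight w (completions n k p′ a′ r′ c′)))
  (meets-mirror n a c a′ c′) (contact-mirror n a c a′ c′))
  (cong (λ u → when (meets n c a c′ a′) (weight (contact n c a c′ a′) u)) (mirror n k p′ a′ r′ c′))
mirror n zero expanding   a expanding   c = at-zero-comm a c one
mirror n zero expanding   a contracting c = refl
mirror n zero contracting a expanding   c = refl
mirror n zero contracting a contracting c = refl
mirror n (suc k) p a r c = begin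
  Sum n (λ a′ → move p a a′ λ p′ → Sum n λ c′ → move r c c′ λ r′ → cell n k a c p′ a′ r′ c′)
    ≡⟨ Sum-cong n (λ a′ _ → move-Sum p a a′ n (λ p′ c′ → move r c c′ λ r′ → cell n k a c p′ a′ r′ c′)) ⟩
  Sum n (λ a′ → Sum n λ c′ → move p a a′ λ p′ → move r c c′ λ r′ → cell n k a c p′ a′ r′ c′)
    ≡⟨ Sum-swap n n (λ a′ c′ → move p a a′ λ p′ → move r c c′ λ r′ → cell n k a c p′ a′ r′ c′) ⟩
  Sum n (λ c′ → Sum n λ a′ → move p a a′ λ p′ → move r c c′ λ r′ → cell n k a c p′ a′ r′ c′)
    ≡⟨ Sum-cong n (λ c′ _ → Sum-cong n (λ a′ _ → trans (move-comm p a a′ r c c′ (λ p′ r′ → cell n k a c p′ a′ r′ c′))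
         (move-cong r c c′ (λ r′ → move-cong p a a′ (λ p′ → cell-mirror n k a c p′ a′ r′ c′))))) ⟩
  Sum n (λ c′ → Sum n λ a′ → move r c c′ λ r′ → move p a a′ λ p′ → cell n k c a r′ c′ p′ a′)
    ≡⟨ Sum-cong n (λ c′ _ → move-Sum r c c′ n (λ r′ a′ → move p a a′ λ p′ → cell n k c a r′ c′ p′ a′)) ⟨
  Sum n (λ c′ → move r c c′ λ r′ → Sum n λ a′ → move p a a′ λ p′ → cell n k c a r′ c′ p′ a′) ∎
  where open ≡.≡-Reasoning

-- One step of the induction on the number of columns. The three states are treated together because
-- B leads to C, and A leads to both.
module Pieces (n k : ℕ)
  (rc-value : ∀ a h c → a + suc h + c ≡ n → completions n k contracting a contracting c ≡ rc k (suc h))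
  (rb-value : ∀ a h c → a + suc h + c ≡ n → completions n k contracting a expanding c ≡ rb k h c)
  (na-value : ∀ a h c → a + suc h + c ≡ n → completions n k expanding a expanding c ≡ na k a h c) where

  open ≡.≡-Reasoning

  -- a₀ and c₀ are the gaps of the previous column, and H rows lie between the smallest new gaps a and c.
  contract-both : ∀ a₀ c₀ a c H {l l′} → a₀ ≤ a → c₀ ≤ c → a + l ≡ n → c + l′ ≡ n → a + H + c ≡ n →
    Sum l (λ i → Sum l′ (λ j → cell n k a₀ c₀ contracting (a + i) contracting (c + j))) ≡ rc (suc k) H
  contract-both a₀ c₀ a c H {l} {l′} a₀≤a c₀≤c l-eq l′-eq eq = begin
    -- Lower gaps `a + i` with i ≥ H leave no room for a column, so these terms vanish; the others
    -- are reindexed by d = H - i - 1, one less than the room left.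
    Sum l row                            ≡⟨ Sum-prefix H c l {row} l≡ (λ i → Sum-∅ l′ (λ j _ → cell-∅
        {n} {k} {a₀} {c₀} {contracting} {a + (H + i)} {contracting} {c + j}
        (meets-false {n} {a₀} {c₀} {a + (H + i)} {c + j} (beyond i j)))) ⟩
    Sum H row                            ≡⟨ Sum-reversed H {row} {λ d → tc k (suc d)} row-value ⟩
    Sum H (λ d → tc k (suc d))           ∎
    where
    row : ℕ → Count
    row i = Sum l′ (λ j → cell n k a₀ c₀ contracting (a + i) contracting (c + j))
    l≡ : H + c ≡ l
    l≡ = +-cancelˡ-≡ a (H + c) l (trans (sym (+-assoc a H c)) (trans eq (sym l-eq)))
    beyond : ∀ i j → n ≤ (a + (H + i)) + (c + j)
    beyond i j = ≤-trans (≤-reflexive (sym eq)) (≤-trans (m≤m+n (a + H + c) (i + j)) (≤-reflexive (rearrange a H c i j)))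
      where
      rearrange : ∀ a H c i j → a + H + c + (i + j) ≡ (a + (H + i)) + (c + j)
      rearrange = solve-∀
    row-value : ∀ i d → i + suc d ≡ H → row i ≡ tc k (suc d)
    row-value i d H-eq = trans (Sum-prefix (suc d) (i + a) l′ {λ j → cell n k a₀ c₀ contracting (a + i) contracting (c + j)} l′≡
      (λ j → cell-∅ {n} {k} {a₀} {c₀} {contracting} {a + i} {contracting} {c + (suc d + j)}
        (meets-false {n} {a₀} {c₀} {a + i} {c + (suc d + j)} (beyond′ j))))
      (Sum-reversed (suc d) {λ j → cell n k a₀ c₀ contracting (a + i) contracting (c + j)} {λ e → weight e (rc k (suc e))} value)
      where
      n-eq : ∀ {j e} → j + suc e ≡ suc d → (a + i) + suc e + (c + j) ≡ n
      n-eq {j} {e} p = trans (rearrange a i e c j) (trans (cong (λ z → a + (i + z) + c) p) (trans (cong (λ z → a + z + c) H-eq) eq))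
        where
        rearrange : ∀ a i e c j → (a + i) + suc e + (c + j) ≡ a + (i + (j + suc e)) + c
        rearrange = solve-∀
      l′≡ : suc d + (i + a) ≡ l′
      l′≡ = +-cancelˡ-≡ c (suc d + (i + a)) l′ (trans (rearrange c d i a) (trans (cong (λ z → a + z + c) H-eq) (trans eq (sym l′-eq))))
        where
        rearrange : ∀ c d i a → c + (suc d + (i + a)) ≡ a + (i + suc d) + c
        rearrange = solve-∀
      beyond′ : ∀ j → n ≤ (a + i) + (c + (suc d + j))
      beyond′ j = ≤-trans (≤-reflexive (sym (trans (cong (λ z → a + z + c) H-eq) eq)))
        (≤-trans (m≤m+n (a + (i + suc d) + c) j) (≤-reflexive (rearrange a i d c j)))
        where
        rearrange : ∀ a i d c j → a + (i + suc d) + c + j ≡ (a + i) + (c + (suc d + j))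
        rearrange = solve-∀
      value : ∀ j e → j + suc e ≡ suc d → cell n k a₀ c₀ contracting (a + i) contracting (c + j) ≡ weight e (rc k (suc e))
      value j e p = cell-value {n} {k} {a₀} {c₀} {contracting} {a + i} {contracting} {c + j} e (rc k (suc e))
        (meets-true {n} {a₀} {c₀} {a + i} {c + j} strict
          (≤-<-trans (+-monoʳ-≤ (a + i) (≤-trans c₀≤c (m≤m+n c j))) strict)
          (≤-<-trans (+-monoˡ-≤ (c + j) (≤-trans a₀≤a (m≤m+n a i))) strict))
        (contact-value {n} {a₀} {c₀} {a + i} {c + j} (a + i) (c + j) e (m≤n⇒m⊔n≡n (≤-trans a₀≤a (m≤m+n a i)))
          (m≤n⇒m⊔n≡n (≤-trans c₀≤c (m≤m+n c j))) (n-eq p))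
        (rc-value (a + i) e (c + j) (n-eq p))
        where
        strict : (a + i) + (c + j) < n
        strict = ≤-trans (+-monoˡ-< (c + j) (m<m+n (a + i) (s≤s z≤n))) (≤-reflexive (n-eq p))

  -- The shared rows lie between the new lower gap and the old upper gap `c`. Their number is
  -- therefore independent of the new upper gap, and the weight can be taken out of the inner sum.
  -- The value `a` is `a₀` if the lower side contracts already, and 1 if it turns at `a₀` = 0.
  contract-expand : ∀ a₀ a c H {l} → a₀ ≤ a → a₀ + c < n → a + l ≡ n → a + H + c ≡ n →
    Sum l (λ i → Sum (suc c) (λ j → cell n k a₀ c contracting (a + i) expanding j)) ≡ sb k H c
  contract-expand a₀ a c H {l} a₀≤a a₀+c<n l-eq eq = begin
    Sum l row                           ≡⟨ Sum-prefix H c l {row} l≡ (λ i → Sum-∅ (suc c) (λ j _ → cell-∅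
        {n} {k} {a₀} {c} {contracting} {a + (H + i)} {expanding} {j}
        (meets-false₂ {n} {a₀} {c} {a + (H + i)} {j} (beyond i)))) ⟩
    Sum H row                           ≡⟨ Sum-reversed H {row} {λ d → weight d (vb k d c)} row-value ⟩
    Sum H (λ d → weight d (vb k d c))   ∎
    where
    row : ℕ → Count
    row i = Sum (suc c) (λ j → cell n k a₀ c contracting (a + i) expanding j)
    l≡ : H + c ≡ l
    l≡ = +-cancelˡ-≡ a (H + c) l (trans (sym (+-assoc a H c)) (trans eq (sym l-eq)))
    beyond : ∀ i → n ≤ (a + (H + i)) + c
    beyond i = ≤-trans (≤-reflexive (sym eq)) (≤-trans (m≤m+n (a + H + c) i) (≤-reflexive (rearrange a H c i)))
      where
      rearrange : ∀ a H c i → a + H + c + i ≡ (a + (H + i)) + c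
      rearrange = solve-∀
    row-value : ∀ i d → i + suc d ≡ H → row i ≡ weight d (vb k d c)
    row-value i d H-eq = begin
      row i                                                               ≡⟨ Sum-cong (suc c) value ⟩
      Sum (suc c) (λ j → weight d (rb k (d + (c ∸ j)) j))                 ≡⟨ Sum-weight (suc c) d (λ j → rb k (d + (c ∸ j)) j) ⟩
      weight d (Sum (suc c) (λ j → rb k (d + (c ∸ j)) j))                 ≡⟨ cong (weight d) (extend-Sum (λ j h → rb k h j) c d) ⟨
      weight d (vb k d c)                                                 ∎
      where
      n-eq : (a + i) + suc d + c ≡ n
      n-eq = trans (cong (λ z → z + c) (+-assoc a i (suc d))) (trans (cong (λ z → a + z + c) H-eq) eq)
      value : ∀ j → j < suc c → cell n k a₀ c contracting (a + i) expanding j ≡ weight d (rb k (d + (c ∸ j)) j)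
      value j (s≤s j≤c) = cell-value {n} {k} {a₀} {c} {contracting} {a + i} {expanding} {j} d (rb k (d + (c ∸ j)) j)
        (meets-true {n} {a₀} {c} {a + i} {j} (≤-<-trans (+-monoʳ-≤ (a + i) j≤c) strict) strict (≤-<-trans (+-monoʳ-≤ a₀ j≤c) a₀+c<n))
        (contact-value {n} {a₀} {c} {a + i} {j} (a + i) c d (m≤n⇒m⊔n≡n (≤-trans a₀≤a (m≤m+n a i))) (m≥n⇒m⊔n≡m j≤c) n-eq)
        (rb-value (a + i) (d + (c ∸ j)) j (trans (rearrange (a + i) d (c ∸ j) j) (trans (cong (λ z → a + i + suc d + z) (m∸n+n≡m j≤c)) n-eq)))
        where
        strict : (a + i) + c < n
        strict = ≤-trans (+-monoˡ-< c (m<m+n (a + i) (s≤s z≤n))) (≤-reflexive n-eq)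
        rearrange : ∀ A d e j → A + suc (d + e) + j ≡ A + suc d + (e + j)
        rearrange = solve-∀

  -- The new column contains the old one, so every term has the same weight h; what remains are the
  -- extensions above and below.
  expand-both : ∀ a h c → a + suc h + c ≡ n →
    Sum (suc a) (λ i → Sum (suc c) (λ j → cell n k a c expanding i expanding j)) ≡ weight h (wa k a h c)
  expand-both a h c eq = begin
    Sum (suc a) (λ i → Sum (suc c) (λ j → cell n k a c expanding i expanding j))
      ≡⟨ Sum-cong (suc a) {_} {λ i → weight h (Sum (suc c) (λ j → na k i (h + (a ∸ i) + (c ∸ j)) j))}
           (λ i i<sa → trans (Sum-cong (suc c) (value i i<sa)) (Sum-weight (suc c) h (λ j → na k i (h + (a ∸ i) + (c ∸ j)) j))) ⟩
    Sum (suc a) (λ i → weight h (Sum (suc c) (λ j → na k i (h + (a ∸ i) + (c ∸ j)) j)))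
      ≡⟨ Sum-weight (suc a) h (λ i → Sum (suc c) (λ j → na k i (h + (a ∸ i) + (c ∸ j)) j)) ⟩
    weight h (Sum (suc a) (λ i → Sum (suc c) (λ j → na k i (h + (a ∸ i) + (c ∸ j)) j)))
      ≡⟨ cong (weight h) (Sum-cong (suc a) {λ i → va k i (h + (a ∸ i)) c} {λ i → Sum (suc c) (λ j → na k i (h + (a ∸ i) + (c ∸ j)) j)}
           (λ i _ → extend-Sum (λ j h → na k i h j) c (h + (a ∸ i)))) ⟨
    weight h (Sum (suc a) (λ i → va k i (h + (a ∸ i)) c))
      ≡⟨ cong (weight h) (extend-Sum (λ i h → va k i h c) a h) ⟨
    weight h (wa k a h c) ∎
    where
    strict : a + c < n
    strict = ≤-trans (+-monoˡ-< c (m<m+n a (s≤s z≤n))) (≤-reflexive eq)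
    value : ∀ i → i < suc a → ∀ j → j < suc c →
      cell n k a c expanding i expanding j ≡ weight h (na k i (h + (a ∸ i) + (c ∸ j)) j)
    value i (s≤s i≤a) j (s≤s j≤c) = cell-value {n} {k} {a} {c} {expanding} {i} {expanding} {j} h (na k i (h + (a ∸ i) + (c ∸ j)) j)
      (meets-true {n} {a} {c} {i} {j} (≤-<-trans (+-mono-≤ i≤a j≤c) strict) (≤-<-trans (+-monoˡ-≤ c i≤a) strict)
        (≤-<-trans (+-monoʳ-≤ a j≤c) strict))
      (contact-value {n} {a} {c} {i} {j} a c h (m≥n⇒m⊔n≡m i≤a) (m≥n⇒m⊔n≡m j≤c) eq)
      (na-value i (h + (a ∸ i) + (c ∸ j)) j (trans (rearrange i h (a ∸ i) (c ∸ j) j)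
        (trans (cong₂ (λ u v → u + suc h + v) (m∸n+n≡m i≤a) (m∸n+n≡m j≤c)) eq)))
      where
      rearrange : ∀ i h d e j → i + suc (h + d + e) + j ≡ (d + i) + suc h + (e + j)
      rearrange = solve-∀

  rc-step : ∀ a h c → a + suc h + c ≡ n → completions n (suc k) contracting a contracting c ≡ rc (suc k) (suc h)
  rc-step a h c eq = begin
    completions n (suc k) contracting a contracting c
      ≡⟨ Sum-contracting a (suc h + c) (λ a′ p′ → Sum n (λ c′ → move contracting c c′ (λ r′ → cell n k a c p′ a′ r′ c′))) a-eq ⟩
    Sum (suc h + c) (λ i → Sum n (λ c′ → move contracting c c′ (λ r′ → cell n k a c contracting (a + i) r′ c′)))
      ≡⟨ Sum-cong (suc h + c) (λ i _ → Sum-contracting c (suc h + a) (λ c′ r′ → cell n k a c contracting (a + i) r′ c′) c-eq) ⟩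
    Sum (suc h + c) (λ i → Sum (suc h + a) (λ j → cell n k a c contracting (a + i) contracting (c + j)))
      ≡⟨ contract-both a c a c (suc h) ≤-refl ≤-refl a-eq c-eq eq ⟩
    rc (suc k) (suc h) ∎
    where
    a-eq : a + (suc h + c) ≡ n
    a-eq = trans (sym (+-assoc a (suc h) c)) eq
    c-eq : c + (suc h + a) ≡ n
    c-eq = trans (rearrange a h c) eq
      where
      rearrange : ∀ a h c → c + (suc h + a) ≡ a + suc h + c
      rearrange = solve-∀

  rb-step : ∀ a h c → a + suc h + c ≡ n → completions n (suc k) contracting a expanding c ≡ rb (suc k) h c
  rb-step a h c eq = begin
    completions n (suc k) contracting a expanding c
      ≡⟨ Sum-contracting a (suc h + c) (λ a′ p′ → Sum n (λ c′ → move expanding c c′ (λ r′ → cell n k a c p′ a′ r′ c′))) a-eq ⟩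
    Sum (suc h + c) (λ i → Sum n (λ c′ → move expanding c c′ (λ r′ → cell n k a c contracting (a + i) r′ c′)))
      ≡⟨ Sum-cong (suc h + c) (λ i _ → Sum-expanding c (h + a) (λ c′ r′ → cell n k a c contracting (a + i) r′ c′) c-eq) ⟩
    Sum (suc h + c) (λ i → stay i ⊞ at-zero c (turn i))
      ≡⟨ Sum-⊞ (suc h + c) stay (λ i → at-zero c (turn i)) ⟩
    Sum (suc h + c) stay ⊞ Sum (suc h + c) (λ i → at-zero c (turn i))
      ≡⟨ cong₂ _⊞_ (contract-expand a a c (suc h) ≤-refl strict a-eq eq)
           (trans (sym (at-zero-Sum c (suc h + c) turn)) (turned c eq)) ⟩
    sb k (suc h) c ⊞ at-zero c (rc (suc k) h)
      ≡⟨ ⊞-comm (sb k (suc h) c) _ ⟩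
    rb (suc k) h c ∎
    where
    stay turn : ℕ → Count
    stay i = Sum (suc c) (λ j → cell n k a c contracting (a + i) expanding j)
    turn i = Sum (h + a) (λ j → cell n k a c contracting (a + i) contracting (suc c + j))
    a-eq : a + (suc h + c) ≡ n
    a-eq = trans (sym (+-assoc a (suc h) c)) eq
    c-eq : suc c + (h + a) ≡ n
    c-eq = trans (rearrange a h c) eq
      where
      rearrange : ∀ a h c → suc c + (h + a) ≡ a + suc h + c
      rearrange = solve-∀
    strict : a + c < n
    strict = ≤-trans (+-monoˡ-< c (m<m+n a (s≤s z≤n))) (≤-reflexive eq)
    turned : ∀ c → a + suc h + c ≡ n →
      at-zero c (Sum (suc h + c) (λ i → Sum (h + a) (λ j → cell n k a c contracting (a + i) contracting (suc c + j))))
        ≡ at-zero c (rc (suc k) h)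
    turned (suc c) eq = refl
    turned zero    eq = contract-both a 0 a 1 h ≤-refl z≤n (trans (sym (+-assoc a (suc h) 0)) eq)
      (trans (rearrange a h) eq) (trans (rearrange′ a h) eq)
      where
      rearrange : ∀ a h → 1 + (h + a) ≡ a + suc h + 0
      rearrange = solve-∀
      rearrange′ : ∀ a h → a + h + 1 ≡ a + suc h + 0
      rearrange′ = solve-∀

  na-step : ∀ a h c → a + suc h + c ≡ n → completions n (suc k) expanding a expanding c ≡ na (suc k) a h c
  na-step a h c eq = begin
    completions n (suc k) expanding a expanding c
      ≡⟨ Sum-expanding a (h + c) (λ a′ p′ → inner p′ a′) a-eq ⟩
    Sum (suc a) (λ i → inner expanding i) ⊞ at-zero a (Sum (h + c) (λ i → inner contracting (suc a + i)))
      ≡⟨ cong₂ _⊞_ (split expanding (suc a) (λ i → i)) (cong (at-zero a) (split contracting (h + c) (λ z → suc a + z))) ⟩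
    (EE ⊞ EC) ⊞ at-zero a (CE ⊞ CC)
      ≡⟨ cong₂ _⊞_ (cong₂ _⊞_ (expand-both a h c eq) (turned-top c eq))
           (trans (at-zero-⊞ a CE CC) (cong₂ _⊞_ (turned-bottom a eq) (turned-both a c eq))) ⟩
    (weight h (wa k a h c) ⊞ at-zero c (sb k h a)) ⊞ (at-zero a (sb k h c) ⊞ at-zero a (at-zero c (rc-before k h)))
      ≡⟨ ⊞-assoc _ (at-zero a (sb k h c)) _ ⟨
    (weight h (wa k a h c) ⊞ at-zero c (sb k h a)) ⊞ at-zero a (sb k h c) ⊞ at-zero a (at-zero c (rc-before k h))
      ≡⟨ cong (_⊞ at-zero a (at-zero c (rc-before k h))) (trans (⊞-assoc (weight h (wa k a h c)) _ _)
           (cong (weight h (wa k a h c) ⊞_) (⊞-comm (at-zero c (sb k h a)) (at-zero a (sb k h c))))) ⟩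
    na (suc k) a h c ∎
    where
    inner : Side → ℕ → Count
    inner p′ a′ = Sum n (λ c′ → move expanding c c′ (λ r′ → cell n k a c p′ a′ r′ c′))
    EE EC CE CC : Count
    EE = Sum (suc a) (λ i → Sum (suc c) (λ j → cell n k a c expanding i expanding j))
    EC = at-zero c (Sum (suc a) (λ i → Sum (h + a) (λ j → cell n k a c expanding i contracting (suc c + j))))
    CE = Sum (h + c) (λ i → Sum (suc c) (λ j → cell n k a c contracting (suc a + i) expanding j))
    CC = at-zero c (Sum (h + c) (λ i → Sum (h + a) (λ j → cell n k a c contracting (suc a + i) contracting (suc c + j))))
    a-eq : suc a + (h + c) ≡ n
    a-eq = trans (rearrange a h c) eq
      where
      rearrange : ∀ a h c → suc a + (h + c) ≡ a + suc h + c
      rearrange = solve-∀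
    c-eq : suc c + (h + a) ≡ n
    c-eq = trans (rearrange a h c) eq
      where
      rearrange : ∀ a h c → suc c + (h + a) ≡ a + suc h + c
      rearrange = solve-∀
    split : ∀ p′ l (f : ℕ → ℕ) → Sum l (λ i → inner p′ (f i))
      ≡ Sum l (λ i → Sum (suc c) (λ j → cell n k a c p′ (f i) expanding j))
        ⊞ at-zero c (Sum l (λ i → Sum (h + a) (λ j → cell n k a c p′ (f i) contracting (suc c + j))))
    split p′ l f = trans (Sum-cong l (λ i _ → Sum-expanding c (h + a) (λ c′ r′ → cell n k a c p′ (f i) r′ c′) c-eq))
      (trans (Sum-⊞ l (λ i → Sum (suc c) (λ j → cell n k a c p′ (f i) expanding j)) (λ i → at-zero c (turn i)))
        (cong (Sum l (λ i → Sum (suc c) (λ j → cell n k a c p′ (f i) expanding j)) ⊞_) (sym (at-zero-Sum c l turn))))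
      where
      turn : ℕ → Count
      turn i = Sum (h + a) (λ j → cell n k a c p′ (f i) contracting (suc c + j))
    turned-bottom : ∀ a → a + suc h + c ≡ n →
      at-zero a (Sum (h + c) (λ i → Sum (suc c) (λ j → cell n k a c contracting (suc a + i) expanding j))) ≡ at-zero a (sb k h c)
    turned-bottom (suc a) eq = refl
    turned-bottom zero    eq = contract-expand 0 1 c h z≤n (≤-trans (s≤s (m≤n+m c h)) (≤-reflexive eq)) eq eq
    turned-top : ∀ c → a + suc h + c ≡ n →
      at-zero c (Sum (suc a) (λ i → Sum (h + a) (λ j → cell n k a c expanding i contracting (suc c + j)))) ≡ at-zero c (sb k h a)
    turned-top (suc c) eq = refl
    -- After exchanging the sums, reflection turns this into a lower side that leaves gap 0 while
    -- the upper side goes on.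
    turned-top zero    eq = begin
      Sum (suc a) (λ i → Sum (h + a) (λ j → cell n k a 0 expanding i contracting (suc j)))
        ≡⟨ Sum-swap (suc a) (h + a) (λ i j → cell n k a 0 expanding i contracting (suc j)) ⟩
      Sum (h + a) (λ j → Sum (suc a) (λ i → cell n k a 0 expanding i contracting (suc j)))
        ≡⟨ Sum-cong (h + a) (λ j _ → Sum-cong (suc a) (λ i _ → cell-mirror n k a 0 expanding i contracting (suc j))) ⟩
      Sum (h + a) (λ j → Sum (suc a) (λ i → cell n k 0 a contracting (suc j) expanding i))
        ≡⟨ contract-expand 0 1 a h z≤n (≤-trans (s≤s (m≤n+m a h)) (≤-reflexive eq′)) eq′ eq′ ⟩
      sb k h a ∎
      where
      eq′ : suc (h + a) ≡ n
      eq′ = trans (rearrange a h) eq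
        where
        rearrange : ∀ a h → suc (h + a) ≡ a + suc h + 0
        rearrange = solve-∀
    turned-both : ∀ a c → a + suc h + c ≡ n →
      at-zero a (at-zero c (Sum (h + c) (λ i → Sum (h + a) (λ j → cell n k a c contracting (suc a + i) contracting (suc c + j)))))
        ≡ at-zero a (at-zero c (rc-before k h))
    turned-both (suc a) c       eq = refl
    turned-both zero    (suc c) eq = refl
    turned-both zero    zero    eq = both h eq
      where
      both : ∀ h → suc h + 0 ≡ n →
        Sum (h + 0) (λ i → Sum (h + 0) (λ j → cell n k 0 0 contracting (1 + i) contracting (1 + j))) ≡ rc-before k h
      both zero    eq = refl
      both (suc H) eq = contract-both 0 0 1 1 H z≤n z≤n eq eq (trans (rearrange H) eq)
        where
        rearrange : ∀ H → 1 + H + 1 ≡ suc (suc H) + 0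
        rearrange = solve-∀

completions-rc : ∀ n k a h c → a + suc h + c ≡ n → completions n k contracting a contracting c ≡ rc k (suc h)
completions-rb : ∀ n k a h c → a + suc h + c ≡ n → completions n k contracting a expanding c ≡ rb k h c
completions-na : ∀ n k a h c → a + suc h + c ≡ n → completions n k expanding a expanding c ≡ na k a h c
completions-rc n zero    a h c eq = refl
completions-rc n (suc k) = Pieces.rc-step n k (completions-rc n k) (completions-rb n k) (completions-na n k)
completions-rb n zero    a h c eq = refl
completions-rb n (suc k) = Pieces.rb-step n k (completions-rc n k) (completions-rb n k) (completions-na n k)
completions-na n zero    a h c eq = refl
completions-na n (suc k) = Pieces.na-step n k (completions-rc n k) (completions-rb n k) (completions-na n k)

completions-total : ∀ t k → Sum (suc t) (λ a → Sum (suc t) (λ c → when (suc (a + c) ≤ᵇ suc t) (completions (suc t) k expanding a expanding c)))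
  ≡ diagonal (λ a c → va k a 0 c) t
completions-total t k = Sum-cong (suc t) row
  where
  row : ∀ a → a < suc t →
    Sum (suc t) (λ c → when (suc (a + c) ≤ᵇ suc t) (completions (suc t) k expanding a expanding c)) ≡ va k a 0 (t ∸ a)
  row a (s≤s a≤t) = begin
    Sum (suc t) (λ c → when (suc (a + c) ≤ᵇ suc t) (completions (suc t) k expanding a expanding c))
      ≡⟨ Sum-prefix (suc (t ∸ a)) a (suc t) {λ c → when (suc (a + c) ≤ᵇ suc t) (completions (suc t) k expanding a expanding c)}
           (cong suc (m∸n+n≡m a≤t)) (λ i → cong (λ b → when b (completions (suc t) k expanding a expanding (suc (t ∸ a) + i)))
           (≤ᵇ-false (s≤s (outside i)))) ⟩
    Sum (suc (t ∸ a)) (λ c → when (suc (a + c) ≤ᵇ suc t) (completions (suc t) k expanding a expanding c))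
      ≡⟨ Sum-cong (suc (t ∸ a)) value ⟩
    Sum (suc (t ∸ a)) (λ c → na k a (t ∸ a ∸ c) c)
      ≡⟨ extend-Sum (λ j h → na k a h j) (t ∸ a) 0 ⟨
    va k a 0 (t ∸ a) ∎
    where
    open ≡.≡-Reasoning
    outside : ∀ i → suc t ≤ a + (suc (t ∸ a) + i)
    outside i = ≤-trans (≤-reflexive (sym (trans (+-suc a (t ∸ a)) (cong suc (m+[n∸m]≡n a≤t)))))
      (+-monoʳ-≤ a (m≤m+n (suc (t ∸ a)) i))
    value : ∀ c → c < suc (t ∸ a) → when (suc (a + c) ≤ᵇ suc t) (completions (suc t) k expanding a expanding c) ≡ na k a (t ∸ a ∸ c) c
    value c (s≤s c≤) = trans
      (cong (λ b → when b (completions (suc t) k expanding a expanding c))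
        (≤ᵇ-true (s≤s (≤-trans (+-monoʳ-≤ a c≤) (≤-reflexive (m+[n∸m]≡n a≤t))))))
      (completions-na (suc t) k a (t ∸ a ∸ c) c
        (trans (+-assoc a (suc (t ∸ a ∸ c)) c) (trans (+-suc a (t ∸ a ∸ c + c)) (cong suc (trans (cong (λ z → a + z) (m∸n+n≡m c≤)) (m+[n∸m]≡n a≤t))))))

-- Grids

runs : ∀ n → List (Vec Bool n)
runs zero    = []
runs (suc n) = map (true ∷_) (runs n) ++ (true ∷ replicate n false) ∷ []

columns : ∀ n → List (Vec Bool n)
columns zero    = []
columns (suc n) = runs (suc n) ++ map (false ∷_) (columns n)

data IsRun : ∀ {n} → ℕ → Vec Bool n → Set where
  last : ∀ {n} → IsRun n (true ∷ replicate n false)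
  more : ∀ {n c} {v : Vec Bool n} → IsRun c v → IsRun c (true ∷ v)

-- a and c are the numbers of empty cells below and above.
data IsColumn : ∀ {n} → ℕ → ℕ → Vec Bool n → Set where
  run  : ∀ {n c} {v : Vec Bool n} → IsRun c v → IsColumn 0 c v
  skip : ∀ {n a c} {v : Vec Bool n} → IsColumn a c v → IsColumn (suc a) c (false ∷ v)

runs-sound : ∀ n {v} → v ∈ runs n → ∃[ c ] IsRun c v
runs-sound (suc n) v∈ with ∈-++⁻ (map (true ∷_) (runs n)) v∈
... | inj₂ (here refl) = n , last
... | inj₁ v∈′ with ∈-map⁻ (true ∷_) v∈′
...   | w , w∈ , refl = let (c , r) = runs-sound n w∈ in c , more r

runs-complete : ∀ {n c} {v : Vec Bool n} → IsRun c v → v ∈ runs n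
runs-complete (last {n}) = ∈-++⁺ʳ (map (true ∷_) (runs n)) (here refl)
runs-complete (more r)   = ∈-++⁺ˡ (∈-map⁺ (true ∷_) (runs-complete r))

columns-sound : ∀ n {v} → v ∈ columns n → ∃[ a ] ∃[ c ] IsColumn a c v
columns-sound (suc n) v∈ with ∈-++⁻ (runs (suc n)) v∈
... | inj₁ v∈′ = let (c , r) = runs-sound (suc n) v∈′ in 0 , c , run r
... | inj₂ v∈′ with ∈-map⁻ (false ∷_) v∈′
...   | w , w∈ , refl = let (a , c , i) = columns-sound n w∈ in suc a , c , skip i

columns-complete : ∀ {n a c} {v : Vec Bool n} → IsColumn a c v → v ∈ columns n
columns-complete {suc n} (run r)  = ∈-++⁺ˡ (runs-complete r)
columns-complete {suc n} (skip i) = ∈-++⁺ʳ (runs (suc n)) (∈-map⁺ (false ∷_) (columns-complete i))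

runs-unique : ∀ n → Unique (runs n)
runs-unique zero    = []
runs-unique (suc n) = Uniqueₚ.++⁺ (Uniqueₚ.map⁺ (proj₂ ∘ ∷-injective) (runs-unique n)) (ListAll.[] ∷ []) disjoint
  where
  empty-is-no-run : ∀ n {c} → ¬ IsRun c (replicate n false)
  empty-is-no-run zero    ()
  empty-is-no-run (suc n) ()
  disjoint : ∀ {v} → ¬ (v ∈ map (true ∷_) (runs n) × v ∈ (true ∷ replicate n false) ∷ [])
  disjoint (v∈ , here refl) with ∈-map⁻ (true ∷_) v∈
  ... | w , w∈ , eq = empty-is-no-run n (subst (IsRun _) (sym (proj₂ (∷-injective eq))) (proj₂ (runs-sound n w∈)))

columns-unique : ∀ n → Unique (columns n)
columns-unique zero    = []
columns-unique (suc n) = Uniqueₚ.++⁺ (runs-unique (suc n)) (Uniqueₚ.map⁺ (proj₂ ∘ ∷-injective) (columns-unique n)) disjoint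
  where
  disjoint : ∀ {v} → ¬ (v ∈ runs (suc n) × v ∈ map (false ∷_) (columns n))
  disjoint (v∈ , v∈′) with runs-sound (suc n) v∈ | ∈-map⁻ (false ∷_) v∈′
  ... | _ , last   | _ , _ , ()
  ... | _ , more _ | _ , _ , ()

low : ∀ {n} → Vec Bool n → ℕ
low []          = 0
low (true  ∷ v) = 0
low (false ∷ v) = suc (low v)

inhabited : ∀ {n} → Vec Bool n → Bool
inhabited []          = false
inhabited (true  ∷ v) = true
inhabited (false ∷ v) = inhabited v

top : ∀ {n} → Vec Bool n → ℕ
top {zero}  []      = 0
top {suc n} (b ∷ v) = if inhabited v then top v else n

run-low : ∀ {n c} {v : Vec Bool n} → IsRun c v → low v ≡ 0
run-low last     = refl
run-low (more r) = refl

column-low : ∀ {n a c} {v : Vec Bool n} → IsColumn a c v → low v ≡ a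
column-low (run r)  = run-low r
column-low (skip i) = cong suc (column-low i)

run-inhabited : ∀ {n c} {v : Vec Bool n} → IsRun c v → inhabited v ≡ true
run-inhabited last     = refl
run-inhabited (more r) = refl

column-inhabited : ∀ {n a c} {v : Vec Bool n} → IsColumn a c v → inhabited v ≡ true
column-inhabited (run r)  = run-inhabited r
column-inhabited (skip i) = column-inhabited i

blank-uninhabited : ∀ n → inhabited (replicate n false) ≡ false
blank-uninhabited zero    = refl
blank-uninhabited (suc n) = blank-uninhabited n

run-top : ∀ {n c} {v : Vec Bool n} → IsRun c v → top v ≡ c
run-top {suc n} last rewrite blank-uninhabited n = refl
run-top {suc n} (more r) rewrite run-inhabited r = run-top r

column-top : ∀ {n a c} {v : Vec Bool n} → IsColumn a c v → top v ≡ c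
column-top (run r) = run-top r
column-top {suc n} (skip i) rewrite column-inhabited i = column-top i

vectors : ∀ {A : Set} → List A → ∀ k → List (Vec A k)
vectors xs zero    = [] ∷ []
vectors xs (suc k) = cartesianProductWith _∷_ xs (vectors xs k)

vectors-sound : ∀ {A : Set} (xs : List A) k {v} → v ∈ vectors xs k → All (_∈ xs) v
vectors-sound xs zero    (here refl) = []
vectors-sound xs (suc k) v∈ with ∈-cartesianProductWith⁻ _∷_ xs (vectors xs k) v∈
... | a , b , a∈ , b∈ , refl = a∈ ∷ vectors-sound xs k b∈

vectors-complete : ∀ {A : Set} (xs : List A) {k} {v : Vec A k} → All (_∈ xs) v → v ∈ vectors xs k
vectors-complete xs []       = here refl
vectors-complete xs (p ∷ ps) = ∈-cartesianProductWith⁺ _∷_ p (vectors-complete xs ps)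

vectors-unique : ∀ {A : Set} {xs : List A} → Unique xs → ∀ k → Unique (vectors xs k)
vectors-unique u zero    = ListAll.[] ∷ []
vectors-unique u (suc k) = Uniqueₚ.cartesianProductWith⁺ _∷_ ∷-injective u (vectors-unique u k)

sumOver : ∀ {A : Set} → List A → (A → Count) → Count
sumOver []       f = ∅
sumOver (x ∷ xs) f = f x ⊞ sumOver xs f

sumOver-cong : ∀ {A : Set} (xs : List A) {f g : A → Count} → (∀ x → x ∈ xs → f x ≡ g x) → sumOver xs f ≡ sumOver xs g
sumOver-cong []       p = refl
sumOver-cong (x ∷ xs) p = cong₂ _⊞_ (p x (here refl)) (sumOver-cong xs (λ y y∈ → p y (there y∈)))

sumOver-∅ : ∀ {A : Set} (xs : List A) → sumOver xs (λ _ → ∅) ≡ ∅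
sumOver-∅ []       = refl
sumOver-∅ (x ∷ xs) = cong (∅ ⊞_) (sumOver-∅ xs)

sumOver-weight : ∀ {A : Set} (xs : List A) w (f : A → Count) → sumOver xs (λ x → weight w (f x)) ≡ weight w (sumOver xs f)
sumOver-weight []       w f = sym (weight-∅ w)
sumOver-weight (x ∷ xs) w f = trans (cong (weight w (f x) ⊞_) (sumOver-weight xs w f)) (sym (weight-⊞ w (f x) _))

sumOver-++ : ∀ {A : Set} (xs ys : List A) (f : A → Count) → sumOver (xs ++ ys) f ≡ sumOver xs f ⊞ sumOver ys f
sumOver-++ []       ys f = sym (⊞-identityˡ _)
sumOver-++ (x ∷ xs) ys f = trans (cong (f x ⊞_) (sumOver-++ xs ys f)) (sym (⊞-assoc (f x) _ _))

sumOver-map : ∀ {A B : Set} (h : A → B) xs (f : B → Count) → sumOver (map h xs) f ≡ sumOver xs (f ∘ h)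
sumOver-map h []       f = refl
sumOver-map h (x ∷ xs) f = cong (f (h x) ⊞_) (sumOver-map h xs f)

sumOver-vectors : ∀ {A : Set} (xs : List A) k (f : Vec A (suc k) → Count) →
  sumOver (vectors xs (suc k)) f ≡ sumOver xs (λ x → sumOver (vectors xs k) (λ v → f (x ∷ v)))
sumOver-vectors xs k f = product xs
  where
  product : ∀ ys → sumOver (cartesianProductWith _∷_ ys (vectors xs k)) f ≡ sumOver ys (λ x → sumOver (vectors xs k) (λ v → f (x ∷ v)))
  product []       = refl
  product (y ∷ ys) = trans (sumOver-++ (map (y ∷_) (vectors xs k)) _ f)
    (cong₂ _⊞_ (sumOver-map (y ∷_) (vectors xs k) f) (product ys))

sumOver-runs : ∀ n (f : ℕ → ℕ → Count) → sumOver (runs n) (λ v → f (low v) (top v)) ≡ Sum n (f 0)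
sumOver-runs zero    f = refl
sumOver-runs (suc n) f = begin
  sumOver (map (true ∷_) (runs n) ++ (true ∷ replicate n false) ∷ []) F
    ≡⟨ sumOver-++ (map (true ∷_) (runs n)) _ F ⟩
  sumOver (map (true ∷_) (runs n)) F ⊞ (F (true ∷ replicate n false) ⊞ ∅)
    ≡⟨ cong₂ _⊞_ (trans (sumOver-map (true ∷_) (runs n) F) (sumOver-cong (runs n) step-top))
         (trans (⊞-identityʳ _) (cong (f 0) (run-top {suc n} last))) ⟩
  sumOver (runs n) (λ v → f 0 (top v)) ⊞ f 0 n
    ≡⟨ cong (_⊞ f 0 n) (trans (sumOver-cong (runs n) (λ v v∈ → cong (λ a → f a (top v)) (sym (run-low (proj₂ (runs-sound n v∈)))))) (sumOver-runs n f)) ⟩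
  Sum n (f 0) ⊞ f 0 n
    ≡⟨ Sum-last n (f 0) ⟨
  Sum (suc n) (f 0) ∎
  where
  open ≡.≡-Reasoning
  F : Vec Bool (suc n) → Count
  F v = f (low v) (top v)
  step-top : ∀ v → v ∈ runs n → f 0 (top (true ∷ v)) ≡ f 0 (top v)
  step-top v v∈ rewrite run-inhabited (proj₂ (runs-sound n v∈)) = refl

-- A column is determined by its two gaps, and every pair with a + c < n occurs. The guard on the
-- right replaces the enumeration of vectors.
sumOver-columns : ∀ n (f : ℕ → ℕ → Count) → sumOver (columns n) (λ v → f (low v) (top v))
  ≡ Sum n (λ a → Sum n (λ c → when (suc (a + c) ≤ᵇ n) (f a c)))
sumOver-columns zero    f = refl
sumOver-columns (suc n) f = begin
  sumOver (runs (suc n) ++ map (false ∷_) (columns n)) F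
    ≡⟨ sumOver-++ (runs (suc n)) _ F ⟩
  sumOver (runs (suc n)) F ⊞ sumOver (map (false ∷_) (columns n)) F
    ≡⟨ cong₂ _⊞_ (trans (sumOver-runs (suc n) f) (Sum-cong (suc n) (λ c c<n → cong (λ b → when b (f 0 c)) (sym (≤ᵇ-true c<n)))))
         (trans (sumOver-map (false ∷_) (columns n) F) (trans (sumOver-cong (columns n) step-top) (sumOver-columns n (f ∘ suc)))) ⟩
  Sum (suc n) (λ c → when (suc c ≤ᵇ suc n) (f 0 c)) ⊞ Sum n (λ a → Sum n (λ c → when (suc (a + c) ≤ᵇ n) (f (suc a) c)))
    ≡⟨ cong (Sum (suc n) (λ c → when (suc c ≤ᵇ suc n) (f 0 c)) ⊞_) (Sum-cong n (λ a _ → sym (widen a))) ⟩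
  Sum (suc n) (λ a → Sum (suc n) (λ c → when (suc (a + c) ≤ᵇ suc n) (f a c))) ∎
  where
  open ≡.≡-Reasoning
  F : Vec Bool (suc n) → Count
  F v = f (low v) (top v)
  step-top : ∀ v → v ∈ columns n → f (suc (low v)) (top (false ∷ v)) ≡ f (suc (low v)) (top v)
  step-top v v∈ rewrite column-inhabited (proj₂ (proj₂ (columns-sound n v∈))) = refl
  widen : ∀ a → Sum (suc n) (λ c → when (suc (suc a + c) ≤ᵇ suc n) (f (suc a) c)) ≡ Sum n (λ c → when (suc (a + c) ≤ᵇ n) (f (suc a) c))
  widen a = trans (Sum-last n _) (trans (cong (λ b → Sum n (λ c → when (suc (a + c) ≤ᵇ n) (f (suc a) c)) ⊞ when b (f (suc a) n))
    (≤ᵇ-false (s≤s (m≤n+m n a)))) (⊞-identityʳ _))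

gridCount : ∀ n {k} → Side → ℕ → Side → ℕ → Vec (Vec Bool n) k → Count
gridCount n p a r c []      = done p a (done r c one)
gridCount n p a r c (v ∷ g) = move p a (low v) λ p′ → move r c (top v) λ r′ →
  when (meets n a c (low v) (top v)) (weight (contact n a c (low v) (top v)) (gridCount n p′ (low v) r′ (top v) g))

sumOver-move : ∀ {A : Set} (xs : List A) p a a′ (F : Side → A → Count) →
  sumOver xs (λ x → move p a a′ (λ p′ → F p′ x)) ≡ move p a a′ (λ p′ → sumOver xs (F p′))
sumOver-move xs expanding a a′ F with a′ ≤ᵇ a
... | true  = refl
... | false = at-zero-sum a
  where
  at-zero-sum : ∀ a → sumOver xs (λ x → at-zero a (F contracting x)) ≡ at-zero a (sumOver xs (F contracting))
  at-zero-sum zero    = refl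
  at-zero-sum (suc a) = sumOver-∅ xs
sumOver-move xs contracting a a′ F with a ≤ᵇ a′
... | true  = refl
... | false = sumOver-∅ xs

sumOver-when : ∀ {A : Set} (xs : List A) b (f : A → Count) → sumOver xs (λ x → when b (f x)) ≡ when b (sumOver xs f)
sumOver-when xs true  f = refl
sumOver-when xs false f = sumOver-∅ xs

move-∅ : ∀ p a a′ → move p a a′ (λ _ → ∅) ≡ ∅
move-∅ expanding a a′ with a′ ≤ᵇ a
... | true  = refl
... | false = at-zero-empty a
move-∅ contracting a a′ with a ≤ᵇ a′
... | true  = refl
... | false = refl

gridCount-sum : ∀ n k p a r c → sumOver (vectors (columns n) k) (gridCount n p a r c) ≡ completions n k p a r c
gridCount-sum n zero    p a r c = ⊞-identityʳ _
gridCount-sum n (suc k) p a r c = begin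
  sumOver (vectors (columns n) (suc k)) (gridCount n p a r c)
    ≡⟨ sumOver-vectors (columns n) k (gridCount n p a r c) ⟩
  sumOver (columns n) (λ v → sumOver (vectors (columns n) k) (λ g → gridCount n p a r c (v ∷ g)))
    ≡⟨ sumOver-cong (columns n) (λ v _ → inner (low v) (top v)) ⟩
  sumOver (columns n) (λ v → next (low v) (top v))
    ≡⟨ sumOver-columns n next ⟩
  Sum n (λ a′ → Sum n (λ c′ → when (suc (a′ + c′) ≤ᵇ n) (next a′ c′)))
    ≡⟨ Sum-cong n (λ a′ _ → Sum-cong n (λ c′ _ → absorb a′ c′)) ⟩
  Sum n (λ a′ → Sum n (λ c′ → next a′ c′))
    ≡⟨ Sum-cong n (λ a′ _ → move-Sum p a a′ n (λ p′ c′ → move r c c′ (λ r′ → cell n k a c p′ a′ r′ c′))) ⟨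
  completions n (suc k) p a r c ∎
  where
  open ≡.≡-Reasoning
  next : ℕ → ℕ → Count
  next a′ c′ = move p a a′ (λ p′ → move r c c′ (λ r′ → cell n k a c p′ a′ r′ c′))
  inner : ∀ a′ c′ → sumOver (vectors (columns n) k) (λ g → move p a a′ λ p′ → move r c c′ λ r′ →
    when (meets n a c a′ c′) (weight (contact n a c a′ c′) (gridCount n p′ a′ r′ c′ g))) ≡ next a′ c′
  inner a′ c′ = trans (sumOver-move gs p a a′ _) (move-cong p a a′ λ p′ → trans (sumOver-move gs r c c′ _) (move-cong r c c′ λ r′ →
    trans (sumOver-when gs (meets n a c a′ c′) _) (cong (when (meets n a c a′ c′))
      (trans (sumOver-weight gs (contact n a c a′ c′) _) (cong (weight (contact n a c a′ c′)) (gridCount-sum n k p′ a′ r′ c′))))))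
    where gs = vectors (columns n) k
  -- The guard repeats the first conjunct of `meets`, so nothing is lost by dropping it.
  absorb : ∀ a′ c′ → when (suc (a′ + c′) ≤ᵇ n) (next a′ c′) ≡ next a′ c′
  absorb a′ c′ with suc (a′ + c′) ≤ᵇ n
  ... | true  = refl
  ... | false = sym (trans (move-cong p a a′ (λ _ → move-∅ r c c′)) (move-∅ p a a′))

run-bound : ∀ {n c} {v : Vec Bool n} → IsRun c v → c < n
run-bound last     = ≤-refl
run-bound (more r) = m<n⇒m<1+n (run-bound r)

column-bound : ∀ {n a c} {v : Vec Bool n} → IsColumn a c v → a + c < n
column-bound (run r)  = run-bound r
column-bound (skip i) = s≤s (column-bound i)

colAt-blank : ∀ n j → colAt (replicate n false) j ≡ false
colAt-blank zero    j       = refl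
colAt-blank (suc n) zero    = refl
colAt-blank (suc n) (suc j) = colAt-blank n j

run-cell⁻ : ∀ {n c} {v : Vec Bool n} → IsRun c v → ∀ j → colAt v j ≡ true → j + c < n
run-cell⁻ last             zero    p = ≤-refl
run-cell⁻ (last {n})       (suc j) p with trans (sym (colAt-blank n j)) p
... | ()
run-cell⁻ (more r) zero    p = m<n⇒m<1+n (run-bound r)
run-cell⁻ (more r) (suc j) p = s≤s (run-cell⁻ r j p)

run-cell⁺ : ∀ {n c} {v : Vec Bool n} → IsRun c v → ∀ j → j + c < n → colAt v j ≡ true
run-cell⁺ last       zero    p = refl
run-cell⁺ (last {n}) (suc j) (s≤s p) = contradiction (≤-trans (m≤n+m (suc n) j) (≤-trans (≤-reflexive (+-suc j n)) p)) (<-irrefl refl)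
run-cell⁺ (more r)   zero    p = refl
run-cell⁺ (more r)   (suc j) (s≤s p) = run-cell⁺ r j p

column-cell⁻ : ∀ {n a c} {v : Vec Bool n} → IsColumn a c v → ∀ j → colAt v j ≡ true → a ≤ j × j + c < n
column-cell⁻ (run r)  j       p = z≤n , run-cell⁻ r j p
column-cell⁻ (skip i) (suc j) p = let (q , r) = column-cell⁻ i j p in s≤s q , s≤s r

column-cell⁺ : ∀ {n a c} {v : Vec Bool n} → IsColumn a c v → ∀ j → a ≤ j → j + c < n → colAt v j ≡ true
column-cell⁺ (run r)  j       _       q       = run-cell⁺ r j q
column-cell⁺ (skip i) (suc j) (s≤s p) (s≤s q) = column-cell⁺ i j p q

convex-column : ∀ {n} (v : Vec Bool n) → (∃[ j ] colAt v j ≡ true) →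
  (∀ j₁ j₂ j → colAt v j₁ ≡ true → colAt v j₂ ≡ true → j₁ ≤ j → j ≤ j₂ → colAt v j ≡ true) → ∃[ a ] ∃[ c ] IsColumn a c v
convex-column (false ∷ v) (suc j , p) convex =
  let (a , c , i) = convex-column v (j , p) (λ j₁ j₂ j q r s t → convex (suc j₁) (suc j₂) (suc j) q r (s≤s s) (s≤s t)) in suc a , c , skip i
convex-column (true ∷ v) _ convex with blank-or-cell v
  where
  blank-or-cell : ∀ {n} (v : Vec Bool n) → v ≡ replicate n false ⊎ ∃[ j ] colAt v j ≡ true
  blank-or-cell []          = inj₁ refl
  blank-or-cell (true  ∷ v) = inj₂ (0 , refl)
  blank-or-cell (false ∷ v) with blank-or-cell v
  ... | inj₁ eq      = inj₁ (cong (false ∷_) eq)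
  ... | inj₂ (j , p) = inj₂ (suc j , p)
convex-column (true ∷ _) _ convex | inj₁ refl = 0 , _ , run last
convex-column (true ∷ v) _ convex | inj₂ (j , p)
  with convex-column v (j , p) (λ j₁ j₂ j q r s t → convex (suc j₁) (suc j₂) (suc j) q r (s≤s s) (s≤s t))
... | zero  , c , run r = 0 , c , run (more r)
-- A filled cell in row 0 and another above it force row 1 to be filled, so the tail cannot begin
-- with a gap.
... | suc a , c , i     with column-cell⁻ i 0 (convex 0 (suc j) 1 refl p z≤n (s≤s z≤n))
...   | () , _

Column : ∀ {n} → Vec Bool n → Set
Column v = IsColumn (low v) (top v) v

column-gaps : ∀ {n a c} {v : Vec Bool n} → IsColumn a c v → Column v
column-gaps {v = v} i = ≡.subst₂ (λ a c → IsColumn a c v) (sym (column-low i)) (sym (column-top i)) i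

meets⁻ : ∀ n a c a′ c′ → meets n a c a′ c′ ≡ true → a′ + c′ < n × a′ + c < n × a + c′ < n
meets⁻ n a c a′ c′ p with ≤ᵇ-dec (suc (a′ + c′)) n | ≤ᵇ-dec (suc (a′ + c)) n | ≤ᵇ-dec (suc (a + c′)) n
  where
  ≤ᵇ-dec : ∀ m n → m ≤ n ⊎ (m ≤ᵇ n) ≡ false
  ≤ᵇ-dec m n with m ≤? n
  ... | yes q = inj₁ q
  ... | no  q = inj₂ (≤ᵇ-false (≰⇒> q))
... | inj₁ q | inj₁ r | inj₁ s = q , r , s
meets⁻ n a c a′ c′ p | inj₂ q | _ | _ rewrite q = contradiction p λ ()
meets⁻ n a c a′ c′ p | inj₁ q | inj₂ r | _ rewrite ≤ᵇ-true q | r = contradiction p λ ()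
meets⁻ n a c a′ c′ p | inj₁ q | inj₁ r | inj₂ s rewrite ≤ᵇ-true q | ≤ᵇ-true r | s = contradiction p λ ()

sumℕ-upTo : ∀ (F : ℕ → ℕ) n → sumℕ (map F (upTo (suc n))) ≡ F 0 + sumℕ (map (F ∘ suc) (upTo n))
sumℕ-upTo F n = cong (λ l → F 0 + sumℕ l) (trans (map-applyUpTo suc F n) (sym (map-applyUpTo id (F ∘ suc) n)))

sumℕ-zero : ∀ (F : ℕ → ℕ) n → (∀ j → F j ≡ 0) → sumℕ (map F (upTo n)) ≡ 0
sumℕ-zero F zero    p = refl
sumℕ-zero F (suc n) p = trans (sumℕ-upTo F n) (cong₂ _+_ (p 0) (sumℕ-zero (F ∘ suc) n (p ∘ suc)))

sumℕ-block : ∀ A w r (F : ℕ → ℕ) → (∀ j → j < A → F j ≡ 0) → (∀ j → j < w → F (A + j) ≡ 1) →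
  (∀ j → F (A + w + j) ≡ 0) → sumℕ (map F (upTo (A + w + r))) ≡ w
sumℕ-block zero    zero    r F p q s = sumℕ-zero F r s
sumℕ-block zero    (suc w) r F p q s = trans (sumℕ-upTo F (w + r))
  (cong₂ _+_ (q 0 (s≤s z≤n)) (sumℕ-block zero w r (F ∘ suc) (λ _ ()) (λ j j<w → q (suc j) (s≤s j<w)) s))
sumℕ-block (suc A) w       r F p q s = trans (sumℕ-upTo F (A + w + r))
  (cong₂ _+_ (p 0 (s≤s z≤n)) (sumℕ-block A w r (F ∘ suc) (λ j j<A → p (suc j) (s≤s j<A)) q s))

interior : ∀ {n} → Vec Bool n → Vec Bool n → ℕ
interior {n} v w = sumℕ (map (λ j → if colAt v j ∧ colAt w j ∧ colAt v (suc j) ∧ colAt w (suc j) then 1 else 0) (upTo n))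

indicator-0 : ∀ p q r s → ¬ (p ≡ true × q ≡ true × r ≡ true × s ≡ true) → (if p ∧ q ∧ r ∧ s then 1 else 0) ≡ 0
indicator-0 false q     r     s     _ = refl
indicator-0 true  false r     s     _ = refl
indicator-0 true  true  false s     _ = refl
indicator-0 true  true  true  false _ = refl
indicator-0 true  true  true  true  h = contradiction (refl , refl , refl , refl) h

int-single : ∀ {n} (v : Vec Bool n) → int (v ∷ []) ≡ 0
int-single {n} v = trans (+-identityʳ _) (sumℕ-zero _ n (λ j → indicator-0 (colAt v j) false (colAt v (suc j)) false λ ()))

int-cons : ∀ {n k} (v w : Vec Bool n) (g : Vec (Vec Bool n) k) → int (v ∷ w ∷ g) ≡ interior v w + int (w ∷ g)
int-cons {n} {k} v w g = sumℕ-upTo (λ i → sumℕ (map (λ j →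
  if at (v ∷ w ∷ g) i j ∧ at (v ∷ w ∷ g) (suc i) j ∧ at (v ∷ w ∷ g) i (suc j) ∧ at (v ∷ w ∷ g) (suc i) (suc j) then 1 else 0) (upTo n))) (suc k)

⊔-lub-< : ∀ {n} a c a′ c′ → a + c < n → a′ + c′ < n → a′ + c < n → a + c′ < n → (a ⊔ a′) + (c ⊔ c′) < n
⊔-lub-< a c a′ c′ p q r s with ⊔-sel a a′ | ⊔-sel c c′
... | inj₁ e | inj₁ f rewrite e | f = p
... | inj₁ e | inj₂ f rewrite e | f = s
... | inj₂ e | inj₁ f rewrite e | f = r
... | inj₂ e | inj₂ f rewrite e | f = q

-- With A and C the larger gaps below and above and d + 1 shared rows, n = A + d + 1 + C. Rows j and
-- j + 1 are both shared exactly for A ≤ j < A + d, so the indicator sum is a block of d ones.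
interior-contact : ∀ {n a c a′ c′} {v w : Vec Bool n} → IsColumn a c v → IsColumn a′ c′ w →
  meets n a c a′ c′ ≡ true → interior v w ≡ contact n a c a′ c′
interior-contact {n} {a} {c} {a′} {c′} {v} {w} iv iw m = trans
  (trans (cong (λ k → sumℕ (map F (upTo k))) n-eq) (sumℕ-block A d (suc C) F below inside above))
  (sym (contact-value {n} {a} {c} {a′} {c′} A C d refl refl (trans (cong (λ z → z + C) (+-suc A d)) (trans (sym (+-suc (A + d) C)) (sym n-eq)))))
  where
  A C : ℕ
  A = a ⊔ a′
  C = c ⊔ c′
  A+C<n : A + C < n
  A+C<n = let (p , q , r) = meets⁻ n a c a′ c′ m in ⊔-lub-< a c a′ c′ (column-bound iv) p q r
  split : ∃[ d ] suc (A + C) + d ≡ n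
  split = m≤n⇒∃[o]m+o≡n A+C<n
  d : ℕ
  d = proj₁ split
  n-eq : n ≡ A + d + suc C
  n-eq = trans (sym (proj₂ split)) (trans (cong suc (trans (+-assoc A C d) (trans (cong (λ z → A + z) (+-comm C d)) (sym (+-assoc A d C))))) (sym (+-suc (A + d) C)))
  F : ℕ → ℕ
  F j = if colAt v j ∧ colAt w j ∧ colAt v (suc j) ∧ colAt w (suc j) then 1 else 0
  below : ∀ j → j < A → F j ≡ 0
  below j j<A = indicator-0 (colAt v j) (colAt w j) (colAt v (suc j)) (colAt w (suc j)) λ (p , q , _) →
    <⇒≱ j<A (⊔-lub (proj₁ (column-cell⁻ iv j p)) (proj₁ (column-cell⁻ iw j q)))
  inside : ∀ j → j < d → F (A + j) ≡ 1
  inside j j<d = cong (λ b → if b then 1 else 0) (four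
    (column-cell⁺ iv (A + j) (≤-trans (m≤m⊔n a a′) (m≤m+n A j)) (≤-<-trans (n≤1+n _) (room c (m≤m⊔n c c′))))
    (column-cell⁺ iw (A + j) (≤-trans (m≤n⊔m a a′) (m≤m+n A j)) (≤-<-trans (n≤1+n _) (room c′ (m≤n⊔m c c′))))
    (column-cell⁺ iv (suc (A + j)) (≤-trans (m≤m⊔n a a′) (≤-trans (m≤m+n A j) (n≤1+n _))) (room c (m≤m⊔n c c′)))
    (column-cell⁺ iw (suc (A + j)) (≤-trans (m≤n⊔m a a′) (≤-trans (m≤m+n A j) (n≤1+n _))) (room c′ (m≤n⊔m c c′))))
    where
    four : ∀ {p q r s} → p ≡ true → q ≡ true → r ≡ true → s ≡ true → (p ∧ q ∧ r ∧ s) ≡ true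
    four refl refl refl refl = refl
    room : ∀ e → e ≤ C → suc (A + j) + e < n
    room e e≤C = subst (suc (A + j) + e <_) (sym n-eq) (+-mono-≤-< (≤-trans (≤-reflexive (sym (+-suc A j))) (+-monoʳ-≤ A j<d)) (s≤s e≤C))
  above : ∀ j → F (A + d + j) ≡ 0
  above j = indicator-0 (colAt v (A + d + j)) (colAt w (A + d + j)) (colAt v (suc (A + d + j))) (colAt w (suc (A + d + j))) λ (_ , _ , p , q) →
    <⇒≱ (bound (proj₂ (column-cell⁻ iv (suc (A + d + j)) p)) (proj₂ (column-cell⁻ iw (suc (A + d + j)) q)))
      (≤-trans (≤-reflexive (trans n-eq (+-suc (A + d) C))) (s≤s (+-monoˡ-≤ C (m≤m+n (A + d) j))))
    where
    bound : suc (A + d + j) + c < n → suc (A + d + j) + c′ < n → suc (A + d + j) + C < n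
    bound p q with ⊔-sel c c′
    ... | inj₁ e rewrite e = p
    ... | inj₂ e rewrite e = q

-- `turn` requires a strict increase and `stay` excludes one, so a sequence of gaps has at most one
-- history of states. This is why no polyomino is counted twice.
data Step : Side → ℕ → ℕ → Side → Set where
  stay : ∀ {a a′} → a′ ≤ a → Step expanding a a′ expanding
  turn : ∀ {a a′} → a ≡ 0 → a < a′ → Step expanding a a′ contracting
  rise : ∀ {a a′} → a ≤ a′ → Step contracting a a′ contracting

End : Side → ℕ → Set
End expanding   a = a ≡ 0
End contracting a = ⊤

Valley : ∀ {A : Set} {k} → (A → ℕ) → Side → ℕ → Vec A k → Set
Valley f p a []      = End p a
Valley f p a (v ∷ g) = ∃[ p′ ] Step p a (f v) p′ × Valley f p′ (f v) g

Chain : ∀ {n k} → ℕ → ℕ → Vec (Vec Bool n) k → Set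
Chain         a c []      = ⊤
Chain {n = n} a c (v ∷ g) = meets n a c (low v) (top v) ≡ true × Chain (low v) (top v) g

move-step : ∀ {p a a′ p′} → Step p a a′ p′ → ∀ F → move p a a′ F ≡ F p′
move-step (stay q) F rewrite ≤ᵇ-true q = refl
move-step (turn refl q) F rewrite ≤ᵇ-false q = refl
move-step (rise q) F rewrite ≤ᵇ-true q = refl

move-cases : ∀ p a a′ F → move p a a′ F ≡ ∅ ⊎ ∃[ p′ ] Step p a a′ p′ × move p a a′ F ≡ F p′
move-cases expanding a a′ F with a′ ≤? a
... | yes q = inj₂ (expanding , stay q , move-step (stay q) F)
... | no  q with a
...   | zero  = inj₂ (contracting , turn refl (≰⇒> q) , move-step (turn refl (≰⇒> q)) F)
...   | suc a rewrite ≤ᵇ-false (≰⇒> q) = inj₁ refl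
move-cases contracting a a′ F with a ≤? a′
... | yes q = inj₂ (contracting , rise q , move-step (rise q) F)
... | no  q rewrite ≤ᵇ-false (≰⇒> q) = inj₁ refl

done-cases : ∀ p a u → done p a u ≡ ∅ ⊎ End p a × done p a u ≡ u
done-cases expanding   zero    u = inj₂ (refl , refl)
done-cases expanding   (suc a) u = inj₁ refl
done-cases contracting a       u = inj₂ (tt , refl)

-- The q-count of a single sequence of columns is q ^ int if the sequence is admissible and 0 otherwise.
gridCount-value : ∀ {n k} p r (v : Vec Bool n) (g : Vec (Vec Bool n) k) → Column v → All Column g →
  Valley low p (low v) g → Valley top r (top v) g → Chain (low v) (top v) g →
  gridCount n p (low v) r (top v) g ≡ (+ 1 +ε + int (v ∷ g))
gridCount-value p r v [] iv [] P R _ = trans (finish p r P R) (cong (λ k → + 1 +ε + k) (sym (int-single v)))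
  where
  finish : ∀ p r {a c} → End p a → End r c → done p a (done r c one) ≡ one
  finish expanding   expanding   refl refl = refl
  finish expanding   contracting refl _    = refl
  finish contracting expanding   _    refl = refl
  finish contracting contracting _    _    = refl
gridCount-value {n} p r v (w ∷ g) iv (iw ∷ ig) (p′ , P , Ps) (r′ , R , Rs) (m , ms) = begin
  gridCount n p (low v) r (top v) (w ∷ g)
    ≡⟨ trans (move-step P _) (move-step R _) ⟩
  when (meets n (low v) (top v) (low w) (top w)) (weight d (gridCount n p′ (low w) r′ (top w) g))
    ≡⟨ cong₂ (λ b u → when b (weight d u)) m (gridCount-value p′ r′ w g iw ig Ps Rs ms) ⟩
  (+ 1 +ε + int (w ∷ g) ℤ.+ + d ℤ.* + 1)
    ≡⟨ cong (+ 1 +ε_) (trans (cong (ℤ._+_ (+ int (w ∷ g))) (ℤₚ.*-identityʳ (+ d))) (cong (λ z → + z) (trans (+-comm (int (w ∷ g)) d)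
         (trans (cong (λ z → z + int (w ∷ g)) (sym (interior-contact iv iw m))) (sym (int-cons v w g)))))) ⟩
  (+ 1 +ε + int (v ∷ w ∷ g)) ∎
  where
  open ≡.≡-Reasoning
  d : ℕ
  d = contact n (low v) (top v) (low w) (top w)

-- The converse of `gridCount-value`: a nonzero count reveals admissibility, so the count can serve
-- as a decision procedure.
gridCount-cases : ∀ {n k} p a r c (g : Vec (Vec Bool n) k) →
  gridCount n p a r c g ≡ ∅ ⊎ Valley low p a g × Valley top r c g × Chain a c g
gridCount-cases p a r c [] with done-cases p a (done r c one)
... | inj₁ e = inj₁ e
... | inj₂ (P , e) with done-cases r c one
...   | inj₁ e′       = inj₁ (trans e e′)
...   | inj₂ (R , e′) = inj₂ (P , R , tt)
gridCount-cases {n} p a r c (v ∷ g) with move-cases p a (low v) (λ p′ → move r c (top v) λ r′ →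
  when (meets n a c (low v) (top v)) (weight (contact n a c (low v) (top v)) (gridCount n p′ (low v) r′ (top v) g)))
... | inj₁ e = inj₁ e
... | inj₂ (p′ , P , e) with move-cases r c (top v) (λ r′ →
  when (meets n a c (low v) (top v)) (weight (contact n a c (low v) (top v)) (gridCount n p′ (low v) r′ (top v) g)))
...   | inj₁ e′ = inj₁ (trans e e′)
...   | inj₂ (r′ , R , e′) with meets n a c (low v) (top v) in m | gridCount-cases p′ (low v) r′ (top v) g
...     | false | _       = inj₁ (trans e e′)
...     | true  | inj₁ e″ = inj₁ (trans e (trans e′ (trans (cong (weight (contact n a c (low v) (top v))) e″) (weight-∅ (contact n a c (low v) (top v))))))
...     | true  | inj₂ (Ps , Rs , ms) = inj₂ ((p′ , P , Ps) , (r′ , R , Rs) , refl , ms)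

-- Convexity and connectedness

nth : ∀ {A : Set} {k} → (A → ℕ) → Vec A k → ℕ → ℕ
nth f []      i       = 0
nth f (v ∷ g) zero    = f v
nth f (v ∷ g) (suc i) = nth f g i

cell⁻ : ∀ {n k} {g : Vec (Vec Bool n) k} → All Column g → ∀ i j → Cell g i j →
  i < k × nth low g i ≤ j × j + nth top g i < n
cell⁻ (c ∷ cs) zero    j p = s≤s z≤n , column-cell⁻ c j p
cell⁻ (c ∷ cs) (suc i) j p = let (q , r) = cell⁻ cs i j p in s≤s q , r

cell⁺ : ∀ {n k} {g : Vec (Vec Bool n) k} → All Column g → ∀ i j → i < k →
  nth low g i ≤ j → j + nth top g i < n → Cell g i j
cell⁺ (c ∷ cs) zero    j _       p q = column-cell⁺ c j p q
cell⁺ (c ∷ cs) (suc i) j (s≤s r) p q = cell⁺ cs i j r p q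

nth-bound : ∀ {n k} {g : Vec (Vec Bool n) k} → All Column g → ∀ i → i < k → nth low g i + nth top g i < n
nth-bound (c ∷ cs) zero    _       = column-bound c
nth-bound (c ∷ cs) (suc i) (s≤s r) = nth-bound cs i r

rising : ∀ {A : Set} (f : A → ℕ) {k} v (g : Vec A k) → Valley f contracting (f v) g →
  ∀ i j → i ≤ j → j ≤ k → nth f (v ∷ g) i ≤ nth f (v ∷ g) j
rising f v g       V zero    zero    _ _ = ≤-refl
rising f v (w ∷ g) (_ , rise q , V) zero    (suc j) _       (s≤s l) = ≤-trans q (rising f w g V 0 j z≤n l)
rising f v (w ∷ g) (_ , rise q , V) (suc i) (suc j) (s≤s r) (s≤s l) = rising f w g V i j r l

-- A sequence that first falls and then rises has no interior value above both of its ends. For the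
-- gaps below and above this is exactly row convexity.
valley-convex : ∀ {A : Set} (f : A → ℕ) {k} p v (g : Vec A k) → Valley f p (f v) g →
  ∀ i₁ i i₂ → i₁ ≤ i → i ≤ i₂ → i₂ ≤ k → nth f (v ∷ g) i ≤ nth f (v ∷ g) i₁ ⊔ nth f (v ∷ g) i₂
valley-convex f p v g V zero zero i₂ _ _ _ = m≤m⊔n (f v) _
valley-convex f contracting v g V zero (suc i) i₂ _ q l =
  ≤-trans (rising f v g V (suc i) i₂ q l) (m≤n⊔m (f v) _)
valley-convex f expanding v (w ∷ g) (_ , stay b , V) zero (suc i) (suc i₂) _ (s≤s q) (s≤s l) =
  ≤-trans (valley-convex f expanding w g V 0 i i₂ z≤n q l) (⊔-monoˡ-≤ (nth f (w ∷ g) i₂) b)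
valley-convex f expanding v (w ∷ g) (_ , turn _ b , V) zero (suc i) (suc i₂) _ (s≤s q) (s≤s l) =
  ≤-trans (rising f w g V i i₂ q l) (m≤n⊔m (f v) (nth f (w ∷ g) i₂))
valley-convex f p v (w ∷ g) (p′ , _ , V) (suc i₁) (suc i) (suc i₂) (s≤s r) (s≤s q) (s≤s l) =
  valley-convex f p′ w g V i₁ i i₂ r q l

-- An initially expanding side either turns, which needs gap 0, or ends expanding, which `End`
-- allows only at gap 0.
valley-zero : ∀ {A : Set} (f : A → ℕ) {k} v (g : Vec A k) → Valley f expanding (f v) g → ∃[ i ] i ≤ k × nth f (v ∷ g) i ≡ 0
valley-zero f v []      e = 0 , z≤n , e
valley-zero f v (w ∷ g) (_ , stay _ , V)   = let (i , l , e) = valley-zero f w g V in suc i , s≤s l , e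
valley-zero f v (w ∷ g) (_ , turn e _ , V) = 0 , z≤n , e

path-start : ∀ {m n} {g : Grid m n} {i j d} → Path g (i , j) d → Cell g i j
path-start (here c)     = c
path-start (step c _ _) = c

path-trans : ∀ {m n} {g : Grid m n} {a b c} → Path g a b → Path g b c → Path g a c
path-trans (here _)     q = q
path-trans (step c e p) q = step c e (path-trans p q)

path-shift : ∀ {m n} {v : Vec Bool n} {g : Grid m n} {i j i′ j′} →
  Path g (i , j) (i′ , j′) → Path (v ∷ g) (suc i , j) (suc i′ , j′)
path-shift (here c) = here c
path-shift (step c (inj₁ (refl , e)) p) = step c (inj₁ (refl , e)) (path-shift p)
path-shift (step c (inj₂ (refl , inj₁ refl)) p) = step c (inj₂ (refl , inj₁ refl)) (path-shift p)
path-shift (step c (inj₂ (refl , inj₂ refl)) p) = step c (inj₂ (refl , inj₂ refl)) (path-shift p)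

vertical : ∀ {m n} {v : Vec Bool n} {g : Grid m n} → Column v → ∀ j j′ → colAt v j ≡ true → colAt v j′ ≡ true →
  Path (v ∷ g) (0 , j) (0 , j′)
vertical {n = n} {v} {g} iv j j′ p p′ with ≤-total j j′
... | inj₁ j≤j′ with m≤n⇒∃[o]m+o≡n j≤j′
...   | d , refl = up d j p (proj₂ (column-cell⁻ iv (j + d) p′))
  where
  up : ∀ d j → colAt v j ≡ true → j + d + top v < n → Path (v ∷ g) (0 , j) (0 , j + d)
  up zero    j p q rewrite +-identityʳ j = here p
  up (suc d) j p q rewrite +-suc j d = step p (inj₁ (refl , inj₁ refl)) (up d (suc j)
    (column-cell⁺ iv (suc j) (m≤n⇒m≤1+n (proj₁ (column-cell⁻ iv j p))) (≤-<-trans (+-monoˡ-≤ (top v) (s≤s (m≤m+n j d))) q)) q)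
vertical {n = n} {v} {g} iv j j′ p p′ | inj₂ j′≤j with m≤n⇒∃[o]m+o≡n j′≤j
...   | d , refl = down d j′ p′ (proj₂ (column-cell⁻ iv (j′ + d) p))
  where
  down : ∀ d j → colAt v j ≡ true → j + d + top v < n → Path (v ∷ g) (0 , j + d) (0 , j)
  down zero    j p q rewrite +-identityʳ j = here p
  down (suc d) j p q rewrite +-suc j d = path-trans (down d (suc j) next q) (step next (inj₁ (refl , inj₂ refl)) (here p))
    where
    next : colAt v (suc j) ≡ true
    next = column-cell⁺ iv (suc j) (m≤n⇒m≤1+n (proj₁ (column-cell⁻ iv j p))) (≤-<-trans (+-monoˡ-≤ (top v) (s≤s (m≤m+n j d))) q)

-- The larger of the two lower gaps is a row of both columns; `meets` bounds it from above in the
-- other column.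
common-row : ∀ {n} {v w : Vec Bool n} → Column v → Column w → meets n (low v) (top v) (low w) (top w) ≡ true →
  ∃[ s ] colAt v s ≡ true × colAt w s ≡ true
common-row {n} {v} {w} iv iw m with meets⁻ n (low v) (top v) (low w) (top w) m | ≤-total (low v) (low w)
... | p , q , r | inj₁ l = low w , column-cell⁺ iv (low w) l q , column-cell⁺ iw (low w) ≤-refl p
... | p , q , r | inj₂ l = low v , column-cell⁺ iv (low v) ≤-refl (column-bound iv) , column-cell⁺ iw (low v) l r

chain-connected : ∀ {n k} (v : Vec Bool n) (g : Vec (Vec Bool n) k) → All Column (v ∷ g) → Chain (low v) (top v) g →
  EdgeConnected (v ∷ g)
chain-connected v g       (iv ∷ ig)      ms       zero    j zero     j′ p q = vertical iv j j′ p q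
chain-connected v (w ∷ g) (iv ∷ iw ∷ ig) (m , ms) zero    j (suc i′) j′ p q =
  let (s , p′ , q′) = common-row iv iw m in
  path-trans (vertical iv j s p p′) (step p′ (inj₂ (refl , inj₁ refl))
    (path-shift (chain-connected w g (iw ∷ ig) ms 0 s i′ j′ q′ q)))
chain-connected v (w ∷ g) (iv ∷ iw ∷ ig) (m , ms) (suc i) j zero     j′ p q =
  let (s , p′ , q′) = common-row iv iw m in
  path-trans (path-shift (chain-connected w g (iw ∷ ig) ms i j 0 s p q′)) (step q′ (inj₂ (refl , inj₂ refl)) (vertical iv s j′ p′ q))
chain-connected v (w ∷ g) (iv ∷ iw ∷ ig) (m , ms) (suc i) j (suc i′) j′ p q =
  path-shift (chain-connected w g (iw ∷ ig) ms i j i′ j′ p q)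

-- A discrete intermediate value argument: a step changes the row by at most one.
path-row : ∀ {m n} {g : Grid m n} {i j i′ j′} → Path g (i , j) (i′ , j′) → ∀ r → j ≤ r → r ≤ j′ → ∃[ s ] Cell g s r
path-row {i = i} (here c) r p q rewrite ≤-antisym p q = i , c
path-row {i = i} {j} (step c e π) r p q with m≤n⇒m<n∨m≡n p
path-row {i = i} (step c e π) r p q | inj₂ refl = i , c
path-row (step c (inj₁ (refl , inj₁ refl)) π) r p q | inj₁ l = path-row π r l q
path-row (step c (inj₁ (refl , inj₂ refl)) π) r p q | inj₁ l = path-row π r (≤-trans (n≤1+n _) p) q
path-row (step c (inj₂ (refl , _)) π) r p q | inj₁ l = path-row π r p q

-- To get beyond column r the path must step from r to r + 1, and the ends of such a step lie in one
-- row.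
path-crossing : ∀ {m n} {g : Grid m n} {i j i′ j′} → Path g (i , j) (i′ , j′) → ∀ r → i ≤ r → r < i′ →
  ∃[ s ] Cell g r s × Cell g (suc r) s
path-crossing (here c) r p q = contradiction (≤-trans q p) (<-irrefl refl)
path-crossing (step c (inj₁ (refl , _)) π) r p q = path-crossing π r p q
path-crossing {j = j} (step c (inj₂ (refl , inj₁ refl)) π) r p q with m≤n⇒m<n∨m≡n p
... | inj₁ l    = path-crossing π r l q
... | inj₂ refl = j , c , path-start π
path-crossing (step c (inj₂ (refl , inj₂ refl)) π) r p q = path-crossing π r (≤-trans (n≤1+n _) p) q

Admissible : ∀ {n k} → Vec Bool n → Vec (Vec Bool n) k → Set
Admissible v g = Valley low expanding (low v) g × Valley top expanding (top v) g × Chain (low v) (top v) g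

admissible⇒IsCP : ∀ {n k} (v : Vec Bool n) (g : Vec (Vec Bool n) k) → All Column (v ∷ g) → Admissible v g → IsCP (v ∷ g)
admissible⇒IsCP {n} {k} v g iv (L , T , ms) = (0 , filled 0 (s≤s z≤n)) , connected , column-convex , row-convex , filled , fills-rows
  where
  connected : EdgeConnected (v ∷ g)
  connected = chain-connected v g iv ms
  column-convex : ColumnConvex (v ∷ g)
  column-convex i j₁ j₂ j p q r s =
    let (l , a , _) = cell⁻ iv i j₁ p ; (_ , _ , c) = cell⁻ iv i j₂ q in
    cell⁺ iv i j l (≤-trans a r) (≤-<-trans (+-monoˡ-≤ (nth top (v ∷ g) i) s) c)
  row-convex : RowConvex (v ∷ g)
  row-convex j i₁ i₂ i p q r s =
    let (_ , a₁ , c₁) = cell⁻ iv i₁ j p ; (l , a₂ , c₂) = cell⁻ iv i₂ j q in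
    cell⁺ iv i j (≤-<-trans s l)
      (≤-trans (valley-convex low expanding v g L i₁ i i₂ r s (≤-pred l)) (⊔-lub a₁ a₂))
      (≤-<-trans (+-monoʳ-≤ j (valley-convex top expanding v g T i₁ i i₂ r s (≤-pred l)))
        (gap (nth top (v ∷ g) i₁) (nth top (v ∷ g) i₂) c₁ c₂))
    where
    gap : ∀ c c′ → j + c < n → j + c′ < n → j + (c ⊔ c′) < n
    gap c c′ p q with ⊔-sel c c′
    ... | inj₁ e rewrite e = p
    ... | inj₂ e rewrite e = q
  bottom : ∀ i → i < suc k → Cell (v ∷ g) i (nth low (v ∷ g) i)
  bottom i l = cell⁺ iv i (nth low (v ∷ g) i) l ≤-refl (nth-bound iv i l)
  filled : ∀ i → i < suc k → ∃[ j ] Cell (v ∷ g) i j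
  filled i l = nth low (v ∷ g) i , bottom i l
  fills-rows : FillsRows (v ∷ g)
  -- Some column touches the bottom of the box and some column its top; a path between these two
  -- cells visits every row.
  fills-rows j j<n =
    let (i₀ , l₀ , e₀) = valley-zero low v g L ; (i₁ , l₁ , e₁) = valley-zero top v g T
        b = cell⁺ iv i₀ 0 (s≤s l₀) (≤-reflexive e₀) (≤-<-trans (m≤n+m _ (nth low (v ∷ g) i₀)) (nth-bound iv i₀ (s≤s l₀)))
        t = cell⁺ iv i₁ (ℕ.pred n) (s≤s l₁) (low≤ i₁ (s≤s l₁)) (subst (λ c → ℕ.pred n + c < n) (sym e₁) top-row)
    in path-row (connected i₀ 0 i₁ (ℕ.pred n) b t) j z≤n (<⇒≤pred j<n)
    where
    low≤ : ∀ i → i < suc k → nth low (v ∷ g) i ≤ ℕ.pred n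
    low≤ i l = <⇒≤pred (≤-<-trans (m≤m+n _ _) (nth-bound iv i l))
    top-row : ℕ.pred n + 0 < n
    top-row rewrite +-identityʳ (ℕ.pred n) = pred< n j<n
      where
      pred< : ∀ n → j < n → ℕ.pred n < n
      pred< (suc n) _ = ≤-refl

-- From convex polyominoes to admissible sequences

Adjacents : ∀ {m n} → Grid m n → Set
Adjacents {m} g = ∀ i → suc i < m → ∃[ s ] Cell g i s × Cell g (suc i) s

-- Unlike `FillsRows`, these properties pass to the grid without its first column, as the recursion
-- requires; `adjacents` is all that is kept of connectedness.
record Shape {m n} (g : Grid m n) : Set where
  field
    columns-of : All Column g
    adjacents  : Adjacents g
    row-convex : RowConvex g

shape-tail : ∀ {m n} {v : Vec Bool n} {g : Grid m n} → Shape (v ∷ g) → Shape g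
shape-tail s = record
  { columns-of = All.tail columns-of
  ; adjacents  = λ i l → adjacents (suc i) (s≤s l)
  ; row-convex = λ j i₁ i₂ i p q r t → row-convex j (suc i₁) (suc i₂) (suc i) p q (s≤s r) (s≤s t)
  }
  where open Shape s

Persistent : (∀ {n} → Vec Bool n → ℕ) → Set
Persistent f = ∀ {n k} (v w : Vec Bool n) (g : Vec (Vec Bool n) k) → Shape (v ∷ w ∷ g) → f v < f w → ∀ i → i ≤ k → f w ≤ nth f (w ∷ g) i

-- If column w no longer reaches a row in which v has a cell, then by row convexity no later column does.
low-persistent : Persistent low
low-persistent v w g s lt zero    l = ≤-refl
low-persistent {n} v w (u ∷ g) s lt (suc i) l with low w ≤? nth low (u ∷ g) i
... | yes p = p
... | no ¬p = contradiction (proj₁ (proj₂ (cell⁻ cols 1 ρ bad))) (<⇒≱ (≤-reflexive ρ-eq))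
  where
  open Shape s
  cols = columns-of
  ρ : ℕ
  ρ = ℕ.pred (low w)
  ρ-eq : suc ρ ≡ low w
  ρ-eq = suc-pred (low w) {{ℕ.>-nonZero (≤-<-trans z≤n lt)}}
  below-ρ : ∀ {a} → a < low w → a ≤ ρ
  below-ρ {a} a<w = ≤-pred (subst (a <_) (sym ρ-eq) a<w)
  ρ≤ : ∀ {r} → low w ≤ r → ρ ≤ r
  ρ≤ w≤r = ≤-trans (n≤1+n ρ) (≤-trans (≤-reflexive ρ-eq) w≤r)
  ih = low-persistent v w (u ∷ g) s lt i (≤-trans (n≤1+n i) l)
  common = adjacents (suc i) (s≤s (s≤s l))
  r = proj₁ common
  ρ≤r : ρ ≤ r
  ρ≤r = ρ≤ (≤-trans ih (proj₁ (proj₂ (cell⁻ cols (suc i) r (proj₁ (proj₂ common))))))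
  first = adjacents 0 (s≤s (s≤s z≤n))
  cell-v : Cell (v ∷ w ∷ u ∷ g) 0 ρ
  cell-v = cell⁺ cols 0 ρ (s≤s z≤n) (below-ρ lt)
    (≤-<-trans (+-monoˡ-≤ (top v) (ρ≤ (proj₁ (proj₂ (cell⁻ cols 1 (proj₁ first) (proj₂ (proj₂ first)))))))
      (proj₂ (proj₂ (cell⁻ cols 0 (proj₁ first) (proj₁ (proj₂ first))))))
  cell-u : Cell (v ∷ w ∷ u ∷ g) (suc (suc i)) ρ
  cell-u = cell⁺ cols (suc (suc i)) ρ (s≤s (s≤s l)) (below-ρ (≰⇒> ¬p))
    (≤-<-trans (+-monoˡ-≤ (nth top (u ∷ g) i) ρ≤r) (proj₂ (proj₂ (cell⁻ cols (suc (suc i)) r (proj₂ (proj₂ common))))))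
  bad : Cell (v ∷ w ∷ u ∷ g) 1 ρ
  bad = row-convex ρ 0 (suc (suc i)) 1 cell-v cell-u z≤n (s≤s z≤n)

-- Row ρ is the first row above w. Column v reaches it because its upper gap is smaller. Were a
-- later gap smaller as well, the column there would contain ρ too: it meets its predecessor, whose
-- cells lie below ρ by induction, so its bottom is not above ρ. Row convexity would then put a cell
-- of w in row ρ.
top-persistent : Persistent top
top-persistent v w g s lt zero    l = ≤-refl
top-persistent {n} v w (u ∷ g) s lt (suc i) l with top w ≤? nth top (u ∷ g) i
... | yes p = p
... | no ¬p = contradiction (proj₂ (proj₂ (cell⁻ cols 1 ρ bad))) (<⇒≱ (s≤s (≤-reflexive (sym ρ-eq))))
  where
  open Shape s
  cols = columns-of
  ih = top-persistent v w (u ∷ g) s lt i (≤-trans (n≤1+n i) l)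
  ρ : ℕ
  ρ = n ∸ top w
  ρ-eq : ρ + top w ≡ n
  ρ-eq = m∸n+n≡m (≤-trans (m≤n+m (top w) (low w)) (<⇒≤ (nth-bound cols 1 (s≤s (s≤s z≤n)))))
  below-ρ : ∀ r c → top w ≤ c → r + c < n → r ≤ ρ
  below-ρ r c q lt = <⇒≤ (+-cancelʳ-< (top w) r ρ (≤-trans (s≤s (+-monoʳ-≤ r q)) (≤-trans lt (≤-reflexive (sym ρ-eq)))))
  common = adjacents (suc i) (s≤s (s≤s l))
  r = proj₁ common
  r≤ρ : r ≤ ρ
  r≤ρ = below-ρ r (nth top (w ∷ u ∷ g) i) ih (proj₂ (proj₂ (cell⁻ cols (suc i) r (proj₁ (proj₂ common)))))
  first = adjacents 0 (s≤s (s≤s z≤n))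
  cell-v : Cell (v ∷ w ∷ u ∷ g) 0 ρ
  cell-v = cell⁺ cols 0 ρ (s≤s z≤n)
    (≤-trans (proj₁ (proj₂ (cell⁻ cols 0 (proj₁ first) (proj₁ (proj₂ first)))))
      (below-ρ (proj₁ first) (top w) ≤-refl (proj₂ (proj₂ (cell⁻ cols 1 (proj₁ first) (proj₂ (proj₂ first)))))))
    (≤-trans (+-monoʳ-< ρ lt) (≤-reflexive ρ-eq))
  cell-u : Cell (v ∷ w ∷ u ∷ g) (suc (suc i)) ρ
  cell-u = cell⁺ cols (suc (suc i)) ρ (s≤s (s≤s l))
    (≤-trans (proj₁ (proj₂ (cell⁻ cols (suc (suc i)) r (proj₂ (proj₂ common))))) r≤ρ)
    (≤-trans (+-monoʳ-< ρ (≰⇒> ¬p)) (≤-reflexive ρ-eq))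
  bad : Cell (v ∷ w ∷ u ∷ g) 1 ρ
  bad = row-convex ρ 0 (suc (suc i)) 1 cell-v cell-u z≤n (s≤s z≤n)

-- The invariant of the recursion over columns: before the turn the box is still to be touched at
-- the present column or later, after the turn the present gap is the smallest that remains.
Reach : Side → (ℕ → ℕ) → ℕ → Set
Reach expanding   s k = ∃[ i ] i ≤ k × s i ≡ 0
Reach contracting s k = ∀ i → i ≤ k → s 0 ≤ s i

-- At the first strict increase persistence keeps all later gaps positive. The column that touches
-- the box must then be the present one, so its gap is 0 and the turn is legitimate.
shape-valley : (f : ∀ {n} → Vec Bool n → ℕ) → Persistent f → ∀ {n k} p (v : Vec Bool n) (g : Vec (Vec Bool n) k) →
  Shape (v ∷ g) → Reach p (nth f (v ∷ g)) k → Valley f p (f v) g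
shape-valley f per expanding   v []      s (zero , _ , e) = e
shape-valley f per contracting v []      s r = tt
shape-valley f per contracting v (w ∷ g) s r = contracting , rise (r 1 (s≤s z≤n)) , shape-valley f per contracting w g (shape-tail s) later
  where
  later : Reach contracting (nth f (w ∷ g)) _
  later i l with m≤n⇒m<n∨m≡n (r 1 (s≤s z≤n))
  ... | inj₁ lt = per v w g s lt i l
  ... | inj₂ eq = ≤-trans (≤-reflexive (sym eq)) (r (suc i) (s≤s l))
shape-valley f per {k = suc k} expanding v (w ∷ g) s (i , l , e) with f w ≤? f v
... | yes p = expanding , stay p , shape-valley f per expanding w g (shape-tail s) (later i l e)
  where
  later : ∀ i → i ≤ suc k → nth f (v ∷ w ∷ g) i ≡ 0 → Reach expanding (nth f (w ∷ g)) k
  later zero    _       e = 0 , z≤n , n≤0⇒n≡0 (≤-trans p (≤-reflexive e))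
  later (suc i) (s≤s l) e = i , l , e
... | no ¬p = contracting , turn (zero-first i l e) (≰⇒> ¬p) , shape-valley f per contracting w g (shape-tail s) (per v w g s (≰⇒> ¬p))
  where
  zero-first : ∀ i → i ≤ suc k → nth f (v ∷ w ∷ g) i ≡ 0 → f v ≡ 0
  zero-first zero    _       e = e
  zero-first (suc i) (s≤s l) e = contradiction (≤-trans (≰⇒> ¬p) (≤-trans (per v w g s (≰⇒> ¬p) i l) (≤-reflexive e))) λ ()

shape-chain : ∀ {n k} (v : Vec Bool n) (g : Vec (Vec Bool n) k) → Shape (v ∷ g) → Chain (low v) (top v) g
shape-chain v []      s = tt
shape-chain {n} v (w ∷ g) s = meets-true {n} {low v} {top v} {low w} {top w} (nth-bound columns-of 1 (s≤s (s≤s z≤n)))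
    (≤-<-trans (+-monoˡ-≤ (top v) (proj₁ (proj₂ cw))) (proj₂ (proj₂ cv)))
    (≤-<-trans (+-monoˡ-≤ (top w) (proj₁ (proj₂ cv))) (proj₂ (proj₂ cw)))
  , shape-chain w g (shape-tail s)
  where
  open Shape s
  first = adjacents 0 (s≤s (s≤s z≤n))
  cv = cell⁻ columns-of 0 (proj₁ first) (proj₁ (proj₂ first))
  cw = cell⁻ columns-of 1 (proj₁ first) (proj₂ (proj₂ first))

convex-columns : ∀ {m n} (g : Grid m n) → FillsColumns g → ColumnConvex g → All Column g
convex-columns []      fills convex = []
convex-columns (v ∷ g) fills convex =
    column-gaps (proj₂ (proj₂ (convex-column v (fills 0 (s≤s z≤n)) (convex 0))))
  ∷ convex-columns g (λ i l → fills (suc i) (s≤s l)) (λ i → convex (suc i))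

IsCP⇒admissible : ∀ {n k} (v : Vec Bool n) (g : Vec (Vec Bool n) k) → IsCP (v ∷ g) → All Column (v ∷ g) × Admissible v g
IsCP⇒admissible {n} {k} v g (_ , connected , column-convex , row-convex , fills-columns , fills-rows) =
  cols , shape-valley low low-persistent expanding v g shape reach-low
       , shape-valley top top-persistent expanding v g shape reach-top , shape-chain v g shape
  where
  cols : All Column (v ∷ g)
  cols = convex-columns (v ∷ g) fills-columns column-convex
  shape : Shape (v ∷ g)
  shape = record { columns-of = cols ; row-convex = row-convex ; adjacents = λ i l →
    let (j , p) = fills-columns i (≤-trans (n≤1+n _) l) ; (j′ , p′) = fills-columns (suc i) l in
    path-crossing (connected i j (suc i) j′ p p′) i ≤-refl ≤-refl }
  n>0 : 0 < n
  n>0 = ≤-trans (s≤s z≤n) (nth-bound cols 0 (s≤s z≤n))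
  reach-low : Reach expanding (nth low (v ∷ g)) k
  reach-low = let (i , p) = fills-rows 0 n>0 ; (l , q , _) = cell⁻ cols i 0 p in i , ≤-pred l , n≤0⇒n≡0 q
  reach-top : Reach expanding (nth top (v ∷ g)) k
  reach-top = last-row n fills-rows n>0 refl
    where
    last-row : ∀ n′ → (∀ j → j < n′ → ∃[ i ] Cell (v ∷ g) i j) → 0 < n′ → n′ ≡ n → Reach expanding (nth top (v ∷ g)) k
    last-row (suc n′) fills _ refl = let (i , p) = fills n′ ≤-refl ; (l , _ , q) = cell⁻ cols i n′ p in
      i , ≤-pred l , n≤0⇒n≡0 (+-cancelˡ-≤ n′ _ 0 (≤-trans (≤-pred q) (≤-reflexive (sym (+-identityʳ n′)))))

-- The list of polyominoes and its total

module _ (n k : ℕ) where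

  start : Vec (Vec Bool n) (suc k) → Count
  start (v ∷ g) = gridCount n expanding (low v) expanding (top v) g

  -- On candidates the count at q = 1 is 0 or 1, so the convex polyominoes can be selected without
  -- deciding `IsCP` directly.
  counted? : ∀ g → Dec (number (start g) ≡ + 1)
  counted? g = number (start g) ℤ.≟ + 1

  candidates polyominoes : List (Grid (suc k) n)
  candidates  = vectors (columns n) (suc k)
  polyominoes = filter counted? candidates

  columns-of-candidate : ∀ {g} → g ∈ candidates → All Column g
  columns-of-candidate g∈ = All.map (λ v∈ → column-gaps (proj₂ (proj₂ (columns-sound n v∈)))) (vectors-sound (columns n) (suc k) g∈)

  start-admissible : ∀ v g → All Column (v ∷ g) → Admissible v g → start (v ∷ g) ≡ (+ 1 +ε + int (v ∷ g))
  start-admissible v g (c ∷ cs) (L , T , ms) = gridCount-value expanding expanding v g c cs L T ms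

  start-cases : ∀ g → g ∈ candidates → start g ≡ ∅ ⊎ start g ≡ (+ 1 +ε + int g)
  start-cases (v ∷ g) g∈ with gridCount-cases expanding (low v) expanding (top v) g
  ... | inj₁ e   = inj₁ e
  ... | inj₂ adm = inj₂ (start-admissible v g (columns-of-candidate g∈) adm)

  polyominoes-IsCP : ∀ g → (g ∈ polyominoes) ⇔ IsCP g
  polyominoes-IsCP (v ∷ g) = mk⇔ to from
    where
    to : (v ∷ g) ∈ polyominoes → IsCP (v ∷ g)
    to g∈ with ∈-filter⁻ counted? {xs = candidates} g∈
    ... | g∈′ , eq with gridCount-cases expanding (low v) expanding (top v) g
    ...   | inj₁ e   = contradiction (trans (sym eq) (cong number e)) λ ()
    ...   | inj₂ adm = admissible⇒IsCP v g (columns-of-candidate g∈′) adm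
    from : IsCP (v ∷ g) → (v ∷ g) ∈ polyominoes
    from cp = let (cols , adm) = IsCP⇒admissible v g cp in
      ∈-filter⁺ counted? (vectors-complete (columns n) (All.map columns-complete cols)) (cong number (start-admissible v g cols adm))

  -- A selected grid contributes its `int` as ε-part and a rejected one contributes 0, so filtering
  -- does not change the sum.
  filtered-total : ∀ xs → (∀ g → g ∈ xs → start g ≡ ∅ ⊎ start g ≡ (+ 1 +ε + int g)) →
    + sumℕ (map int (filter counted? xs)) ≡ total (sumOver xs start)
  filtered-total []       p = refl
  filtered-total (g ∷ xs) p with p g (here refl) | number (start g) ℤ.≟ + 1 | filtered-total xs (λ h h∈ → p h (there h∈))
  ... | inj₁ e | yes eq | _  = contradiction (trans (sym eq) (cong number e)) λ ()
  ... | inj₁ e | no  _  | ih = trans ih (cong total (sym (trans (cong (_⊞ sumOver xs start) e) (⊞-identityˡ _))))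
  ... | inj₂ e | no neq | _  = contradiction (cong number e) neq
  ... | inj₂ e | yes _  | ih = trans (cong (ℤ._+_ (+ int g)) ih) (sym (trans (cong (λ u → total (u ⊞ sumOver xs start)) e) (add (sumOver xs start))))
    where
    add : ∀ u → total ((+ 1 +ε + int g) ⊞ u) ≡ + int g ℤ.+ total u
    add (a +ε b) = refl

  polyominoes-IntSum : IntSum (suc k) n (sumℕ (map int polyominoes))
  polyominoes-IntSum = polyominoes , Uniqueₚ.filter⁺ counted? (vectors-unique (columns-unique n) (suc k)) , polyominoes-IsCP , refl

candidates-total : ∀ t k → sumOver (candidates (suc t) k) (start (suc t) k) ≡ diagonal (λ a c → va k a 0 c) t
candidates-total t k = begin
  sumOver (candidates (suc t) k) (start (suc t) k)
    ≡⟨ sumOver-vectors (columns (suc t)) k (start (suc t) k) ⟩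
  sumOver (columns (suc t)) (λ v → sumOver (vectors (columns (suc t)) k) (gridCount (suc t) expanding (low v) expanding (top v)))
    ≡⟨ sumOver-cong (columns (suc t)) (λ v _ → gridCount-sum (suc t) k expanding (low v) expanding (top v)) ⟩
  sumOver (columns (suc t)) (λ v → completions (suc t) k expanding (low v) expanding (top v))
    ≡⟨ sumOver-columns (suc t) (λ a c → completions (suc t) k expanding a expanding c) ⟩
  Sum (suc t) (λ a → Sum (suc t) (λ c → when (suc (a + c) ≤ᵇ suc t) (completions (suc t) k expanding a expanding c)))
    ≡⟨ completions-total t k ⟩
  diagonal (λ a c → va k a 0 c) t ∎
  where open ≡.≡-Reasoning

empty-IntSum : ∀ m n → (∀ (g : Grid m n) i j → ¬ Cell g i j) → IntSum m n 0
empty-IntSum m n no-cell = [] , [] , (λ g → mk⇔ (λ ()) (λ { ((i , j , p) , _) → contradiction p (no-cell g i j) })) , refl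

rowless : ∀ {m} (g : Grid m 0) i j → ¬ Cell g i j
rowless ([] ∷ g) zero    j ()
rowless ([] ∷ g) (suc i) j p = rowless g i j p

theorem4p1 : (S T U : Series) →
    S 0 0 ≡ + 1 → S ⊛ S ≈ₛ D →
    T ⊛ S ^ₛ 5 ≈ₛ 𝟙 →
    U ⊛ D ^ₛ 4 ≈ₛ 𝟙 →
    (m n : ℕ) → Σ ℕ (λ k → IntSum m n k × + k ≡ ((P₁ ⊕ P₂) ⊛ U ⊕ P₃ ⊛ T) m n)
-- A box without columns or without rows contains no cell and hence no polyomino, so the empty list
-- serves; the series has no such terms because y · VA 0 is divisible by x y.
theorem4p1 S T U S₀₀ S² TS⁵ UD⁴ zero    n       = 0 , empty-IntSum 0 n (λ { [] i j () }) , no-columns S T U S₀₀ S² TS⁵ UD⁴ n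
theorem4p1 S T U S₀₀ S² TS⁵ UD⁴ (suc m) zero    = 0 , empty-IntSum (suc m) 0 rowless , no-rows S T U S₀₀ S² TS⁵ UD⁴ (suc m)
theorem4p1 S T U S₀₀ S² TS⁵ UD⁴ (suc m) (suc n) = sumℕ (map int (polyominoes (suc n) m)) , polyominoes-IntSum (suc n) m ,
  trans (filtered-total (suc n) m (candidates (suc n) m) (start-cases (suc n) m))
    (trans (cong total (candidates-total n m)) (counting-formula S T U S₀₀ S² TS⁵ UD⁴ m n))
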